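{- Let $G$ be a finite simple graph with maximum degree $\Delta(G)\geq 3$, and let $m,n$ be positive integers with $1<m<n$ and $m$ even. Then $\chi(G^{\frac{m}{n}})=\omega(G^{\frac{m}{n}})$.
   Context: For a graph $G$ and positive integer $n$, the $n$-subdivision $G^{\frac{1}{n}}$ is obtained from $G$ by replacing each edge with a path of length $n$. For a graph $H$ and positive integer $m$, the $m$-th power $H^m$ is the graph on $V(H)$ in which two distinct vertices are adjacent iff their distance in $H$ is at most $m$. The fractional power is $G^{\frac{m}{n}}=(G^{\frac{1}{n}})^m$. $\chi$ denotes the chromatic number and $\omega$ the clique number. -}

module Defs where

open import Data.Nat as ℕ using (ℕ; zero; suc; _∸_; _≤_; _⊔_)
open import Data.Fin as Fin using (Fin; zero; suc; inject₁)
open import Data.Fin.Properties using ()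
open import Data.Bool using (Bool; true; false; T)
open import Data.List using (List; map; foldr; allFin)
open import Data.Nat.ListAction using (sum)
open import Data.Maybe using (Maybe; just; nothing)
import Data.Maybe as Maybe
open import Data.Sum using (_⊎_; inj₁; inj₂)
open import Data.Product using (Σ; _×_; _,_; proj₁; proj₂; ∃)
open import Relation.Binary.PropositionalEquality using (_≡_; _≢_)
open import Function.Definitions using (Injective)

record FinSimpleGraph : Set where
  field
    N      : ℕ
    adj    : Fin N → Fin N → Bool
    sym    : ∀ u v → adj u v ≡ adj v u
    irrefl : ∀ v → adj v v ≡ false
open FinSimpleGraph public

boolToℕ : Bool → ℕ
boolToℕ true  = 1
boolToℕ false = 0

degree : (G : FinSimpleGraph) → Fin (N G) → ℕ
degree G v = sum (map (λ w → boolToℕ (adj G v w)) (allFin (N G)))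

maxDegree : FinSimpleGraph → ℕ
maxDegree G = foldr _⊔_ 0 (map (degree G) (allFin (N G)))

record Graph : Set₁ where
  field
    Vtx : Set
    Adj : Vtx → Vtx → Set
open Graph public

-- Edges of G, each listed once as (u , v) with u < v.
Edge : FinSimpleGraph → Set
Edge G = Σ (Fin (N G) × Fin (N G))
           (λ p → (proj₁ p Fin.< proj₂ p) × T (adj G (proj₁ p) (proj₂ p)))

-- n-subdivision G^{1/n}: original vertices plus n-1 internal vertices per edge.
SubVtx : (G : FinSimpleGraph) → ℕ → Set
SubVtx G n = Fin (N G) ⊎ (Edge G × Fin (n ∸ 1))

-- position i ∈ {1,…,k+1} along a path of length k+1: internal index i-1 if i ≤ k,
-- nothing if i = k+1 (the far endpoint).  Argument is i-1 : Fin (suc k).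
innerPos : (k : ℕ) → Fin (suc k) → Maybe (Fin k)
innerPos zero    zero    = nothing
innerPos (suc k) zero    = just zero
innerPos (suc k) (suc i) = Maybe.map suc (innerPos k i)

-- pos e i : the i-th vertex (0 ≤ i ≤ n) of the path replacing edge e = uv,
-- with pos e 0 = u and pos e n = v.
pos : (G : FinSimpleGraph) (n : ℕ) → Edge G → Fin (suc n) → SubVtx G n
pos G n       ((u , v) , _) zero = inj₁ u
pos G zero    ((u , v) , _) (suc ())
pos G (suc k) ((u , v) , p) (suc i) with innerPos k i
... | just j  = inj₂ (((u , v) , p) , j)
... | nothing = inj₁ v

data SubAdj (G : FinSimpleGraph) (n : ℕ) : SubVtx G n → SubVtx G n → Set where
  fwd : (e : Edge G) (i : Fin n) →
        SubAdj G n (pos G n e (inject₁ i)) (pos G n e (suc i))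
  bwd : (e : Edge G) (i : Fin n) →
        SubAdj G n (pos G n e (suc i)) (pos G n e (inject₁ i))

subdivision : FinSimpleGraph → ℕ → Graph
subdivision G n = record { Vtx = SubVtx G n ; Adj = SubAdj G n }

data Walk (H : Graph) : Vtx H → Vtx H → ℕ → Set where
  [] : ∀ {x} → Walk H x x 0
  _∷_ : ∀ {x y z l} → Adj H x y → Walk H y z l → Walk H x z (suc l)

power : Graph → ℕ → Graph
power H m = record
  { Vtx = Vtx H
  ; Adj = λ x y → x ≢ y × Σ ℕ (λ l → l ≤ m × Walk H x y l) }

fracPower : FinSimpleGraph → ℕ → ℕ → Graph
fracPower G m n = power (subdivision G n) m

ProperColouring : (H : Graph) (k : ℕ) → (Vtx H → Fin k) → Set
ProperColouring H k c = ∀ x y → Adj H x y → c x ≢ c y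

Colourable : Graph → ℕ → Set
Colourable H k = Σ (Vtx H → Fin k) (ProperColouring H k)

HasClique : Graph → ℕ → Set
HasClique H k = Σ (Fin k → Vtx H) λ f →
  Injective _≡_ _≡_ f × (∀ i j → i ≢ j → Adj H (f i) (f j))

IsChromaticNumber : Graph → ℕ → Set
IsChromaticNumber H k = Colourable H k × (∀ j → Colourable H j → k ≤ j)

IsCliqueNumber : Graph → ℕ → Set
IsCliqueNumber H k = HasClique H k × (∀ j → HasClique H j → j ≤ k)

{-# OPTIONS --safe #-}

-- Write m = 2k, n = 2k + 1 + r and call the vertices of G hubs.  The ball of radius k around a hub of maximum degree Δ is
-- a clique with Δk + 1 vertices, so it is enough to colour with Δk + 1 colours.  Since any 2k + 1 consecutive vertices of
-- an edge path differ, repeating 2k + 1 of them reduces the problem to r ≤ 2k.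
--
-- One colour goes to the hubs, the others are pairs of a class d < Δ and a level l ≤ k.  Each half-edge receives a class,
-- the classes at a hub being distinct, and the i-th vertex of the half-edge the colour of that class and of level i, up
-- to a permutation of the levels.  The r middle vertices take high levels of classes of other half-edges.  By König's
-- theorem for the bipartite graph G^{1/2} the two halves of each edge can be given different classes.  If Δ ≥ 4 this
-- leaves two classes for the middle.
--
-- Let Δ = 3.  If r ≤ k, the one class left is used from both ends, its levels being ordered oppositely at the two hubs; the
-- orders can be chosen because the labelling can be modified so that the edges with a given pair of classes form no cycle.
-- If r > k, the classes come from a proper edge colouring with four colours: three of them are classes, so the halves of
-- such an edge agree and two classes are left, while the edges of the fourth colour form a matching.  There the levels of
-- all classes are ordered oppositely at the two hubs and the middle uses the classes of the ends too; a union of two matchings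
-- is bipartite, so the orders exist.  This is one colour short when r − k is odd; then four colours are set aside for
-- a total labelling of G, which colours the hubs and four vertices of each edge path.
module Submission where

open import Defs renaming (sym to adj-sym; irrefl to adj-irrefl)
open import Data.Nat
open import Data.Nat.Properties
open import Data.Nat.Divisibility using (_∣_; divides)
open import Data.Nat.ListAction using (sum)
open import Data.Nat.DivMod using (_/_; _%_; m≡m%n+[m/n]*n; m%n<n)
open import Data.Bool using (Bool; true; false; T; not; _∧_; _∨_; _xor_; if_then_else_)
open import Algebra.Properties.CommutativeSemigroup +-commutativeSemigroup using (interchange)
open import Data.Bool.Properties as Bool using (T?; T-irrelevant; not-¬; ¬-not; not-involutive; not-injective)
open import Data.Fin as Fin using (Fin; zero; suc; toℕ; fromℕ<; inject₁; inject≤; #_)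
import Data.Fin.Properties as Fin
open import Data.Fin.Induction using (<-weakInduction; >-weakInduction)
open import Relation.Binary.Definitions using (tri<; tri≈; tri>)
open import Data.List as List using (List; []; _∷_; _++_; cartesianProductWith; cartesianProduct; filter; allFin; foldr; length)
open import Data.List.Membership.Propositional using (_∈_; find; lose)
import Data.List.Membership.Propositional.Properties as Mem
open import Data.List.Relation.Unary.All as All using (All; []; _∷_)
import Data.List.Relation.Unary.All.Properties as All
open import Data.List.Relation.Unary.Any as Any using (Any; here; there)
import Data.List.Relation.Unary.Any.Properties as Any
open import Data.List.Relation.Unary.Unique.Propositional using (Unique; []; _∷_)
import Data.List.Relation.Unary.Unique.Propositional.Properties as Unique
open import Data.Vec as Vec using (Vec; []; _∷_; zipWith; replicate; lookup)
open import Data.Product using (_×_; _,_; Σ; proj₁; proj₂)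
open import Data.Sum using (_⊎_; inj₁; inj₂)
open import Data.Sum.Properties using (inj₁-injective; inj₂-injective)
open import Data.Empty using (⊥; ⊥-elim)
open import Data.Unit using (⊤; tt)
open import Data.Maybe using (just; nothing)
open import Function using (_∘_; id; case_of_)
open import Function.Definitions using (Injective)
open import Relation.Nullary
open import Relation.Nullary.Decidable using (isYes; toWitness; _×-dec_; _⊎-dec_; _→-dec_; ¬?)
open import Relation.Binary.PropositionalEquality

-- The clique leaves no slack: in the ball of a hub of degree Δ each colour occurs exactly once. So
-- the t-th middle vertex on the side of u, at distance k + t from u, can only repeat a colour
-- placed around u beyond depth k - t; hence the high levels, and both ends want the same ones. In
-- opposite orders the t-th vertex of one side and the s-th of the other share a colour of the one
-- spare class only if t + s = r + 1, and then they are the same vertex.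
--
-- For r > k and end classes a ≠ b the spare class serves k middle vertices, and the others must
-- come from a and b. In opposite orders the s-th middle vertex on the side of v, coloured from the
-- class a of u, repeats the s-th vertex after u. They are more than 2k apart iff 2s ≤ r - k, so
-- each side gains half of r - k, rounded down. This is where the parity of r - k enters.
--
-- In the odd case one level of each of the three classes is given up. The three colours gained and
-- the hub colour are the four of the total labelling, 3(k - 1) + 4 = 3k + 1, and the remaining
-- middle has r - 2 vertices, whose excess over k - 1 is even again.

-- Linear arithmetic by Fourier-Motzkin elimination

module Linear where

  infix 7 1+_
  infixl 6 _:+_
  infix 5 _:≤_ _:<_ _:≡_
  infixr 4 _:⇒_

  data Expr (n : ℕ) : Set where
    var  : Fin n → Expr n
    con  : ℕ → Expr n
    _:+_ : Expr n → Expr n → Expr n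

  1+_ : ∀ {n} → Expr n → Expr n
  1+ e = con 1 :+ e

  data Atom (n : ℕ) : Set where
    _:≤_ _:<_ _:≡_ : Expr n → Expr n → Atom n
    absurd : Atom n

  data Form (n : ℕ) : Set where
    goal : Atom n → Form n
    _:⇒_ : Atom n → Form n → Form n

  ⟦_⟧ : ∀ {n} → Expr n → Vec ℕ n → ℕ
  ⟦ var i ⟧ ρ = lookup ρ i
  ⟦ con c ⟧ ρ = c
  ⟦ e :+ f ⟧ ρ = ⟦ e ⟧ ρ + ⟦ f ⟧ ρ

  ⟦_⟧ₐ : ∀ {n} → Atom n → Vec ℕ n → Set
  ⟦ e :≤ f ⟧ₐ ρ = ⟦ e ⟧ ρ ≤ ⟦ f ⟧ ρ
  ⟦ e :< f ⟧ₐ ρ = ⟦ e ⟧ ρ < ⟦ f ⟧ ρ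
  ⟦ e :≡ f ⟧ₐ ρ = ⟦ e ⟧ ρ ≡ ⟦ f ⟧ ρ
  ⟦ absurd ⟧ₐ ρ = ⊥

  ⟦_⟧f : ∀ {n} → Form n → Vec ℕ n → Set
  ⟦ goal a ⟧f ρ = ⟦ a ⟧ₐ ρ
  ⟦ a :⇒ f ⟧f ρ = ⟦ a ⟧ₐ ρ → ⟦ f ⟧f ρ

  dot : ∀ {n} → Vec ℕ n → Vec ℕ n → ℕ
  dot [] [] = 0
  dot (a ∷ u) (x ∷ ρ) = a * x + dot u ρ

  _⊕_ : ∀ {n} → Vec ℕ n → Vec ℕ n → Vec ℕ n
  _⊕_ = zipWith _+_

  _⊖_ : ∀ {n} → Vec ℕ n → Vec ℕ n → Vec ℕ n
  _⊖_ = zipWith _∸_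

  dot-⊕ : ∀ {n} (u v ρ : Vec ℕ n) → dot (u ⊕ v) ρ ≡ dot u ρ + dot v ρ
  dot-⊕ [] [] [] = refl
  dot-⊕ (a ∷ u) (b ∷ v) (x ∷ ρ) =
    trans (cong₂ _+_ (*-distribʳ-+ x a b) (dot-⊕ u v ρ)) (interchange (a * x) (b * x) (dot u ρ) (dot v ρ))

  dot-scale : ∀ {n} c (u ρ : Vec ℕ n) → dot (Vec.map (c *_) u) ρ ≡ c * dot u ρ
  dot-scale c [] [] = sym (*-zeroʳ c)
  dot-scale c (a ∷ u) (x ∷ ρ) =
    trans (cong₂ _+_ (*-assoc c a x) (dot-scale c u ρ)) (sym (*-distribˡ-+ c (a * x) (dot u ρ)))

  -- Both sides are the maximum of `a` and `b`. This is what justifies cancelling with truncated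
  -- subtraction.
  max-comm : ∀ a b → a + (b ∸ a) ≡ b + (a ∸ b)
  max-comm a b = trans (sym (m⊔n≡m+n∸m a b)) (trans (⊔-comm a b) (m⊔n≡m+n∸m b a))
    where
    m⊔n≡m+n∸m : ∀ m n → m ⊔ n ≡ m + (n ∸ m)
    m⊔n≡m+n∸m zero n = refl
    m⊔n≡m+n∸m (suc m) zero = sym (cong suc (+-identityʳ m))
    m⊔n≡m+n∸m (suc m) (suc n) = cong suc (m⊔n≡m+n∸m m n)

  ⊕⊖-comm : ∀ {n} (u v : Vec ℕ n) → u ⊕ (v ⊖ u) ≡ v ⊕ (u ⊖ v)
  ⊕⊖-comm [] [] = refl
  ⊕⊖-comm (a ∷ u) (b ∷ v) = cong₂ _∷_ (max-comm a b) (⊕⊖-comm u v)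

  dot-zero : ∀ {n} (ρ : Vec ℕ n) → dot (replicate n 0) ρ ≡ 0
  dot-zero [] = refl
  dot-zero (x ∷ ρ) = dot-zero ρ

  unit : ∀ {n} → Fin n → Vec ℕ n
  unit zero = 1 ∷ replicate _ 0
  unit (suc i) = 0 ∷ unit i

  dot-unit : ∀ {n} (i : Fin n) ρ → dot (unit i) ρ ≡ lookup ρ i
  dot-unit zero (x ∷ ρ) rewrite dot-zero ρ | +-identityʳ x = +-identityʳ x
  dot-unit (suc i) (x ∷ ρ) = dot-unit i ρ

  -- Index 0 holds the constant term, so a normal form is evaluated in the environment `1 ∷ ρ`.
  norm : ∀ {n} → Expr n → Vec ℕ (suc n)
  norm (var i) = 0 ∷ unit i
  norm (con c) = c ∷ replicate _ 0
  norm (e :+ f) = norm e ⊕ norm f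

  norm-sound : ∀ {n} (e : Expr n) ρ → dot (norm e) (1 ∷ ρ) ≡ ⟦ e ⟧ ρ
  norm-sound (var i) ρ = dot-unit i ρ
  norm-sound (con c) ρ rewrite dot-zero ρ | *-identityʳ c = +-identityʳ c
  norm-sound (e :+ f) ρ = trans (dot-⊕ (norm e) (norm f) (1 ∷ ρ)) (cong₂ _+_ (norm-sound e ρ) (norm-sound f ρ))

  Ineq : ℕ → Set
  Ineq n = Vec ℕ n × Vec ℕ n

  Holds : ∀ {n} → Vec ℕ n → Ineq n → Set
  Holds ρ (l , r) = dot l ρ ≤ dot r ρ

  -- Subtracting on both sides keeps all coefficients natural and leaves each variable on at most
  -- one side, so that an inequality bounds it from above, from below or not at all.
  cancel : ∀ {n} → Ineq n → Ineq n
  cancel (l , r) = l ⊖ r , r ⊖ l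

  cancel-sound : ∀ {n} (ρ : Vec ℕ n) c → Holds ρ c → Holds ρ (cancel c)
  cancel-sound ρ (l , r) h = +-cancelˡ-≤ (dot l ρ) _ _ (begin
    dot l ρ + dot (l ⊖ r) ρ ≤⟨ +-monoˡ-≤ _ h ⟩
    dot r ρ + dot (l ⊖ r) ρ ≡⟨ sym (dot-⊕ r (l ⊖ r) ρ) ⟩
    dot (r ⊕ (l ⊖ r)) ρ     ≡⟨ cong (λ w → dot w ρ) (⊕⊖-comm r l) ⟩
    dot (l ⊕ (r ⊖ l)) ρ     ≡⟨ dot-⊕ l (r ⊖ l) ρ ⟩
    dot l ρ + dot (r ⊖ l) ρ ∎)
    where open ≤-Reasoning

  -- Fourier–Motzkin: the combination of two inequalities in which variable i cancels.
  combine : ∀ {n} → Fin n → Ineq n → Ineq n → Ineq n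
  combine i (l , r) (l′ , r′) = cancel (Vec.map (p *_) l ⊕ Vec.map (q *_) l′ , Vec.map (p *_) r ⊕ Vec.map (q *_) r′)
    where
    p = lookup r′ i
    q = lookup l i

  combine-sound : ∀ {n} i (ρ : Vec ℕ n) c d → Holds ρ c → Holds ρ d → Holds ρ (combine i c d)
  combine-sound i ρ (l , r) (l′ , r′) h h′ = cancel-sound ρ
    (Vec.map (p *_) l ⊕ Vec.map (q *_) l′ , Vec.map (p *_) r ⊕ Vec.map (q *_) r′) (begin
    dot (Vec.map (p *_) l ⊕ Vec.map (q *_) l′) ρ            ≡⟨ dot-⊕ (Vec.map (p *_) l) (Vec.map (q *_) l′) ρ ⟩
    dot (Vec.map (p *_) l) ρ + dot (Vec.map (q *_) l′) ρ    ≡⟨ cong₂ _+_ (dot-scale p l ρ) (dot-scale q l′ ρ) ⟩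
    p * dot l ρ + q * dot l′ ρ                              ≤⟨ +-mono-≤ (*-monoʳ-≤ p h) (*-monoʳ-≤ q h′) ⟩
    p * dot r ρ + q * dot r′ ρ                              ≡⟨ sym (cong₂ _+_ (dot-scale p r ρ) (dot-scale q r′ ρ)) ⟩
    dot (Vec.map (p *_) r) ρ + dot (Vec.map (q *_) r′) ρ    ≡⟨ sym (dot-⊕ (Vec.map (p *_) r) (Vec.map (q *_) r′) ρ) ⟩
    dot (Vec.map (p *_) r ⊕ Vec.map (q *_) r′) ρ ∎)
    where
    open ≤-Reasoning
    p = lookup r′ i
    q = lookup l i

  isZero : ∀ {n} → Vec ℕ n → Bool
  isZero [] = true
  isZero (zero ∷ u) = isZero u
  isZero (suc _ ∷ u) = false

  isZero-sound : ∀ {n} (u ρ : Vec ℕ n) → T (isZero u) → dot u ρ ≡ 0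
  isZero-sound [] [] _ = refl
  isZero-sound (zero ∷ u) (x ∷ ρ) z = isZero-sound u ρ z

  false? : ∀ {n} → Ineq (suc n) → Bool
  false? (zero ∷ l , r) = false
  false? (suc c ∷ l , r) = isZero r

  false?-sound : ∀ {n} (ρ : Vec ℕ n) c → T (false? c) → Holds (1 ∷ ρ) c → ⊥
  false?-sound ρ (suc c ∷ l , r) z h rewrite isZero-sound r (1 ∷ ρ) z = case h
    where
    case : suc c * 1 + dot l ρ ≤ 0 → ⊥
    case ()

  anyFalse : ∀ {n} → List (Ineq (suc n)) → Bool
  anyFalse [] = false
  anyFalse (c ∷ cs) = false? c ∨ anyFalse cs

  anyFalse-sound : ∀ {n} (ρ : Vec ℕ n) cs → T (anyFalse cs) → All (Holds (1 ∷ ρ)) cs → ⊥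
  anyFalse-sound ρ (c ∷ cs) t (h ∷ hs) with false? c in eq
  ... | true = false?-sound ρ c (subst T (sym eq) tt) h
  ... | false = anyFalse-sound ρ cs t hs

  upper lower neither : ∀ {n} → Fin n → Ineq n → Bool
  upper i (l , r) = 0 <ᵇ lookup l i
  lower i (l , r) = 0 <ᵇ lookup r i
  neither i (l , r) = lookup l i + lookup r i ≡ᵇ 0

  eliminate : ∀ {n} → Fin n → List (Ineq n) → List (Ineq n)
  eliminate i cs = filter (λ c → T? (neither i c)) cs
    ++ cartesianProductWith (combine i) (filter (λ c → T? (upper i c)) cs) (filter (λ c → T? (lower i c)) cs)

  eliminate-sound : ∀ {n} i (ρ : Vec ℕ n) cs → All (Holds ρ) cs → All (Holds ρ) (eliminate i cs)
  eliminate-sound i ρ cs hs = All.++⁺ (All.filter⁺ (λ c → T? (neither i c)) hs)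
    (product _ _ (All.filter⁺ (λ c → T? (upper i c)) hs) (All.filter⁺ (λ c → T? (lower i c)) hs))
    where
    row : ∀ c ds → Holds ρ c → All (Holds ρ) ds → All (Holds ρ) (List.map (combine i c) ds)
    row c [] h [] = []
    row c (d ∷ ds) h (h′ ∷ hs′) = combine-sound i ρ c d h h′ ∷ row c ds h hs′
    product : ∀ xs ds → All (Holds ρ) xs → All (Holds ρ) ds → All (Holds ρ) (cartesianProductWith (combine i) xs ds)
    product [] ds [] _ = []
    product (c ∷ xs) ds (h ∷ h′) k = All.++⁺ (row c ds h k) (product xs ds h′ k)

  eliminateAll : ∀ {n} → List (Fin n) → List (Ineq n) → List (Ineq n)
  eliminateAll [] cs = cs
  eliminateAll (i ∷ is) cs = eliminateAll is (eliminate i cs)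

  eliminateAll-sound : ∀ {n} is (ρ : Vec ℕ n) cs → All (Holds ρ) cs → All (Holds ρ) (eliminateAll is cs)
  eliminateAll-sound [] ρ cs hs = hs
  eliminateAll-sound (i ∷ is) ρ cs hs = eliminateAll-sound is ρ _ (eliminate-sound i ρ cs hs)

  -- Elimination argues over the rationals; that the variables are natural numbers enters through
  -- these inequalities and through reading `<` as `1+_ ≤`.
  nonneg : ∀ {n} → List (Ineq (suc n))
  nonneg {n} = List.map (λ i → replicate _ 0 , 0 ∷ unit i) (allFin n)

  nonneg-sound : ∀ {n} (ρ : Vec ℕ n) → All (Holds (1 ∷ ρ)) nonneg
  nonneg-sound {n} ρ = go (allFin n)
    where
    go : ∀ is → All (Holds (1 ∷ ρ)) (List.map (λ i → replicate _ 0 , 0 ∷ unit i) is)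
    go [] = []
    go (i ∷ is) = subst (_≤ dot (unit i) ρ) (sym (dot-zero ρ)) z≤n ∷ go is

  refute : ∀ {n} → List (Ineq (suc n)) → Bool
  refute {n} cs = anyFalse (eliminateAll (List.map suc (allFin n)) (nonneg ++ cs))

  refute-sound : ∀ {n} (ρ : Vec ℕ n) cs → T (refute cs) → All (Holds (1 ∷ ρ)) cs → ⊥
  refute-sound {n} ρ cs t hs = anyFalse-sound ρ _ t
    (eliminateAll-sound (List.map suc (allFin n)) (1 ∷ ρ) _ (All.++⁺ (nonneg-sound ρ) hs))

  leq lt : ∀ {n} → Expr n → Expr n → Ineq (suc n)
  leq e f = cancel (norm e , norm f)
  lt e f = leq (con 1 :+ e) f

  leq-sound : ∀ {n} (e f : Expr n) ρ → ⟦ e ⟧ ρ ≤ ⟦ f ⟧ ρ → Holds (1 ∷ ρ) (leq e f)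
  leq-sound e f ρ h = cancel-sound (1 ∷ ρ) (norm e , norm f)
    (subst₂ _≤_ (sym (norm-sound e ρ)) (sym (norm-sound f ρ)) h)

  hyps : ∀ {n} → Atom n → List (Ineq (suc n))
  hyps (e :≤ f) = leq e f ∷ []
  hyps (e :< f) = lt e f ∷ []
  hyps (e :≡ f) = leq e f ∷ leq f e ∷ []
  hyps absurd = lt (con 0) (con 0) ∷ []

  hyps-sound : ∀ {n} (a : Atom n) ρ → ⟦ a ⟧ₐ ρ → All (Holds (1 ∷ ρ)) (hyps a)
  hyps-sound (e :≤ f) ρ h = leq-sound e f ρ h ∷ []
  hyps-sound (e :< f) ρ h = leq-sound (con 1 :+ e) f ρ h ∷ []
  hyps-sound (e :≡ f) ρ h = leq-sound e f ρ (≤-reflexive h) ∷ leq-sound f e ρ (≤-reflexive (sym h)) ∷ []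

  check : ∀ {n} → List (Ineq (suc n)) → Form n → Bool
  check cs (a :⇒ f) = check (hyps a ++ cs) f
  check cs (goal (e :≤ f)) = refute (lt f e ∷ cs)
  check cs (goal (e :< f)) = refute (leq f e ∷ cs)
  check cs (goal (e :≡ f)) = refute (lt e f ∷ cs) ∧ refute (lt f e ∷ cs)
  check cs (goal absurd) = refute cs

  check-sound : ∀ {n} cs (f : Form n) ρ → T (check cs f) → All (Holds (1 ∷ ρ)) cs → ⟦ f ⟧f ρ
  check-sound cs (a :⇒ f) ρ t hs = λ h → check-sound (hyps a ++ cs) f ρ t (All.++⁺ (hyps-sound a ρ h) hs)
  check-sound cs (goal (e :≤ f)) ρ t hs =
    ≮⇒≥ (λ h → refute-sound ρ _ t (leq-sound (con 1 :+ f) e ρ h ∷ hs))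
  check-sound cs (goal (e :< f)) ρ t hs =
    ≰⇒> (λ h → refute-sound ρ _ t (leq-sound f e ρ h ∷ hs))
  check-sound cs (goal (e :≡ f)) ρ t hs with refute (lt e f ∷ cs) in eq
  ... | true = ≤-antisym
    (≮⇒≥ (λ h → refute-sound ρ _ t (leq-sound (con 1 :+ f) e ρ h ∷ hs)))
    (≮⇒≥ (λ h → refute-sound ρ _ (subst T (sym eq) tt) (leq-sound (con 1 :+ e) f ρ h ∷ hs)))
  check-sound cs (goal absurd) ρ t hs = refute-sound ρ _ t hs

  Π : ∀ n → (Vec ℕ n → Set) → Set
  Π zero P = P []
  Π (suc n) P = ∀ x → Π n (λ ρ → P (x ∷ ρ))

  curry-Π : ∀ n {P : Vec ℕ n → Set} → (∀ ρ → P ρ) → Π n P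
  curry-Π zero f = f []
  curry-Π (suc n) f x = curry-Π n (λ ρ → f (x ∷ ρ))

  Schema : ℕ → ℕ → Set
  Schema m zero = Form m
  Schema m (suc n) = Expr m → Schema m n

  close : ∀ {m} n → Schema m n → Vec (Expr m) n → Form m
  close zero f [] = f
  close (suc n) f (x ∷ xs) = close n (f x) xs

  formula : ∀ n → Schema n n → Form n
  formula n f = close n f (Vec.map var (Vec.allFin n))

  -- The implicit argument is found by evaluating `check`, so a use consists of the formula, the
  -- values of its variables and the proofs of its premises.
  linear : ∀ n (f : Schema n n) {_ : T (check [] (formula n f))} → Π n ⟦ formula n f ⟧f
  linear n f {t} = curry-Π n (λ ρ → check-sound [] (formula n f) ρ t [])

open Linear using (linear; con; _:+_; _:≤_; _:<_; _:≡_; _:⇒_; goal; absurd; 1+_)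

-- Distances in the subdivision

V : FinSimpleGraph → Set
V G = Fin (N G)

infix 4 _⊢_~_
infixr 3 _⇉_
_⊢_~_ : (G : FinSimpleGraph) → V G → V G → Set
G ⊢ u ~ v = adj G u v ≡ true

_⇉_ : FinSimpleGraph → Set → Set
G ⇉ A = V G → V G → A

Injective-at : ∀ (G : FinSimpleGraph) {A : Set} → G ⇉ A → Set
Injective-at G c = ∀ {u v v′} → G ⊢ u ~ v → G ⊢ u ~ v′ → c u v ≡ c u v′ → v ≡ v′

-- A proper colouring of the `w`-th power in terms of positions: for `w ≤ n`, two vertices within
-- distance `w` lie on one edge path or on two paths with a common hub. `cross` starts at position 1
-- because a hub lies on every path leaving it, which makes such a pair a case of `same`.
record Pathwise (G : FinSimpleGraph) (A : Set) (n w : ℕ) : Set where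
  field
    P     : V G → V G → ℕ → A
    hub   : V G → A
    P-hub : ∀ {u v} → G ⊢ u ~ v → P u v 0 ≡ hub u
    P-sym : ∀ {u v i} → G ⊢ u ~ v → i ≤ n → P u v i ≡ P v u (n ∸ i)
    same  : ∀ {u v i j} → G ⊢ u ~ v → i < j → j ≤ n → j ≤ i + w → P u v i ≢ P u v j
    cross : ∀ {u v v′ i j} → G ⊢ u ~ v → G ⊢ u ~ v′ → v ≢ v′ →
            1 ≤ i → 1 ≤ j → i + j ≤ w → P u v i ≢ P u v′ j

T⇐true : ∀ {b} → b ≡ true → T b
T⇐true refl = tt

true⇐T : ∀ {b} → T b → b ≡ true
true⇐T {true} _ = refl

adj-flip : ∀ G {u v} → G ⊢ u ~ v → G ⊢ v ~ u
adj-flip G {u} {v} e = trans (adj-sym G v u) e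

adj-≢ : ∀ G {u v} → G ⊢ u ~ v → u ≢ v
adj-≢ G {u} e refl with trans (sym e) (adj-irrefl G u)
... | ()

module Subdivision (G : FinSimpleGraph) (ν : ℕ) where

  n : ℕ
  n = suc ν

  -- At u v i x : x is the i-th vertex on the path of the edge uv, counted from u.
  data At : V G → V G → ℕ → SubVtx G n → Set where
    start : ∀ {u v} → G ⊢ u ~ v → At u v 0 (inj₁ u)
    end   : ∀ {u v} → G ⊢ u ~ v → At u v n (inj₁ v)
    fwd   : ∀ {u v} (u<v : u Fin.< v) (e : T (adj G u v)) j → At u v (suc (toℕ j)) (inj₂ (((u , v) , u<v , e) , j))
    bwd   : ∀ {u v} (v<u : v Fin.< u) (e : T (adj G v u)) j → At u v (n ∸ suc (toℕ j)) (inj₂ (((v , u) , v<u , e) , j))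

  At-cast : ∀ {u v i j x} → i ≡ j → At u v i x → At u v j x
  At-cast refl at = at

  At-adj : ∀ {u v i x} → At u v i x → G ⊢ u ~ v
  At-adj (start e) = e
  At-adj (end e) = e
  At-adj (fwd _ e _) = true⇐T e
  At-adj (bwd _ e _) = adj-flip G (true⇐T e)

  At-bound : ∀ {u v i x} → At u v i x → i ≤ n
  At-bound (start _) = z≤n
  At-bound (end _) = ≤-refl
  At-bound (fwd _ _ j) = s≤s (<⇒≤ (Fin.toℕ<n j))
  At-bound (bwd _ _ j) = m∸n≤m n (suc (toℕ j))

  At-flip : ∀ {u v i x} → At u v i x → At v u (n ∸ i) x
  At-flip (start e) = end (adj-flip G e)
  At-flip (end {u} {v} e) = At-cast (sym (n∸n≡0 n)) (start (adj-flip G e))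
  At-flip (fwd u<v e j) = bwd u<v e j
  At-flip (bwd {u} {v} v<u e j) =
    At-cast (sym (m∸[m∸n]≡n (s≤s (<⇒≤ (Fin.toℕ<n j))))) (fwd v<u e j)

  innerPos-spec : ∀ k (i : Fin (suc k)) →
    (innerPos k i ≡ nothing × toℕ i ≡ k) ⊎ (Σ (Fin k) λ j → innerPos k i ≡ just j × toℕ j ≡ toℕ i)
  innerPos-spec zero zero = inj₁ (refl , refl)
  innerPos-spec (suc k) zero = inj₂ (zero , refl , refl)
  innerPos-spec (suc k) (suc i) with innerPos-spec k i
  ... | inj₁ (p , q) rewrite p = inj₁ (refl , cong suc q)
  ... | inj₂ (j , p , q) rewrite p = inj₂ (suc j , refl , cong suc q)

  pos-At : ∀ {u v} (u<v : u Fin.< v) (e : T (adj G u v)) (i : Fin (suc n)) →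
    At u v (toℕ i) (pos G n ((u , v) , u<v , e) i)
  pos-At u<v e zero = start (true⇐T e)
  pos-At u<v e (suc i) with innerPos ν i | innerPos-spec ν i
  ... | just j  | inj₂ (.j , refl , q) = At-cast (cong suc q) (fwd u<v e j)
  ... | nothing | inj₁ (refl , q) = At-cast (sym (cong suc q)) (end (true⇐T e))

  step : ∀ {x y} → SubAdj G n x y → Σ (V G) λ u → Σ (V G) λ v → Σ ℕ λ i → At u v i x × At u v (suc i) y
  step (fwd ((u , v) , lt , e) i) =
    u , v , toℕ i , At-cast (Fin.toℕ-inject₁ i) (pos-At lt e (inject₁ i)) , pos-At lt e (suc i)
  step (bwd ((u , v) , lt , e) i) = v , u , n ∸ suc (toℕ i) , At-flip (pos-At lt e (suc i)) ,
    At-cast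
      (trans (cong (n ∸_) (Fin.toℕ-inject₁ i)) (+-∸-assoc 1 (Fin.toℕ<n i)))
      (At-flip (pos-At lt e (inject₁ i)))

  At-inner : ∀ {u v i u′ v′ j z} → At u v i (inj₂ z) → At u′ v′ j (inj₂ z) →
    (u ≡ u′ × v ≡ v′ × i ≡ j) ⊎ (u ≡ v′ × v ≡ u′ × i ≡ n ∸ j)
  At-inner (fwd _ _ _) (fwd _ _ _) = inj₁ (refl , refl , refl)
  At-inner (fwd _ _ j) (bwd _ _ .j) = inj₂ (refl , refl , sym (m∸[m∸n]≡n (s≤s (<⇒≤ (Fin.toℕ<n j)))))
  At-inner (bwd _ _ _) (fwd _ _ _) = inj₂ (refl , refl , refl)
  At-inner (bwd _ _ _) (bwd _ _ _) = inj₁ (refl , refl , refl)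

  At-hub : ∀ {u v i w} → At u v i (inj₁ w) → (i ≡ 0 × u ≡ w) ⊎ (i ≡ n × v ≡ w)
  At-hub (start _) = inj₁ (refl , refl)
  At-hub (end _) = inj₂ (refl , refl)

  n∸i≡1 : ∀ {i} → suc i ≡ n → n ∸ i ≡ 1
  n∸i≡1 {i} refl = trans (+-∸-assoc 1 (≤-refl {i})) (cong suc (n∸n≡0 i))

  -- Only at a hub can a step change the path, and there the other path is entered at position 1.
  local : ∀ {x y u v i} → SubAdj G n x y → At u v i y →
    (Σ (V G) λ w → Σ (V G) λ w′ → y ≡ inj₁ w × At w w′ 1 x)
    ⊎ At u v (suc i) x ⊎ (Σ ℕ λ j → i ≡ suc j × At u v j x)
  local {y = inj₁ w} xy _ with step xy
  ... | u′ , v′ , j , ax , ay with At-hub ay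
  ...   | inj₂ (q , refl) = inj₁ (w , u′ , refl , At-cast (n∸i≡1 q) (At-flip ax))
  local {y = inj₂ z} xy at with step xy
  ... | u′ , v′ , j , ax , ay with At-inner at ay
  ...   | inj₁ (refl , refl , q) = inj₂ (inj₂ (j , q , ax))
  ...   | inj₂ (refl , refl , refl) = inj₂ (inj₁ (At-cast (+-∸-assoc 1 (At-bound ay)) (At-flip ax)))

  -- In `along` the inequality `i ≤ j` is a choice of the end from which the path is read; in `via`
  -- both positions are counted from the common hub.
  data Near (x y : SubVtx G n) (l : ℕ) : Set where
    equal : x ≡ y → Near x y l
    along : ∀ {u v i j} → At u v i x → At u v j y → i ≤ j → j ≤ i + l → Near x y l
    via   : ∀ {u v v′ i j} → At u v i x → At u v′ j y → i + j ≤ l → Near x y l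

  -- A walk this short cannot pass two hubs: in the `via` case a second hub `y` would be the far end
  -- of its path, at distance `n` from the first, against `l < n`.
  prepend : ∀ {x y z l} → l < n → SubAdj G n x y → Near y z l → Near x z (suc l)
  prepend {l = l} l<n xy (equal refl) with step xy
  ... | u , v , i , ax , ay = along ax ay (n≤1+n i)
    (linear 2 (λ i l → goal (1+ i :≤ i :+ (1+ l))) i l)
  prepend {l = l} l<n xy (along {u} {v} {i} {j} ay az i≤j j≤i+l) with local xy ay
  ... | inj₁ (w , w′ , refl , ax) with At-hub ay
  ...   | inj₁ (refl , refl) = via ax az (s≤s j≤i+l)
  ...   | inj₂ (refl , refl) = via ax (At-flip az)
          (subst (λ t → 1 + t ≤ suc l) (sym (m≤n⇒m∸n≡0 i≤j)) (s≤s z≤n))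
  prepend {l = l} l<n xy (along {u} {v} {i} {j} ay az i≤j j≤i+l) | inj₂ (inj₁ ax) with suc i ≤? j
  ... | yes q = along ax az q
          (linear 3 (λ i j l → j :≤ i :+ l :⇒ goal (j :≤ 1+ i :+ (1+ l))) i j l j≤i+l)
  -- Here `i = j`, so `x` lies just beyond `z` and the path has to be read from its other end.
  ... | no q = along (At-flip ax) (At-flip az) (∸-monoʳ-≤ n (<⇒≤ (≰⇒> q)))
          (subst (λ t → n ∸ t ≤ n ∸ suc i + suc l) (≤-antisym i≤j (s≤s⁻¹ (≰⇒> q)))
            (subst (_≤ n ∸ suc i + suc l) (sym (+-∸-assoc 1 (At-bound ax)))
              (linear 2 (λ t l → goal (1+ t :≤ t :+ (1+ l))) (n ∸ suc i) l)))
  prepend {l = l} l<n xy (along {u} {v} {i} {j} ay az i≤j j≤i+l) | inj₂ (inj₂ (i′ , refl , ax)) =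
    along ax az (<⇒≤ i≤j) (subst (j ≤_) (sym (+-suc i′ l)) j≤i+l)
  prepend l<n xy (via ay az ij≤l) with local xy ay
  ... | inj₁ (w , w′ , refl , ax) with At-hub ay
  ...   | inj₁ (refl , refl) = via ax az (s≤s ij≤l)
  ...   | inj₂ (refl , refl) = ⊥-elim (<⇒≱ l<n (m+n≤o⇒m≤o n ij≤l))
  prepend l<n xy (via ay az ij≤l) | inj₂ (inj₁ ax) = via ax az (s≤s ij≤l)
  prepend l<n xy (via ay az ij≤l) | inj₂ (inj₂ (i′ , refl , ax)) = via ax az (m≤n⇒m≤1+n (<⇒≤ ij≤l))

  near : ∀ {x y l} → l ≤ n → Walk (subdivision G n) x y l → Near x y l
  near _ [] = equal refl
  near l≤n (xy ∷ p) = prepend l≤n xy (near (<⇒≤ l≤n) p)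

  module Coloured {A : Set} {w : ℕ} (𝒫 : Pathwise G A n w) (w≤n : w ≤ n) where
    open Pathwise 𝒫

    colour : SubVtx G n → A
    colour (inj₁ u) = hub u
    colour (inj₂ (((u , v) , _) , j)) = P u v (suc (toℕ j))

    colour-At : ∀ {u v i x} → At u v i x → colour x ≡ P u v i
    colour-At (start e) = sym (P-hub e)
    colour-At (end {u} {v} e) = trans (sym (P-hub (adj-flip G e)))
      (trans (P-sym (adj-flip G e) z≤n) refl)
    colour-At (fwd _ _ _) = refl
    colour-At (bwd _ e j) = P-sym (true⇐T e) (s≤s (<⇒≤ (Fin.toℕ<n j)))

    At-injective : ∀ {u v i x y} → At u v i x → At u v i y → x ≡ y
    At-injective ax ay = go ax ay refl
      where
      go : ∀ {u v i j x y} → At u v i x → At u v j y → i ≡ j → x ≡ y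
      go (start _) (start _) _ = refl
      go (start _) (bwd _ _ j) q = ⊥-elim (m<n⇒n≢0 (m<n⇒0<n∸m (s≤s (Fin.toℕ<n j))) (sym q))
      go (end _) (end _) _ = refl
      go (end _) (fwd _ _ j) q = ⊥-elim (<⇒≢ (Fin.toℕ<n j) (sym (suc-injective q)))
      go (end _) (bwd _ _ j) q = ⊥-elim (<⇒≢ (s≤s (m∸n≤m ν (toℕ j))) (sym q))
      go (fwd _ _ j) (end _) q = ⊥-elim (<⇒≢ (Fin.toℕ<n j) (suc-injective q))
      go (fwd a e j) (fwd a′ e′ j′) q with Fin.toℕ-injective (suc-injective q) | <-irrelevant a a′ | T-irrelevant e e′
      ... | refl | refl | refl = refl
      go (fwd a _ _) (bwd a′ _ _) _ = ⊥-elim (<-asym a a′)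
      go (bwd _ _ j) (start _) q = ⊥-elim (m<n⇒n≢0 (m<n⇒0<n∸m (s≤s (Fin.toℕ<n j))) q)
      go (bwd _ _ j) (end _) q = ⊥-elim (<⇒≢ (s≤s (m∸n≤m ν (toℕ j))) q)
      go (bwd a _ _) (fwd a′ _ _) _ = ⊥-elim (<-asym a a′)
      go (bwd a e j) (bwd a′ e′ j′) q
        with Fin.toℕ-injective (∸-cancelˡ-≡ (<⇒≤ (Fin.toℕ<n j)) (<⇒≤ (Fin.toℕ<n j′)) q)
           | <-irrelevant a a′ | T-irrelevant e e′
      ... | refl | refl | refl = refl

    hub-≢ : ∀ {u v j x y} → x ≢ y → At u v 0 x → At u v j y → j ≤ w → colour x ≢ colour y
    hub-≢ {j = zero} x≢y ax ay _ _ = x≢y (At-injective ax ay)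
    hub-≢ {j = suc j} x≢y ax ay j≤w eq = same (At-adj ax) (s≤s z≤n) (At-bound ay) j≤w
      (trans (sym (colour-At ax)) (trans eq (colour-At ay)))

    At-zero : ∀ {u v v′ x} → At u v 0 x → G ⊢ u ~ v′ → At u v′ 0 x
    At-zero {u} {v} {v′} at e = go at refl
      where
      go : ∀ {i x} → At u v i x → i ≡ 0 → At u v′ 0 x
      go (start _) _ = start e
      go (bwd _ _ j) q = ⊥-elim (m<n⇒n≢0 (m<n⇒0<n∸m (s≤s (Fin.toℕ<n j))) q)

    near-≢ : ∀ {x y l} → l ≤ w → x ≢ y → Near x y l → colour x ≢ colour y
    near-≢ l≤w x≢y (equal q) = ⊥-elim (x≢y q)
    near-≢ l≤w x≢y (along {i = i} {j} ax ay i≤j j≤i+l) eq with m≤n⇒m<n∨m≡n i≤j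
    ... | inj₂ refl = x≢y (At-injective ax ay)
    ... | inj₁ i<j = same (At-adj ax) i<j (At-bound ay) (≤-trans j≤i+l (+-monoʳ-≤ i l≤w))
      (trans (sym (colour-At ax)) (trans eq (colour-At ay)))
    near-≢ l≤w x≢y (via {v = v} {v′} {i} {j} ax ay ij≤l) eq with v Fin.≟ v′
    near-≢ l≤w x≢y (via {v = v} {i = i} {j} ax ay ij≤l) eq | yes refl with ≤-total i j
    ... | inj₁ i≤j = near-≢ l≤w x≢y (along ax ay i≤j (≤-trans (m+n≤o⇒n≤o i ij≤l) (m≤n+m _ i))) eq
    ... | inj₂ j≤i = near-≢ l≤w (x≢y ∘ sym) (along ay ax j≤i (≤-trans (m+n≤o⇒m≤o i ij≤l) (m≤n+m _ j))) (sym eq)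
    near-≢ l≤w x≢y (via {i = zero} ax ay ij≤l) eq | no _ =
      hub-≢ x≢y (At-zero ax (At-adj ay)) ay (≤-trans ij≤l l≤w) eq
    near-≢ l≤w x≢y (via {i = suc i} {zero} ax ay ij≤l) eq | no _ =
      hub-≢ (x≢y ∘ sym) (At-zero ay (At-adj ax)) ax (≤-trans (m+n≤o⇒m≤o (suc i) ij≤l) l≤w) (sym eq)
    near-≢ l≤w x≢y (via {i = suc i} {suc j} ax ay ij≤l) eq | no v≢v′ =
      cross (At-adj ax) (At-adj ay) v≢v′ (s≤s z≤n) (s≤s z≤n) (≤-trans ij≤l l≤w)
        (trans (sym (colour-At ax)) (trans eq (colour-At ay)))

    proper : ∀ x y → Adj (fracPower G w n) x y → colour x ≢ colour y
    proper x y (x≢y , l , l≤w , p) = near-≢ l≤w x≢y (near (≤-trans l≤w w≤n) p)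

  _++ʷ_ : ∀ {H : Graph} {x y z l l′} → Walk H x y l → Walk H y z l′ → Walk H x z (l + l′)
  [] ++ʷ q = q
  (e ∷ p) ++ʷ q = e ∷ (p ++ʷ q)

  SubAdj-sym : ∀ {x y} → SubAdj G n x y → SubAdj G n y x
  SubAdj-sym (fwd e i) = bwd e i
  SubAdj-sym (bwd e i) = fwd e i

  snoc : ∀ {H : Graph} {x y z l} → Walk H x y l → Adj H y z → Walk H x z (suc l)
  snoc [] e = e ∷ []
  snoc (e′ ∷ p) e = e′ ∷ snoc p e

  Walk-sym : ∀ {x y l} → Walk (subdivision G n) x y l → Walk (subdivision G n) y x l
  Walk-sym [] = []
  Walk-sym (e ∷ p) = snoc (Walk-sym p) (SubAdj-sym e)

  Walk-cast : ∀ {x y l l′} → l ≡ l′ → Walk (subdivision G n) x y l → Walk (subdivision G n) x y l′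
  Walk-cast refl p = p

  walk-up : ∀ {u v} u<v e (i : Fin (suc n)) →
    Walk (subdivision G n) (inj₁ u) (pos G n ((u , v) , u<v , e) i) (toℕ i)
  walk-up u<v e = <-weakInduction _ []
    (λ i p → snoc (Walk-cast (Fin.toℕ-inject₁ i) p) (fwd ((_ , _) , u<v , e) i))

  pos-last : ∀ {u v} u<v e → pos G n ((u , v) , u<v , e) (Fin.fromℕ n) ≡ inj₁ v
  pos-last u<v e with innerPos ν (Fin.fromℕ ν) | innerPos-spec ν (Fin.fromℕ ν)
  ... | nothing | _ = refl
  ... | just j | inj₂ (.j , refl , q) = ⊥-elim (<⇒≢ (Fin.toℕ<n j) (trans q (Fin.toℕ-fromℕ ν)))

  walk-down : ∀ {u v} u<v e (i : Fin (suc n)) →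
    Walk (subdivision G n) (inj₁ v) (pos G n ((u , v) , u<v , e) i) (n ∸ toℕ i)
  walk-down {u} {v} u<v e = >-weakInduction _
    (subst (λ x → Walk (subdivision G n) (inj₁ v) x (n ∸ toℕ (Fin.fromℕ n))) (sym (pos-last u<v e))
      (Walk-cast (sym (trans (cong (n ∸_) (Fin.toℕ-fromℕ n)) (n∸n≡0 n))) []))
    (λ i p → Walk-cast (trans (sym (+-∸-assoc 1 (Fin.toℕ<n i))) (cong (n ∸_) (sym (Fin.toℕ-inject₁ i))))
      (snoc p (bwd ((_ , _) , u<v , e) i)))

  vertexAt : ∀ {u v} → G ⊢ u ~ v → ∀ {i} → i ≤ n →
    Σ (SubVtx G n) λ x → At u v i x × Walk (subdivision G n) (inj₁ u) x i
  vertexAt {u} {v} e {i} i≤n with <-cmp (toℕ u) (toℕ v)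
  ... | tri< u<v _ _ = pos G n ((u , v) , u<v , T⇐true e) f , At-cast q (pos-At u<v (T⇐true e) f) ,
        Walk-cast q (walk-up u<v (T⇐true e) f)
    where
    f = fromℕ< (s≤s i≤n)
    q = Fin.toℕ-fromℕ< (s≤s i≤n)
  ... | tri≈ _ u≡v _ = ⊥-elim (adj-≢ G e (Fin.toℕ-injective u≡v))
  ... | tri> _ _ v<u = pos G n ((v , u) , v<u , T⇐true (adj-flip G e)) f ,
        At-cast q (At-flip (pos-At v<u (T⇐true (adj-flip G e)) f)) , Walk-cast q (walk-down v<u (T⇐true (adj-flip G e)) f)
    where
    f = fromℕ< (s≤s (m∸n≤m n i))
    q = trans (cong (n ∸_) (Fin.toℕ-fromℕ< (s≤s (m∸n≤m n i)))) (m∸[m∸n]≡n i≤n)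

  module Ball {Δ k} (centre : V G) (nbr : Fin Δ → V G) (nbr-inj : Injective _≡_ _≡_ nbr)
              (nbr-adj : ∀ j → G ⊢ centre ~ (nbr j)) (k≤n : k ≤ n) where

    -- The index encodes an arm and a depth. Depths are shifted by one, since depth 0 is the centre,
    -- which the ball lists only once.
    arm : (s : Fin (Δ * k)) → Σ (SubVtx G n) λ x →
      At centre (nbr (proj₁ (Fin.remQuot k s))) (suc (toℕ (proj₂ (Fin.remQuot {Δ} k s)))) x ×
      Walk (subdivision G n) (inj₁ centre) x (suc (toℕ (proj₂ (Fin.remQuot {Δ} k s))))
    arm s = vertexAt (nbr-adj _) (≤-trans (Fin.toℕ<n (proj₂ (Fin.remQuot {Δ} k s))) k≤n)

    ball : Fin (suc (Δ * k)) → SubVtx G n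
    ball zero = inj₁ centre
    ball (suc s) = proj₁ (arm s)

    radius : ∀ s → Σ ℕ λ l → l ≤ k × Walk (subdivision G n) (inj₁ centre) (ball s) l
    radius zero = 0 , z≤n , []
    radius (suc s) = _ , Fin.toℕ<n (proj₂ (Fin.remQuot {Δ} k s)) , proj₂ (proj₂ (arm s))

    module Rainbow {A : Set} (𝒫 : Pathwise G A n (k + k)) (w≤n : k + k ≤ n) where
      open Pathwise 𝒫
      open Coloured 𝒫 w≤n

      arm-≢ : ∀ j j′ (i i′ : Fin k) {x y} → At centre (nbr j) (suc (toℕ i)) x → At centre (nbr j′) (suc (toℕ i′)) y →
        (j ≡ j′ → i ≢ i′) → colour x ≢ colour y
      arm-≢ j j′ i i′ ax ay ≢ eq with j Fin.≟ j′
      arm-≢ j j i i′ ax ay ≢ eq | yes refl with <-cmp (toℕ i) (toℕ i′)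
      ... | tri< i<i′ _ _ = same (At-adj ax) (s≤s i<i′) (At-bound ay)
              (≤-trans (Fin.toℕ<n i′) (≤-trans (m≤m+n k k) (m≤n+m _ (suc (toℕ i)))))
              (trans (sym (colour-At ax)) (trans eq (colour-At ay)))
      ... | tri≈ _ i≡i′ _ = ≢ refl (Fin.toℕ-injective i≡i′)
      ... | tri> _ _ i′<i = same (At-adj ax) (s≤s i′<i) (At-bound ax)
              (≤-trans (Fin.toℕ<n i) (≤-trans (m≤m+n k k) (m≤n+m _ (suc (toℕ i′)))))
              (trans (sym (colour-At ay)) (trans (sym eq) (colour-At ax)))
      arm-≢ j j′ i i′ ax ay ≢ eq | no j≢j′ = cross (At-adj ax) (At-adj ay) (λ q → j≢j′ (nbr-inj q)) (s≤s z≤n) (s≤s z≤n)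
              (+-mono-≤ (Fin.toℕ<n i) (Fin.toℕ<n i′))
              (trans (sym (colour-At ax)) (trans eq (colour-At ay)))

      centre-≢ : ∀ j (i : Fin k) {x} → At centre (nbr j) (suc (toℕ i)) x → hub centre ≢ colour x
      centre-≢ j i ax eq = same (At-adj ax) (s≤s z≤n) (At-bound ax) (≤-trans (Fin.toℕ<n i) (m≤m+n k k))
        (trans (P-hub (At-adj ax)) (trans eq (colour-At ax)))

      -- Two depths of at most `k` add up to at most the window. Injectivity of `ball` is then read
      -- off the colouring, without discussing when vertices of two arms could coincide.
      rainbow : Injective _≡_ _≡_ (colour ∘ ball)
      rainbow {zero} {zero} _ = refl
      rainbow {zero} {suc t} eq = ⊥-elim (centre-≢ _ _ (proj₁ (proj₂ (arm t))) eq)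
      rainbow {suc s} {zero} eq = ⊥-elim (centre-≢ _ _ (proj₁ (proj₂ (arm s))) (sym eq))
      rainbow {suc s} {suc t} eq with s Fin.≟ t
      ... | yes refl = refl
      ... | no s≢t = ⊥-elim (arm-≢ _ _ _ _ (proj₁ (proj₂ (arm s))) (proj₁ (proj₂ (arm t)))
        (λ p q → s≢t (trans (sym (Fin.combine-remQuot {Δ} k s))
          (trans (cong₂ Fin.combine p q) (Fin.combine-remQuot {Δ} k t)))) eq)

      ball-injective : Injective _≡_ _≡_ ball
      ball-injective = rainbow ∘ cong colour

      clique : HasClique (fracPower G (k + k) n) (suc (Δ * k))
      clique = ball , ball-injective , λ s t s≢t → (λ q → s≢t (ball-injective q)) ,
        _ , +-mono-≤ (proj₁ (proj₂ (radius s))) (proj₁ (proj₂ (radius t))) ,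
        Walk-sym (proj₂ (proj₂ (radius s))) ++ʷ proj₂ (proj₂ (radius t))

    -- One colouring with as many colours as the clique has vertices settles both numbers: every
    -- colouring is injective on this clique, and this colouring is injective on every clique.
    perfect : Pathwise G (Fin (suc (Δ * k))) n (k + k) → k + k ≤ n →
      IsChromaticNumber (fracPower G (k + k) n) (suc (Δ * k)) × IsCliqueNumber (fracPower G (k + k) n) (suc (Δ * k))
    perfect 𝒫 w≤n = ((colour , proper) , below) , clique , above
      where
      open Coloured 𝒫 w≤n
      open Rainbow 𝒫 w≤n
      below : ∀ j → Colourable (fracPower G (k + k) n) j → suc (Δ * k) ≤ j
      below j (c , c-proper) = Fin.injective⇒≤ {f = c ∘ ball} λ {s} {t} eq → case s Fin.≟ t of λ where
        (yes q) → q
        (no s≢t) → ⊥-elim (c-proper _ _ (proj₂ (proj₂ clique) s t s≢t) eq)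
      above : ∀ j → HasClique (fracPower G (k + k) n) j → j ≤ suc (Δ * k)
      above j (f , f-inj , f-adj) = Fin.injective⇒≤ {f = colour ∘ f} λ {s} {t} eq → case s Fin.≟ t of λ where
        (yes q) → q
        (no s≢t) → ⊥-elim (proper _ _ (f-adj s t s≢t) eq)

-- Colouring the edge paths from their two ends

module Oriented {G : FinSimpleGraph} {A : Set} (n : ℕ) (Q : V G → V G → ℕ → A) where

  -- `Q u v` and `Q v u` may disagree about the same vertex. Each path is therefore coloured as read
  -- from its smaller end, which yields `P-sym` by construction.
  oriented : V G → V G → ℕ → A
  oriented u v i with <-cmp (toℕ u) (toℕ v)
  ... | tri< _ _ _ = Q u v i
  ... | tri≈ _ _ _ = Q u v i
  ... | tri> _ _ _ = Q v u (n ∸ i)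

  oriented-cases : ∀ {u v} → G ⊢ u ~ v →
    (∀ i → oriented u v i ≡ Q u v i) ⊎ (∀ i → oriented u v i ≡ Q v u (n ∸ i))
  oriented-cases {u} {v} e with <-cmp (toℕ u) (toℕ v)
  ... | tri< _ _ _ = inj₁ (λ _ → refl)
  ... | tri≈ _ _ _ = inj₁ (λ _ → refl)
  ... | tri> _ _ _ = inj₂ (λ _ → refl)

  oriented-sym : ∀ {u v i} → G ⊢ u ~ v → i ≤ n → oriented u v i ≡ oriented v u (n ∸ i)
  oriented-sym {u} {v} {i} e i≤n with <-cmp (toℕ u) (toℕ v) | <-cmp (toℕ v) (toℕ u)
  ... | tri< _ _ _ | tri> _ _ _ = cong (Q u v) (sym (m∸[m∸n]≡n i≤n))
  ... | tri> _ _ _ | tri< _ _ _ = refl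
  ... | tri< a _ _ | tri< b _ _ = ⊥-elim (<-asym a b)
  ... | tri> _ _ a | tri> _ _ b = ⊥-elim (<-asym a b)
  ... | tri≈ _ q _ | _ = ⊥-elim (adj-≢ G e (Fin.toℕ-injective q))
  ... | _ | tri≈ _ q _ = ⊥-elim (adj-≢ G e (Fin.toℕ-injective (sym q)))

  oriented-same : ∀ {w} → (∀ {u v i j} → G ⊢ u ~ v → i < j → j ≤ n → j ≤ i + w → Q u v i ≢ Q u v j) →
    ∀ {u v i j} → G ⊢ u ~ v → i < j → j ≤ n → j ≤ i + w → oriented u v i ≢ oriented u v j
  oriented-same {w} same {u} {v} {i} {j} e i<j j≤n j≤i+w eq with oriented-cases {u} {v} e
  ... | inj₁ f = same e i<j j≤n j≤i+w (trans (sym (f i)) (trans eq (f j)))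
  ... | inj₂ f = same (adj-flip G e) (∸-monoʳ-< i<j j≤n) (m∸n≤m n i)
    (linear 6 (λ n w i j i′ j′ → i :+ i′ :≡ n :⇒ j :+ j′ :≡ n :⇒ j :≤ i :+ w :⇒ goal (i′ :≤ j′ :+ w)) n w i j (n ∸ i) (n ∸ j)
      (m+[n∸m]≡n (≤-trans (<⇒≤ i<j) j≤n)) (m+[n∸m]≡n j≤n) j≤i+w)
    (trans (sym (f j)) (trans (sym eq) (f i)))

-- Any w + 1 consecutive vertices have distinct colours, so the first w + 1 of them can be repeated.
module Lengthen {G A n w} (𝒫 : Pathwise G A n w) (w<n : w < n) where
  open Pathwise 𝒫

  n′ : ℕ
  n′ = suc w + n

  Q : V G → V G → ℕ → A
  Q u v i with i ≤? w
  ... | yes _ = P u v i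
  ... | no _ = P u v (i ∸ suc w)

  Q-low : ∀ {u v i} → i ≤ w → Q u v i ≡ P u v i
  Q-low {i = i} i≤w with i ≤? w
  ... | yes _ = refl
  ... | no i≰w = ⊥-elim (i≰w i≤w)

  Q-high : ∀ {u v i} → w < i → Q u v i ≡ P u v (i ∸ suc w)
  Q-high {i = i} w<i with i ≤? w
  ... | yes i≤w = ⊥-elim (<⇒≱ w<i i≤w)
  ... | no _ = refl

  open Oriented {G} n′ Q

  Q-same : ∀ {u v i j} → G ⊢ u ~ v → i < j → j ≤ n′ → j ≤ i + w → Q u v i ≢ Q u v j
  Q-same {u} {v} {i} {j} e i<j j≤n′ j≤i+w eq with i ≤? w | j ≤? w
  ... | yes _ | yes j≤w = same e i<j (≤-trans j≤w (<⇒≤ w<n)) j≤i+w eq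
  ... | no i≰w | yes j≤w = i≰w (≤-trans (<⇒≤ i<j) j≤w)
  ... | yes i≤w | no j≰w = same e
    (linear 4 (λ w i j j′ → 1+ w :+ j′ :≡ j :⇒ j :≤ i :+ w :⇒ goal (j′ :< i)) w i j (j ∸ suc w) q j≤i+w)
    (≤-trans i≤w (<⇒≤ w<n))
    (linear 4 (λ w i j j′ → 1+ w :+ j′ :≡ j :⇒ i :≤ w :⇒ goal (i :≤ j′ :+ w)) w i j (j ∸ suc w) q i≤w)
    (sym eq)
    where q = m+[n∸m]≡n {suc w} {j} (≰⇒> j≰w)
  ... | no i≰w | no j≰w = same e (∸-monoˡ-< i<j (≰⇒> i≰w))
    (linear 4 (λ w n j j′ → 1+ w :+ j′ :≡ j :⇒ j :≤ 1+ w :+ n :⇒ goal (j′ :≤ n)) w n j (j ∸ suc w) q j≤n′)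
    (linear 5 (λ w i j i′ j′ → 1+ w :+ j′ :≡ j :⇒ 1+ w :+ i′ :≡ i :⇒ j :≤ i :+ w :⇒ goal (j′ :≤ i′ :+ w))
      w i j (i ∸ suc w) (j ∸ suc w) q (m+[n∸m]≡n {suc w} {i} (≰⇒> i≰w)) j≤i+w)
    eq
    where q = m+[n∸m]≡n {suc w} {j} (≰⇒> j≰w)

  -- The repeated stretch is inserted at one end only, but both ends of the long path look like `P`:
  -- one is the stretch itself, and `w < n` puts the last `w + 1` positions inside the copy of `P`.
  oriented-low : ∀ {u v i} → G ⊢ u ~ v → i ≤ w → oriented u v i ≡ P u v i
  oriented-low {u} {v} {i} e i≤w with oriented-cases {u} {v} e
  ... | inj₁ f = trans (f i) (Q-low i≤w)
  ... | inj₂ f = trans (f i) (trans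
    (Q-high (linear 4 (λ w n i t → i :+ t :≡ 1+ w :+ n :⇒ w :< n :⇒ i :≤ w :⇒ goal (w :< t)) w n i (n′ ∸ i) (m+[n∸m]≡n (≤-trans i≤w (≤-trans (n≤1+n w) (m≤m+n (suc w) n)))) w<n i≤w))
    (trans (cong (P v u) q) (sym (P-sym e (≤-trans i≤w (<⇒≤ w<n))))))
    where
    q : n′ ∸ i ∸ suc w ≡ n ∸ i
    q = trans (∸-+-assoc n′ i (suc w)) (trans (cong (n′ ∸_) (+-comm i (suc w)))
      (trans (sym (∸-+-assoc n′ (suc w) i)) (cong (_∸ i) (m+n∸m≡n (suc w) n))))

  lengthen : Pathwise G A n′ w
  lengthen = record
    { P = oriented
    ; hub = hub
    ; P-hub = λ e → trans (oriented-low e z≤n) (P-hub e)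
    ; P-sym = oriented-sym
    ; same = oriented-same Q-same
    ; cross = λ {u} {v} {v′} {i} {j} e e′ ne 1≤i 1≤j ij≤w eq → cross e e′ ne 1≤i 1≤j ij≤w
        (trans (sym (oriented-low e (m+n≤o⇒m≤o i ij≤w)))
          (trans eq (oriented-low e′ (m+n≤o⇒n≤o i ij≤w))))
    }

-- Each half is described from its own hub. If `n = 2h`, both halves contain the central vertex and
-- may colour it differently; `i + j < n` excludes that pair in `opp`. In `far` the vertex `F v u i`
-- is at distance `n - i` from `u` and is compared with another arm of `u`.
record Half (G : FinSimpleGraph) (A : Set) (n w h : ℕ) : Set where
  field
    F     : V G → V G → ℕ → A
    hub   : V G → A
    F-hub : ∀ {u v} → G ⊢ u ~ v → F u v 0 ≡ hub u
    inj   : ∀ {u v i j} → G ⊢ u ~ v → i < j → j ≤ h → F u v i ≢ F u v j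
    opp   : ∀ {u v i j} → G ⊢ u ~ v → i ≤ h → j ≤ h → i + j < n → n ≤ i + j + w → F u v i ≢ F v u j
    cross : ∀ {u v v′ i j} → G ⊢ u ~ v → G ⊢ u ~ v′ → v ≢ v′ →
            1 ≤ i → 1 ≤ j → i ≤ h → j ≤ h → i + j ≤ w → F u v i ≢ F u v′ j
    far   : ∀ {u v v′ i j} → G ⊢ u ~ v → G ⊢ u ~ v′ → v ≢ v′ →
            1 ≤ j → i ≤ h → j ≤ h → n + j ≤ i + w → F v u i ≢ F u v′ j

module Join {G A n w h} (ℋ : Half G A n w h) (2h≤n : h + h ≤ n) (n≤2h+1 : n ≤ suc (h + h)) (w<n : w < n) where
  open Half ℋ renaming (cross to F-cross)

  Q : V G → V G → ℕ → A
  Q u v i with i ≤? h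
  ... | yes _ = F u v i
  ... | no _ = F v u (n ∸ i)

  open Oriented {G} n Q

  Q-same : ∀ {u v i j} → G ⊢ u ~ v → i < j → j ≤ n → j ≤ i + w → Q u v i ≢ Q u v j
  Q-same {u} {v} {i} {j} e i<j j≤n j≤i+w eq with i ≤? h | j ≤? h
  ... | yes _ | yes j≤h = inj e i<j j≤h eq
  ... | no i≰h | yes j≤h = i≰h (≤-trans (<⇒≤ i<j) j≤h)
  ... | yes i≤h | no j≰h = opp e i≤h
    (linear 4 (λ h n j j′ → j :+ j′ :≡ n :⇒ h :< j :⇒ n :≤ 1+ (h :+ h) :⇒ goal (j′ :≤ h)) h n j (n ∸ j) q (≰⇒> j≰h) n≤2h+1)
    (linear 4 (λ n i j j′ → j :+ j′ :≡ n :⇒ i :< j :⇒ goal (i :+ j′ :< n)) n i j (n ∸ j) q i<j)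
    (linear 5 (λ n w i j j′ → j :+ j′ :≡ n :⇒ j :≤ i :+ w :⇒ goal (n :≤ i :+ j′ :+ w)) n w i j (n ∸ j) q j≤i+w)
    eq
    where q = m+[n∸m]≡n j≤n
  ... | no i≰h | no j≰h = inj (adj-flip G e) (∸-monoʳ-< i<j j≤n)
    (linear 4 (λ h n i i′ → i :+ i′ :≡ n :⇒ h :< i :⇒ n :≤ 1+ (h :+ h) :⇒ goal (i′ :≤ h)) h n i (n ∸ i)
      (m+[n∸m]≡n (≤-trans (<⇒≤ i<j) j≤n)) (≰⇒> i≰h) n≤2h+1)
    (sym eq)

  sides : ∀ {u v i} → G ⊢ u ~ v → i ≤ n →
    (i ≤ h × oriented u v i ≡ F u v i) ⊎ (n ∸ i ≤ h × oriented u v i ≡ F v u (n ∸ i))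
  sides {u} {v} {i} e i≤n with oriented-cases {u} {v} e
  sides {u} {v} {i} e i≤n | inj₁ f with i ≤? h | f i
  ... | yes i≤h | p = inj₁ (i≤h , p)
  ... | no i≰h | p = inj₂ (linear 4 (λ h n i i′ → i :+ i′ :≡ n :⇒ h :< i :⇒ n :≤ 1+ (h :+ h) :⇒ goal (i′ :≤ h)) h n i (n ∸ i)
      (m+[n∸m]≡n i≤n) (≰⇒> i≰h) n≤2h+1 , p)
  sides {u} {v} {i} e i≤n | inj₂ f with n ∸ i ≤? h | f i
  ... | yes i≤h | p = inj₂ (i≤h , p)
  ... | no i≰h | p = inj₁ (linear 4 (λ h n i i′ → i :+ i′ :≡ n :⇒ h :< i′ :⇒ n :≤ 1+ (h :+ h) :⇒ goal (i :≤ h)) h n i (n ∸ i)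
      (m+[n∸m]≡n i≤n) (≰⇒> i≰h) n≤2h+1 , trans p (cong (F u v) (m∸[m∸n]≡n i≤n)))

  start-hub : ∀ {u v} → G ⊢ u ~ v → oriented u v 0 ≡ hub u
  start-hub {u} {v} e with sides {u} {v} e z≤n
  ... | inj₁ (_ , p) = trans p (F-hub e)
  ... | inj₂ (n≤h , _) = ⊥-elim (linear 3 (λ h n w → n :≤ h :⇒ h :+ h :≤ n :⇒ w :< n :⇒ goal absurd) h n w n≤h 2h≤n w<n)

  oriented-cross : ∀ {u v v′ i j} → G ⊢ u ~ v → G ⊢ u ~ v′ → v ≢ v′ →
    1 ≤ i → 1 ≤ j → i + j ≤ w → oriented u v i ≢ oriented u v′ j
  oriented-cross {u} {v} {v′} {i} {j} e e′ ne 1≤i 1≤j ij≤w eq = go (sides e i≤n) (sides e′ j≤n)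
    where
    i≤n : i ≤ n
    i≤n = ≤-trans (m+n≤o⇒m≤o i ij≤w) (<⇒≤ w<n)
    j≤n : j ≤ n
    j≤n = ≤-trans (m+n≤o⇒n≤o i ij≤w) (<⇒≤ w<n)
    beyond : ∀ {a b} → a + b ≤ w → a ≤ n → n + b ≤ n ∸ a + w
    beyond {a} {b} ab≤w a≤n = linear 5 (λ n w a b a′ → a :+ a′ :≡ n :⇒ a :+ b :≤ w :⇒ goal (n :+ b :≤ a′ :+ w)) n w a b (n ∸ a)
      (m+[n∸m]≡n a≤n) ab≤w
    go : (i ≤ h × oriented u v i ≡ F u v i) ⊎ (n ∸ i ≤ h × oriented u v i ≡ F v u (n ∸ i)) →
         (j ≤ h × oriented u v′ j ≡ F u v′ j) ⊎ (n ∸ j ≤ h × oriented u v′ j ≡ F v′ u (n ∸ j)) → ⊥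
    go (inj₁ (i≤h , p)) (inj₁ (j≤h , q)) = F-cross e e′ ne 1≤i 1≤j i≤h j≤h ij≤w (trans (sym p) (trans eq q))
    go (inj₂ (i≤h , p)) (inj₁ (j≤h , q)) = far e e′ ne 1≤j i≤h j≤h (beyond ij≤w i≤n) (trans (sym p) (trans eq q))
    go (inj₁ (i≤h , p)) (inj₂ (j≤h , q)) = far e′ e (ne ∘ sym) 1≤i j≤h i≤h
      (beyond (subst (_≤ w) (+-comm i j) ij≤w) j≤n) (trans (sym q) (trans (sym eq) p))
    go (inj₂ (i≤h , _)) (inj₂ (j≤h , _)) =
      linear 7 (λ n w h i j i′ j′ → i :+ i′ :≡ n :⇒ j :+ j′ :≡ n :⇒ i′ :≤ h :⇒ j′ :≤ h :⇒ h :+ h :≤ n :⇒ w :< n :⇒ i :+ j :≤ w :⇒ goal absurd)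
        n w h i j (n ∸ i) (n ∸ j) (m+[n∸m]≡n i≤n) (m+[n∸m]≡n j≤n) i≤h j≤h 2h≤n w<n ij≤w

  joined : Pathwise G A n w
  joined = record
    { P = oriented
    ; hub = hub
    ; P-hub = start-hub
    ; P-sym = oriented-sym
    ; same = oriented-same Q-same
    ; cross = oriented-cross
    }

-- Block colourings

Half-map : ∀ {G A B n w h} (ℋ : Half G A n w h) (Ok : A → Set) (f : A → B) →
  (∀ {u v i} → G ⊢ u ~ v → i ≤ h → Ok (Half.F ℋ u v i)) →
  (∀ {a b} → Ok a → Ok b → f a ≡ f b → a ≡ b) → Half G B n w h
Half-map {G = G} ℋ Ok f valid f-inj = record
  { F = λ u v i → f (F u v i)
  ; hub = f ∘ hub
  ; F-hub = cong f ∘ F-hub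
  ; inj = λ e i<j j≤h eq → inj e i<j j≤h (f-inj (valid e (≤-trans (<⇒≤ i<j) j≤h)) (valid e j≤h) eq)
  ; opp = λ {u} {v} e i≤h j≤h p q eq → opp e i≤h j≤h p q (f-inj (valid e i≤h) (valid (adj-flip G {u} {v} e) j≤h) eq)
  ; cross = λ e e′ ne 1≤i 1≤j i≤h j≤h p eq → cross e e′ ne 1≤i 1≤j i≤h j≤h p (f-inj (valid e i≤h) (valid e′ j≤h) eq)
  ; far = λ {u} {v} e e′ ne 1≤j i≤h j≤h p eq → far e e′ ne 1≤j i≤h j≤h p (f-inj (valid (adj-flip G {u} {v} e) i≤h) (valid e′ j≤h) eq)
  }
  where open Half ℋ

module Palette (S Δ K : ℕ) where

  Valid : Fin (suc S) ⊎ (Fin Δ × ℕ) → Set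
  Valid (inj₁ _) = ⊤
  Valid (inj₂ (_ , l)) = 1 ≤ l × l ≤ K

  -- One special colour (`S = 0`) is for the hubs alone, four (`S = 3`) are for a total labelling.
  -- The code is injective only on levels from 1 to `K`, which is why `Half-map` carries a validity
  -- predicate.
  code : Fin (suc S) ⊎ (Fin Δ × ℕ) → Fin (suc S + Δ * K)
  code (inj₁ s) = s Fin.↑ˡ (Δ * K)
  code (inj₂ (d , l)) with pred l <? K
  ... | yes q = suc S Fin.↑ʳ Fin.combine d (fromℕ< q)
  -- A dummy: `Valid` excludes such levels.
  ... | no _ = zero

  ↑ˡ≢↑ʳ : ∀ {m n} (i : Fin m) (j : Fin n) → i Fin.↑ˡ n ≢ m Fin.↑ʳ j
  ↑ˡ≢↑ʳ {m} {n} i j eq with trans (sym (Fin.splitAt-↑ˡ m i n)) (trans (cong (Fin.splitAt m) eq) (Fin.splitAt-↑ʳ m n j))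
  ... | ()

  pred< : ∀ {l} → 1 ≤ l → l ≤ K → pred l < K
  pred< {suc l} _ q = q

  pred-inj : ∀ {l l′} → 1 ≤ l → 1 ≤ l′ → pred l ≡ pred l′ → l ≡ l′
  pred-inj {suc l} {suc l′} _ _ q = cong suc q

  code-injective : ∀ {a b} → Valid a → Valid b → code a ≡ code b → a ≡ b
  code-injective {inj₁ s} {inj₁ t} _ _ eq = cong inj₁ (Fin.↑ˡ-injective (Δ * K) s t eq)
  code-injective {inj₁ s} {inj₂ (d , l)} _ (p , q) eq with pred l <? K
  ... | yes _ = ⊥-elim (↑ˡ≢↑ʳ s _ eq)
  ... | no ¬q = ⊥-elim (¬q (pred< p q))
  code-injective {inj₂ (d , l)} {inj₁ t} (p , q) _ eq with pred l <? K
  ... | yes _ = ⊥-elim (↑ˡ≢↑ʳ t _ (sym eq))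
  ... | no ¬q = ⊥-elim (¬q (pred< p q))
  code-injective {inj₂ (d , l)} {inj₂ (d′ , l′)} (p , q) (p′ , q′) eq with pred l <? K | pred l′ <? K
  ... | no ¬q | _ = ⊥-elim (¬q (pred< p q))
  ... | yes _ | no ¬q = ⊥-elim (¬q (pred< p′ q′))
  ... | yes x | yes x′ with Fin.combine-injective d (fromℕ< x) d′ (fromℕ< x′) (Fin.↑ʳ-injective (suc S) _ _ eq)
  ...   | refl , e = cong (λ t → inj₂ (d , t)) (pred-inj p p′ (Fin.fromℕ<-injective _ _ x x′ e))

-- The colours of all vertices except the hubs, when the path length is 2K + 1 + r and the window 2K.
record Blocks (G : FinSimpleGraph) (Δ K r H : ℕ) : Set where
  field
    D     : V G → V G → ℕ → Fin Δ × ℕ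
    valid : ∀ {u v i} → G ⊢ u ~ v → 1 ≤ i → i ≤ K + H → 1 ≤ proj₂ (D u v i) × proj₂ (D u v i) ≤ K
    inj   : ∀ {u v i j} → G ⊢ u ~ v → 1 ≤ i → i < j → j ≤ K + H → D u v i ≢ D u v j
    opp   : ∀ {u v i j} → G ⊢ u ~ v → 1 ≤ i → 1 ≤ j → i ≤ K + H → j ≤ K + H →
            i + j < K + K + suc r → K + K + suc r ≤ i + j + (K + K) → D u v i ≢ D v u j
    cross : ∀ {u v v′ i j} → G ⊢ u ~ v → G ⊢ u ~ v′ → v ≢ v′ →
            1 ≤ i → 1 ≤ j → i ≤ K + H → j ≤ K + H → i + j ≤ K + K → D u v i ≢ D u v′ j
    far   : ∀ {u v v′ i j} → G ⊢ u ~ v → G ⊢ u ~ v′ → v ≢ v′ →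
            1 ≤ i → 1 ≤ j → i ≤ K + H → j ≤ K + H → K + K + suc r + j ≤ i + (K + K) → D v u i ≢ D u v′ j

module Monochrome {G Δ K r H} (𝒟 : Blocks G Δ K r H) where
  open Blocks 𝒟

  F : V G → V G → ℕ → Fin 1 ⊎ (Fin Δ × ℕ)
  F u v zero = inj₁ zero
  F u v (suc i) = inj₂ (D u v (suc i))

  half : Half G (Fin 1 ⊎ (Fin Δ × ℕ)) (K + K + suc r) (K + K) (K + H)
  half .Half.F = F
  half .Half.hub _ = inj₁ zero
  half .Half.F-hub _ = refl
  half .Half.inj {i = zero} {suc j} _ _ _ ()
  half .Half.inj {i = suc i} {suc j} e i<j j≤h eq = inj e (s≤s z≤n) i<j j≤h (inj₂-injective eq)
  half .Half.opp {i = zero} {zero} _ _ _ _ p _ = linear 2 (λ k r → k :+ k :+ (1+ r) :≤ k :+ k :⇒ goal absurd) K r p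
  half .Half.opp {i = zero} {suc j} _ _ _ _ _ ()
  half .Half.opp {i = suc i} {zero} _ _ _ _ _ ()
  half .Half.opp {i = suc i} {suc j} e i≤h j≤h p q eq = opp e (s≤s z≤n) (s≤s z≤n) i≤h j≤h p q (inj₂-injective eq)
  half .Half.cross {i = suc i} {suc j} e e′ ne 1≤i 1≤j i≤h j≤h p eq =
    cross e e′ ne 1≤i 1≤j i≤h j≤h p (inj₂-injective eq)
  half .Half.far {i = zero} {suc j} _ _ _ _ _ _ _ ()
  half .Half.far {i = suc i} {suc j} e e′ ne 1≤j i≤h j≤h p eq =
    far e e′ ne (s≤s z≤n) 1≤j i≤h j≤h p (inj₂-injective eq)

  coded : Half G (Fin (suc (Δ * K))) (K + K + suc r) (K + K) (K + H)
  coded = Half-map half Valid code F-valid code-injective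
    where
    open Palette 0 Δ K
    F-valid : ∀ {u v i} → G ⊢ u ~ v → i ≤ K + H → Valid (F u v i)
    F-valid {i = zero} _ _ = tt
    F-valid {i = suc i} e i≤h = valid e (s≤s z≤n) i≤h

-- `β` is meant for the hubs, `q u v` and `m u v` for the vertices at distances `K + 1` and `K + 2`
-- from `u`. The window will be `2K + 2`, exactly the distance of two `q`-vertices around a hub;
-- hence `q-inj`.
record Quad (G : FinSimpleGraph) : Set where
  field
    β   : V G → Fin 4
    q m : G ⇉ Fin 4
    qβ  : ∀ {u v} → G ⊢ u ~ v → q u v ≢ β u
    qq  : ∀ {u v} → G ⊢ u ~ v → q u v ≢ q v u
    q-inj : ∀ {u v v′} → G ⊢ u ~ v → G ⊢ u ~ v′ → v ≢ v′ → q u v ≢ q u v′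
    mβ  : ∀ {u v} → G ⊢ u ~ v → m u v ≢ β u
    mq  : ∀ {u v} → G ⊢ u ~ v → m u v ≢ q u v
    mq′ : ∀ {u v} → G ⊢ u ~ v → m u v ≢ q v u
    mm  : ∀ {u v} → G ⊢ u ~ v → m u v ≢ m v u

-- The four colours of a Quad go to positions 0, K + 1 and K + 2, the blocks move outwards to make room.
module Fourchrome {G Δ K r H} (𝒟 : Blocks G Δ K r H) (𝒬 : Quad G)
    (K≤r : K ≤ r) (r≤2K : r ≤ K + K) (2H≤ : H + H ≤ suc r) where
  open Blocks 𝒟
  open Quad 𝒬

  data Special : ℕ → Set where
    at-hub : Special 0
    at-q   : Special (1 + K)
    at-m   : Special (2 + K)

  data Moved (i : ℕ) : ℕ → Set where
    low  : i ≤ K → Moved i i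
    high : K < i → Moved i (2 + i)

  data View (j : ℕ) : Set where
    special : Special j → View j
    block   : ∀ {i} → 1 ≤ i → Moved i j → View j

  view : ∀ i → View i
  view zero = special at-hub
  view (suc i) with suc i ≤? K
  ... | yes i≤K = block (s≤s z≤n) (low i≤K)
  ... | no i≰K with i ∸ K in eq
  ...   | zero rewrite ≤-antisym (m∸n≡0⇒m≤n {i} {K} eq) (s≤s⁻¹ (≰⇒> i≰K)) = special at-q
  ...   | suc zero = subst View (trans (cong suc (+-comm 1 K)) (cong suc (trans (cong (K +_) (sym eq)) (m+[n∸m]≡n (s≤s⁻¹ (≰⇒> i≰K))))))
            (special at-m)
  ...   | suc (suc t) = subst View (trans (cong suc (sym (trans (+-suc K (suc t)) (cong suc (+-suc K t)))))
            (cong suc (trans (cong (K +_) (sym eq)) (m+[n∸m]≡n (s≤s⁻¹ (≰⇒> i≰K))))))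
            (block {i = suc (K + t)} (s≤s z≤n) (high (s≤s (m≤m+n K t))))

  specialColour : V G → V G → ∀ {j} → Special j → Fin 4
  specialColour u v at-hub = β u
  specialColour u v at-q = q u v
  specialColour u v at-m = m u v

  colourView : V G → V G → ∀ {j} → View j → Fin 4 ⊎ (Fin Δ × ℕ)
  colourView u v (special a) = inj₁ (specialColour u v a)
  colourView u v (block {i} _ _) = inj₂ (D u v i)

  w n h : ℕ
  w = suc K + suc K
  n = suc K + suc K + suc (2 + r)
  h = 2 + K + H

  wₑ : ∀ {i} → Linear.Expr i → Linear.Expr i
  wₑ k = 1+ k :+ (1+ k)

  nₑ : ∀ {i} → Linear.Expr i → Linear.Expr i → Linear.Expr i
  nₑ k r = wₑ k :+ (con 3 :+ r)

  Moved-≤ : ∀ {i j} → Moved i j → j ≤ h → i ≤ K + H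
  Moved-≤ (low i≤K) _ = ≤-trans i≤K (m≤m+n K H)
  Moved-≤ (high _) j≤h = s≤s⁻¹ (s≤s⁻¹ j≤h)

  Moved-< : ∀ {i i′ j j′} → Moved i j → Moved i′ j′ → j < j′ → i < i′
  Moved-< (low _) (low _) p = p
  Moved-< (low i≤K) (high K<i′) _ = ≤-<-trans i≤K K<i′
  Moved-< {i} {i′} (high K<i) (low i′≤K) p =
    ⊥-elim (linear 3 (λ k i j → k :< i :⇒ j :≤ k :⇒ con 2 :+ i :< j :⇒ goal absurd) K i i′ K<i i′≤K p)
  Moved-< (high _) (high _) p = s≤s⁻¹ (s≤s⁻¹ p)

  -- The path has grown by four and the window by two. Opposite vertices are pushed apart by four or
  -- two unless both are `high`; then their distance is unchanged, and it is below `r`, hence within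
  -- the old window by `r ≤ 2K`.
  Moved-sum : ∀ {i i′ j j′} → Moved i j → Moved i′ j′ → j ≤ h → j′ ≤ h → j + j′ < n → n ≤ j + j′ + w →
    i + i′ < K + K + suc r × K + K + suc r ≤ i + i′ + (K + K)
  Moved-sum {i} {i′} (low p) (low p′) _ _ _ q =
    linear 4 (λ k r i j → i :≤ k :⇒ j :≤ k :⇒ goal (i :+ j :< k :+ k :+ (1+ r))) K r i i′ p p′ ,
    linear 4 (λ k r i j → nₑ k r :≤ i :+ j :+ wₑ k :⇒ goal (k :+ k :+ (1+ r) :≤ i :+ j :+ (k :+ k))) K r i i′ q
  Moved-sum {i} {i′} (low p) (high _) _ j′≤h _ q =
    linear 5 (λ k r H i j → i :≤ k :⇒ con 2 :+ j :≤ con 2 :+ k :+ H :⇒ H :+ H :≤ 1+ r :⇒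
      goal (i :+ j :< k :+ k :+ (1+ r))) K r H i i′ p j′≤h 2H≤ ,
    linear 4 (λ k r i j → nₑ k r :≤ i :+ (con 2 :+ j) :+ wₑ k :⇒ goal (k :+ k :+ (1+ r) :≤ i :+ j :+ (k :+ k))) K r i i′ q
  Moved-sum {i} {i′} (high _) (low p) j≤h _ _ q =
    linear 5 (λ k r H i j → j :≤ k :⇒ con 2 :+ i :≤ con 2 :+ k :+ H :⇒ H :+ H :≤ 1+ r :⇒
      goal (i :+ j :< k :+ k :+ (1+ r))) K r H i i′ p j≤h 2H≤ ,
    linear 4 (λ k r i j → nₑ k r :≤ con 2 :+ i :+ j :+ wₑ k :⇒ goal (k :+ k :+ (1+ r) :≤ i :+ j :+ (k :+ k))) K r i i′ q
  Moved-sum {i} {i′} (high K<i) (high K<i′) _ _ p _ =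
    linear 4 (λ k r i j → con 2 :+ i :+ (con 2 :+ j) :< nₑ k r :⇒ goal (i :+ j :< k :+ k :+ (1+ r))) K r i i′ p ,
    linear 4 (λ k r i j → k :< i :⇒ k :< j :⇒ r :≤ k :+ k :⇒ goal (k :+ k :+ (1+ r) :≤ i :+ j :+ (k :+ k))) K r i i′ K<i K<i′ r≤2K

  Moved-window : ∀ {i i′ j j′} → Moved i j → Moved i′ j′ → j + j′ ≤ w → i + i′ ≤ K + K
  Moved-window (low p) (low p′) _ = +-mono-≤ p p′
  Moved-window {i} {i′} (low _) (high _) p =
    linear 3 (λ k i j → i :+ (con 2 :+ j) :≤ wₑ k :⇒ goal (i :+ j :≤ k :+ k)) K i i′ p
  Moved-window {i} {i′} (high _) (low _) p =
    linear 3 (λ k i j → con 2 :+ i :+ j :≤ wₑ k :⇒ goal (i :+ j :≤ k :+ k)) K i i′ p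
  Moved-window {i} {i′} (high p) (high p′) q =
    ⊥-elim (linear 3 (λ k i j → con 2 :+ i :+ (con 2 :+ j) :≤ wₑ k :⇒ k :< i :⇒ k :< j :⇒ goal absurd) K i i′ q p p′)

  Moved-far : ∀ {i i′ j j′} → Moved i j → Moved i′ j′ → n + j′ ≤ j + w → K + K + suc r + i′ ≤ i + (K + K)
  Moved-far {i} {i′} {j} {j′} a b p =
    linear 6 (λ k r i i′ j j′ → nₑ k r :+ j′ :≤ j :+ wₑ k :⇒ j :≤ con 2 :+ i :⇒ i′ :≤ j′ :⇒
      goal (k :+ k :+ (1+ r) :+ i′ :≤ i :+ (k :+ k))) K r i i′ j j′ p (up a) (down b)
    where
    up : ∀ {i j} → Moved i j → j ≤ 2 + i
    up {i} (low _) = m≤n+m i 2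
    up (high _) = ≤-refl
    down : ∀ {i j} → Moved i j → i ≤ j
    down (low _) = ≤-refl
    down {i} (high _) = m≤n+m i 2

  special-inj : ∀ {u v i j} → G ⊢ u ~ v → (a : Special i) (b : Special j) → i < j → specialColour u v a ≢ specialColour u v b
  special-inj e at-hub at-hub ()
  special-inj e at-hub at-q _ eq = qβ e (sym eq)
  special-inj e at-hub at-m _ eq = mβ e (sym eq)
  special-inj e at-q at-hub ()
  special-inj e at-q at-q i<j _ = <-irrefl refl i<j
  special-inj e at-q at-m _ eq = mq e (sym eq)
  special-inj e at-m at-hub ()
  special-inj e at-m at-q i<j _ = <-asym i<j ≤-refl
  special-inj e at-m at-m i<j _ = <-irrefl refl i<j

  special-≤ : ∀ {i} → Special i → i ≤ 2 + K
  special-≤ at-hub = z≤n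
  special-≤ at-q = n≤1+n _
  special-≤ at-m = ≤-refl

  -- `K ≤ r` keeps the special vertices of one end out of reach of the opposite hub.
  hub-alone : ∀ {j} → Special j → ¬ n ≤ j + w
  hub-alone {j} b p = linear 3 (λ k r j → nₑ k r :≤ j :+ wₑ k :⇒ j :≤ con 2 :+ k :⇒ k :≤ r :⇒ goal absurd) K r j p (special-≤ b) K≤r

  special-opp : ∀ {u v i j} → G ⊢ u ~ v → (a : Special i) (b : Special j) → n ≤ i + j + w → specialColour u v a ≢ specialColour v u b
  special-opp e at-hub b p _ = hub-alone b p
  special-opp e at-q at-hub p _ = hub-alone at-q (subst (λ t → n ≤ t + w) (+-identityʳ (1 + K)) p)
  special-opp e at-q at-q _ = qq e
  special-opp e at-q at-m _ = mq′ (adj-flip G e) ∘ sym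
  special-opp e at-m at-hub p _ = hub-alone at-m (subst (λ t → n ≤ t + w) (+-identityʳ (2 + K)) p)
  special-opp e at-m at-q _ = mq′ e
  special-opp e at-m at-m _ = mm e

  special-cross : ∀ {u v v′ i j} → G ⊢ u ~ v → G ⊢ u ~ v′ → v ≢ v′ → (a : Special i) (b : Special j) →
    1 ≤ i → 1 ≤ j → i + j ≤ w → specialColour u v a ≢ specialColour u v′ b
  special-cross e e′ ne at-hub _ () _ _
  special-cross e e′ ne at-q at-hub _ () _
  special-cross e e′ ne at-m at-hub _ () _
  special-cross e e′ ne at-q at-q _ _ _ = q-inj e e′ ne
  special-cross e e′ ne at-q at-m _ _ p _ = linear 1 (λ k → 1+ k :+ (con 2 :+ k) :≤ wₑ k :⇒ goal absurd) K p
  special-cross e e′ ne at-m at-q _ _ p _ = linear 1 (λ k → con 2 :+ k :+ (1+ k) :≤ wₑ k :⇒ goal absurd) K p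
  special-cross e e′ ne at-m at-m _ _ p _ = linear 1 (λ k → con 2 :+ k :+ (con 2 :+ k) :≤ wₑ k :⇒ goal absurd) K p

  half : Half G (Fin 4 ⊎ (Fin Δ × ℕ)) n w h
  half = record
    { F = λ u v i → colourView u v (view i)
    ; hub = λ u → inj₁ (β u)
    ; F-hub = λ _ → refl
    ; inj = λ e i<j j≤h → F-inj e (view _) (view _) i<j j≤h
    ; opp = λ e i≤h j≤h p q → F-opp e (view _) (view _) i≤h j≤h p q
    ; cross = λ e e′ ne 1≤i 1≤j i≤h j≤h p → F-cross e e′ ne (view _) (view _) 1≤i 1≤j i≤h j≤h p
    ; far = λ e e′ ne 1≤j i≤h j≤h p → F-far e e′ ne (view _) (view _) 1≤j i≤h j≤h p
    }
    where
    F-inj : ∀ {u v i j} → G ⊢ u ~ v → (a : View i) (b : View j) → i < j → j ≤ h → colourView u v a ≢ colourView u v b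
    F-inj e (special a) (special b) i<j _ eq = special-inj e a b i<j (inj₁-injective eq)
    F-inj e (special _) (block _ _) _ _ ()
    F-inj e (block _ _) (special _) _ _ ()
    F-inj e (block 1≤i a) (block _ b) i<j j≤h eq = inj e 1≤i (Moved-< a b i<j) (Moved-≤ b j≤h) (inj₂-injective eq)

    F-opp : ∀ {u v i j} → G ⊢ u ~ v → (a : View i) (b : View j) → i ≤ h → j ≤ h →
      i + j < n → n ≤ i + j + w → colourView u v a ≢ colourView v u b
    F-opp e (special a) (special b) _ _ _ p eq = special-opp e a b p (inj₁-injective eq)
    F-opp e (special _) (block _ _) _ _ _ _ ()
    F-opp e (block _ _) (special _) _ _ _ _ ()
    F-opp e (block 1≤i a) (block 1≤j b) i≤h j≤h p q eq = let p′ , q′ = Moved-sum a b i≤h j≤h p q in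
      opp e 1≤i 1≤j (Moved-≤ a i≤h) (Moved-≤ b j≤h) p′ q′ (inj₂-injective eq)

    F-cross : ∀ {u v v′ i j} → G ⊢ u ~ v → G ⊢ u ~ v′ → v ≢ v′ → (a : View i) (b : View j) →
      1 ≤ i → 1 ≤ j → i ≤ h → j ≤ h → i + j ≤ w → colourView u v a ≢ colourView u v′ b
    F-cross e e′ ne (special a) (special b) 1≤i 1≤j _ _ p eq = special-cross e e′ ne a b 1≤i 1≤j p (inj₁-injective eq)
    F-cross e e′ ne (special _) (block _ _) _ _ _ _ _ ()
    F-cross e e′ ne (block _ _) (special _) _ _ _ _ _ ()
    F-cross e e′ ne (block 1≤i a) (block 1≤j b) _ _ i≤h j≤h p eq =
      cross e e′ ne 1≤i 1≤j (Moved-≤ a i≤h) (Moved-≤ b j≤h) (Moved-window a b p) (inj₂-injective eq)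

    F-far : ∀ {u v v′ i j} → G ⊢ u ~ v → G ⊢ u ~ v′ → v ≢ v′ → (a : View i) (b : View j) →
      1 ≤ j → i ≤ h → j ≤ h → n + j ≤ i + w → colourView v u a ≢ colourView u v′ b
    F-far {j = j} e e′ ne (special a) _ _ _ _ p _ = hub-alone a (≤-trans (m≤m+n n j) p)
    F-far e e′ ne (block _ _) (special _) _ _ _ _ ()
    F-far e e′ ne (block 1≤i a) (block 1≤j b) _ i≤h j≤h p eq =
      far e e′ ne 1≤i 1≤j (Moved-≤ a i≤h) (Moved-≤ b j≤h) (Moved-far a b p) (inj₂-injective eq)

  coded : Half G (Fin (4 + Δ * K)) n w h
  coded = Half-map half Valid code (λ e i≤h → F-valid e (view _) i≤h) code-injective
    where
    open Palette 3 Δ K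
    F-valid : ∀ {u v i} → G ⊢ u ~ v → (a : View i) → i ≤ h → Valid (colourView u v a)
    F-valid e (special _) _ = tt
    F-valid e (block 1≤i a) i≤h = valid e 1≤i (Moved-≤ a i≤h)

-- slot u v i is the class and the level, as seen from u, of the colour at position i of the path uv;
-- lvl u d orders the colours of class d around u.  The middle slots beyond position K of the path uv
-- borrow, at u, a colour of another arm whose level is so high that it is out of reach.
module Scheme {G : FinSimpleGraph} {Δ K r H : ℕ} (H≤ : H + H ≤ suc r)
  (c : G ⇉ Fin Δ)
  (lvl : V G → Fin Δ → ℕ → ℕ)
  (mid : V G → V G → ℕ → Fin Δ × ℕ)
  (c-inj : Injective-at G c)
  (lvl-range : ∀ u d {l} → 1 ≤ l → l ≤ K → 1 ≤ lvl u d l × lvl u d l ≤ K)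
  (lvl-inj : ∀ u d {l l′} → 1 ≤ l → l ≤ K → 1 ≤ l′ → l′ ≤ K → lvl u d l ≡ lvl u d l′ → l ≡ l′)
  where

  paint : V G → Fin Δ × ℕ → Fin Δ × ℕ
  paint u (d , l) = d , lvl u d l

  slot : V G → V G → ℕ → Fin Δ × ℕ
  slot u v i with i ≤? K
  ... | yes _ = c u v , i
  ... | no _ = mid u v (i ∸ K)

  InRange : Fin Δ × ℕ → Set
  InRange (_ , l) = 1 ≤ l × l ≤ K

  paint-inj : ∀ u {s t} → InRange s → InRange t → paint u s ≡ paint u t → s ≡ t
  paint-inj u {d , l} {d′ , l′} (p , q) (p′ , q′) eq with cong proj₁ eq
  ... | refl = cong (d ,_) (lvl-inj u d p q p′ q′ (cong proj₂ eq))

  data View u v (i : ℕ) : Fin Δ × ℕ → Set where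
    low  : 1 ≤ i → i ≤ K → View u v i (c u v , i)
    high : ∀ {t} → 1 ≤ t → t ≤ H → i ≡ K + t → View u v i (mid u v t)

  view : ∀ u v {i} → 1 ≤ i → i ≤ K + H → View u v i (slot u v i)
  view u v {i} 1≤i i≤ with i ≤? K
  ... | yes i≤K = low 1≤i i≤K
  ... | no i≰K = high
    (linear 3 (λ k i t → k :+ t :≡ i :⇒ k :< i :⇒ goal (con 1 :≤ t)) K i (i ∸ K) q (≰⇒> i≰K))
    (linear 4 (λ k i t H → k :+ t :≡ i :⇒ i :≤ k :+ H :⇒ goal (t :≤ H)) K i (i ∸ K) H q i≤)
    (sym q)
    where q = m+[n∸m]≡n (<⇒≤ (≰⇒> i≰K))

  -- The distance conditions in terms of slots: vertices at `i` and `j` from the two ends are within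
  -- `2K` iff `r < i + j`, and the vertex at `i` from the remote end is within `2K` of the vertex
  -- `j` on another arm iff `r + j < i`. By `mid-high`, a borrower at depth `K + t` and the owner of
  -- its colour at depth `l` satisfy `K + t + l > 2K`.
  record Middle : Set where
    field
      mid-range : ∀ {u v t} → G ⊢ u ~ v → 1 ≤ t → t ≤ H → InRange (mid u v t)
      mid-high  : ∀ {u v t} → G ⊢ u ~ v → 1 ≤ t → t ≤ H → K < t + proj₂ (mid u v t)
      mid-class : ∀ {u v t} → G ⊢ u ~ v → 1 ≤ t → t ≤ H → proj₁ (mid u v t) ≢ c u v
      mid-inj   : ∀ {u v t t′} → G ⊢ u ~ v → 1 ≤ t → t < t′ → t′ ≤ H → mid u v t ≢ mid u v t′
      opp-low   : ∀ {u v i j} → G ⊢ u ~ v → 1 ≤ i → i ≤ K → 1 ≤ j → j ≤ K → r < i + j →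
                  paint u (c u v , i) ≢ paint v (c v u , j)
      opp-mixed : ∀ {u v i s} → G ⊢ u ~ v → 1 ≤ i → i ≤ K → 1 ≤ s → s ≤ H → r < i + (K + s) →
                  paint u (c u v , i) ≢ paint v (mid v u s)
      opp-high  : ∀ {u v t s} → G ⊢ u ~ v → 1 ≤ t → t ≤ H → 1 ≤ s → s ≤ H → t + s ≤ r →
                  paint u (mid u v t) ≢ paint v (mid v u s)
      far-low   : ∀ {u v v′ i j} → G ⊢ u ~ v → G ⊢ u ~ v′ → v ≢ v′ →
                  1 ≤ j → j ≤ K → i ≤ K → r + j < i → paint v (c v u , i) ≢ paint u (c u v′ , j)
      far-high  : ∀ {u v v′ t j} → G ⊢ u ~ v → G ⊢ u ~ v′ → v ≢ v′ →
                  1 ≤ j → j ≤ K → 1 ≤ t → t ≤ H → r + j < K + t → paint v (mid v u t) ≢ paint u (c u v′ , j)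

  module Build (ℳ : Middle) where
    open Middle ℳ

    view-range : ∀ {u v i s} → G ⊢ u ~ v → View u v i s → InRange s
    view-range e (low p q) = p , q
    view-range e (high p q _) = mid-range e p q

    view-inj : ∀ {u v i j s s′} → G ⊢ u ~ v → View u v i s → View u v j s′ → i < j → s ≢ s′
    view-inj e (low _ _) (low _ _) i<j eq = <⇒≢ i<j (cong proj₂ eq)
    view-inj e (low _ _) (high p q _) _ eq = mid-class e p q (sym (cong proj₁ eq))
    view-inj e (high {t} p _ refl) (low _ j≤K) i<j _ =
      linear 3 (λ k t j → con 1 :≤ t :⇒ j :≤ k :⇒ k :+ t :< j :⇒ goal absurd) K t _ p j≤K i<j
    view-inj e (high p _ refl) (high _ q′ refl) i<j eq = mid-inj e p (+-cancelˡ-< K _ _ i<j) q′ eq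

    view-opp : ∀ {u v i j s s′} → G ⊢ u ~ v → View u v i s → View v u j s′ →
      i + j < K + K + suc r → K + K + suc r ≤ i + j + (K + K) → paint u s ≢ paint v s′
    view-opp {i = i} {j} e (low 1≤i i≤K) (low 1≤j j≤K) _ p eq = opp-low e 1≤i i≤K 1≤j j≤K
      (linear 4 (λ k r i j → k :+ k :+ (1+ r) :≤ i :+ j :+ (k :+ k) :⇒ goal (r :< i :+ j)) K r i j p) eq
    view-opp {i = i} {j} e (low 1≤i i≤K) (high {s} 1≤s s≤H refl) _ p eq = opp-mixed e 1≤i i≤K 1≤s s≤H
      (linear 4 (λ k r i s → k :+ k :+ (1+ r) :≤ i :+ (k :+ s) :+ (k :+ k) :⇒ goal (r :< i :+ (k :+ s))) K r i s p) eq
    view-opp {i = i} {j} e (high {t} 1≤t t≤H refl) (low 1≤j j≤K) _ p eq = opp-mixed (adj-flip G e) 1≤j j≤K 1≤t t≤H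
      (linear 4 (λ k r j t → k :+ k :+ (1+ r) :≤ k :+ t :+ j :+ (k :+ k) :⇒ goal (r :< j :+ (k :+ t))) K r j t p) (sym eq)
    view-opp e (high {t} 1≤t t≤H refl) (high {s} 1≤s s≤H refl) p _ eq = opp-high e 1≤t t≤H 1≤s s≤H
      (linear 4 (λ k r t s → k :+ t :+ (k :+ s) :< k :+ k :+ (1+ r) :⇒ goal (t :+ s :≤ r)) K r t s p) eq

    view-cross : ∀ {u v v′ i j s s′} → G ⊢ u ~ v → G ⊢ u ~ v′ → v ≢ v′ →
      View u v i s → View u v′ j s′ → i + j ≤ K + K → s ≢ s′
    view-cross e e′ ne (low _ _) (low _ _) _ eq = ne (c-inj e e′ (cong proj₁ eq))
    view-cross {i = i} e e′ ne (low _ i≤K) (high {s} p q refl) ij≤ eq =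
      linear 4 (λ k i s l → k :< s :+ l :⇒ i :≡ l :⇒ i :+ (k :+ s) :≤ k :+ k :⇒ goal absurd) K i s _ (mid-high e′ p q) (cong proj₂ eq) ij≤
    view-cross {j = j} e e′ ne (high {t} p q refl) (low _ _) ij≤ eq =
      linear 4 (λ k j t l → k :< t :+ l :⇒ l :≡ j :⇒ k :+ t :+ j :≤ k :+ k :⇒ goal absurd) K j t _ (mid-high e p q) (cong proj₂ eq) ij≤
    view-cross e e′ ne (high {t} p _ refl) (high {s} p′ _ refl) ij≤ _ =
      linear 3 (λ k t s → con 1 :≤ t :⇒ con 1 :≤ s :⇒ k :+ t :+ (k :+ s) :≤ k :+ k :⇒ goal absurd) K t s p p′ ij≤

    view-far : ∀ {u v v′ i j s s′} → G ⊢ u ~ v → G ⊢ u ~ v′ → v ≢ v′ →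
      View v u i s → View u v′ j s′ → K + K + suc r + j ≤ i + (K + K) → paint v s ≢ paint u s′
    view-far {i = i} {j} e e′ ne (low _ i≤K) (low 1≤j j≤K) p = far-low e e′ ne 1≤j j≤K i≤K
      (linear 4 (λ k r i j → k :+ k :+ (1+ r) :+ j :≤ i :+ (k :+ k) :⇒ goal (r :+ j :< i)) K r i j p)
    view-far {j = j} e e′ ne (high {t} 1≤t t≤H refl) (low 1≤j j≤K) p = far-high e e′ ne 1≤j j≤K 1≤t t≤H
      (linear 4 (λ k r j t → k :+ k :+ (1+ r) :+ j :≤ k :+ t :+ (k :+ k) :⇒ goal (r :+ j :< k :+ t)) K r j t p)
    view-far {i = i} e e′ ne (low _ i≤K) (high {s} _ _ refl) p _ =
      linear 4 (λ k r i s → k :+ k :+ (1+ r) :+ (k :+ s) :≤ i :+ (k :+ k) :⇒ i :≤ k :⇒ goal absurd) K r i s p i≤K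
    view-far e e′ ne (high {t} _ t≤H refl) (high {s} _ _ refl) p _ =
      linear 5 (λ k r t s H → k :+ k :+ (1+ r) :+ (k :+ s) :≤ k :+ t :+ (k :+ k) :⇒ t :≤ H :⇒ H :+ H :≤ 1+ r :⇒ con 1 :≤ H :⇒ goal absurd)
        K r t s H p t≤H H≤ (≤-trans (linear 4 (λ k r t s → k :+ k :+ (1+ r) :+ (k :+ s) :≤ k :+ t :+ (k :+ k) :⇒ goal (con 1 :≤ t)) K r t s p) t≤H)

    blocks : Blocks G Δ K r H
    blocks = record
      { D = λ u v i → paint u (slot u v i)
      ; valid = λ {u} {v} e 1≤i i≤ → let p , q = view-range e (view u v 1≤i i≤) in lvl-range u _ p q
      ; inj = λ {u} {v} e 1≤i i<j j≤ eq →
          let a = view u v 1≤i (≤-trans (<⇒≤ i<j) j≤)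
              b = view u v (≤-trans 1≤i (<⇒≤ i<j)) j≤
          in view-inj e a b i<j (paint-inj u (view-range e a) (view-range e b) eq)
      ; opp = λ {u} {v} e 1≤i 1≤j i≤ j≤ p q → view-opp e (view u v 1≤i i≤) (view v u 1≤j j≤) p q
      ; cross = λ {u} {v} {v′} e e′ ne 1≤i 1≤j i≤ j≤ p eq →
          let a = view u v 1≤i i≤
              b = view u v′ 1≤j j≤
          in view-cross e e′ ne a b p (paint-inj u (view-range e a) (view-range e′ b) eq)
      ; far = λ {u} {v} {v′} e e′ ne 1≤i 1≤j i≤ j≤ p → view-far e e′ ne (view v u 1≤i i≤) (view u v′ 1≤j j≤) p
      }

-- For `true` the top `w` levels are turned upside down, `l` going to `2K + 1 - w - l`, and the
-- levels up to `K - w` stay in place.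
reversal : ℕ → ℕ → Bool → ℕ → ℕ
reversal K w false l = l
reversal K w true l with K <? l + w
... | yes _ = suc (K + K) ∸ (l + w)
... | no _ = l

data Reversal (K w l : ℕ) : Bool → ℕ → Set where
  keep  : Reversal K w l false l
  below : l + w ≤ K → Reversal K w l true l
  turn  : ∀ {l′} → K < l + w → l + w + l′ ≡ suc (K + K) → Reversal K w l true l′

reversal-view : ∀ {K w} o l → w ≤ K → l ≤ K → Reversal K w l o (reversal K w o l)
reversal-view false l _ _ = keep
reversal-view {K} {w} true l w≤K l≤K with K <? l + w
... | yes p = turn p (m+[n∸m]≡n (≤-trans (+-mono-≤ l≤K w≤K) (n≤1+n (K + K))))
... | no p = below (≮⇒≥ p)

reversal-range : ∀ {K w} o {l} → w ≤ K → 1 ≤ l → l ≤ K → 1 ≤ reversal K w o l × reversal K w o l ≤ K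
reversal-range {K} {w} o {l} w≤K 1≤l l≤K = go (reversal-view o l w≤K l≤K)
  where
  go : ∀ {o l′} → Reversal K w l o l′ → 1 ≤ l′ × l′ ≤ K
  go keep = 1≤l , l≤K
  go (below _) = 1≤l , l≤K
  go (turn {l′} p q) =
    linear 4 (λ k w l m → l :+ w :+ m :≡ 1+ (k :+ k) :⇒ l :≤ k :⇒ w :≤ k :⇒ goal (con 1 :≤ m)) K w l l′ q l≤K w≤K ,
    linear 4 (λ k w l m → l :+ w :+ m :≡ 1+ (k :+ k) :⇒ k :< l :+ w :⇒ goal (m :≤ k)) K w l l′ q p

reversal-inj : ∀ {K w} o {l l′} → w ≤ K → l ≤ K → l′ ≤ K → reversal K w o l ≡ reversal K w o l′ → l ≡ l′
reversal-inj {K} {w} o {l} {l′} w≤K l≤K l′≤K eq = go (reversal-view o l w≤K l≤K) (reversal-view o l′ w≤K l′≤K) eq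
  where
  go : ∀ {o a b} → Reversal K w l o a → Reversal K w l′ o b → a ≡ b → l ≡ l′
  go keep keep refl = refl
  go (below _) (below _) refl = refl
  go (below p) (turn q q′) refl =
    ⊥-elim (linear 4 (λ k w l l′ → l :+ w :≤ k :⇒ l′ :≤ k :⇒ l′ :+ w :+ l :≡ 1+ (k :+ k) :⇒ goal absurd) K w l l′ p l′≤K q′)
  go (turn q q′) (below p) refl =
    ⊥-elim (linear 4 (λ k w l l′ → l′ :+ w :≤ k :⇒ l :≤ k :⇒ l :+ w :+ l′ :≡ 1+ (k :+ k) :⇒ goal absurd) K w l l′ p l≤K q′)
  go (turn {a} _ p) (turn _ q) refl =
    linear 5 (λ k w l l′ a → l :+ w :+ a :≡ 1+ (k :+ k) :⇒ l′ :+ w :+ a :≡ 1+ (k :+ k) :⇒ goal (l :≡ l′)) K w l l′ a p q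

-- Under opposite orders equal colours come from mirror images among the top `w` levels. This turns
-- each possible clash between two hubs into one linear equation.
reversal-mirror : ∀ {K w} o o′ {l l′} → o ≢ o′ → w ≤ K → l ≤ K → l′ ≤ K → K < l + w → K < l′ + w →
  reversal K w o l ≡ reversal K w o′ l′ → l + w + l′ ≡ suc (K + K)
reversal-mirror {K} {w} o o′ {l} {l′} o≢o′ w≤K l≤K l′≤K high high′ eq =
  go (reversal-view o l w≤K l≤K) (reversal-view o′ l′ w≤K l′≤K) o≢o′ eq
  where
  go : ∀ {o o′ a b} → Reversal K w l o a → Reversal K w l′ o′ b → o ≢ o′ → a ≡ b → l + w + l′ ≡ suc (K + K)
  go keep keep ne _ = ⊥-elim (ne refl)
  go keep (below p) _ _ = ⊥-elim (<⇒≱ high′ p)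
  go keep (turn _ p) _ refl =
    linear 4 (λ k w l l′ → l′ :+ w :+ l :≡ 1+ (k :+ k) :⇒ goal (l :+ w :+ l′ :≡ 1+ (k :+ k))) K w l l′ p
  go (below p) _ _ _ = ⊥-elim (<⇒≱ high p)
  go (turn _ p) keep _ refl = p
  go (turn _ _) (below p) _ _ = ⊥-elim (<⇒≱ high′ p)
  go (turn _ _) (turn _ _) ne _ = ⊥-elim (ne refl)

reversal-fixed : ∀ {K w} o {l} → w ≤ K → l + w ≤ K → reversal K w o l ≡ l
reversal-fixed {K} {w} false _ _ = refl
reversal-fixed {K} {w} true {l} w≤K p with K <? l + w
... | yes q = ⊥-elim (<⇒≱ q p)
... | no _ = refl

∸-level : ∀ {K t} → t ≤ K → t + (suc K ∸ t) ≡ suc K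
∸-level {K} p = m+[n∸m]≡n (≤-trans p (n≤1+n K))

-- y u v is a class used by neither end of the edge uv; its top colours fill the middle from the u side.
module DistinctEnds {G : FinSimpleGraph} {Δ K r H : ℕ} (2H≤ : H + H ≤ suc r) (H≤K : H ≤ K)
  (c y : G ⇉ Fin Δ)
  (lvl : V G → Fin Δ → ℕ → ℕ)
  (c-inj : Injective-at G c)
  (c-opp : ∀ {u v} → G ⊢ u ~ v → c u v ≢ c v u)
  (y-class : ∀ {u v} → G ⊢ u ~ v → y u v ≢ c u v × y u v ≢ c v u)
  (lvl-range : ∀ u d {l} → 1 ≤ l → l ≤ K → 1 ≤ lvl u d l × lvl u d l ≤ K)
  (lvl-inj : ∀ u d {l l′} → 1 ≤ l → l ≤ K → 1 ≤ l′ → l′ ≤ K → lvl u d l ≡ lvl u d l′ → l ≡ l′)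
  (lvl-far-low : ∀ u v d {i j} → 1 ≤ j → j ≤ K → i ≤ K → r + j < i → lvl v d i ≢ lvl u d j)
  (lvl-far-high : ∀ u v d {t l j} → 1 ≤ j → j ≤ K → 1 ≤ t → t ≤ H → t + l ≡ suc K → r + j < K + t → lvl v d l ≢ lvl u d j)
  (lvl-opp : ∀ {u v t s l l′} → G ⊢ u ~ v → 1 ≤ t → t ≤ H → 1 ≤ s → s ≤ H → t + l ≡ suc K → s + l′ ≡ suc K → t + s ≤ r →
     y u v ≡ y v u → lvl u (y u v) l ≢ lvl v (y v u) l′)
  where

  mid : V G → V G → ℕ → Fin Δ × ℕ
  mid u v t = y u v , suc K ∸ t

  level : ∀ {t} → t ≤ H → t + (suc K ∸ t) ≡ suc K
  level t≤H = ∸-level (≤-trans t≤H H≤K)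

  open Scheme {G} {Δ} {K} {r} {H} 2H≤ c lvl mid c-inj lvl-range lvl-inj

  same-class : ∀ u v {d d′ l l′} → paint u (d , l) ≡ paint v (d′ , l′) → d ≡ d′ × lvl u d l ≡ lvl v d l′
  same-class u v refl′ with cong proj₁ refl′
  ... | refl = refl , cong proj₂ refl′

  middle : Middle
  middle = record
    { mid-range = λ {_} {_} {t} _ 1≤t t≤H →
        linear 4 (λ k t l H → t :+ l :≡ 1+ k :⇒ t :≤ H :⇒ H :≤ k :⇒ goal (con 1 :≤ l)) K t (suc K ∸ t) H (level t≤H) t≤H H≤K ,
        linear 3 (λ k t l → t :+ l :≡ 1+ k :⇒ con 1 :≤ t :⇒ goal (l :≤ k)) K t (suc K ∸ t) (level t≤H) 1≤t
    ; mid-high = λ _ _ t≤H → ≤-reflexive (sym (level t≤H))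
    ; mid-class = λ e _ _ → proj₁ (y-class e)
    ; mid-inj = λ {_} {_} {t} {t′} _ _ t<t′ t′≤H eq →
        linear 4 (λ k t t′ l → t :+ l :≡ 1+ k :⇒ t′ :+ l :≡ 1+ k :⇒ t :< t′ :⇒ goal absurd) K t t′ (suc K ∸ t)
          (level (≤-trans (<⇒≤ t<t′) t′≤H)) (trans (cong (t′ +_) (cong proj₂ eq)) (level t′≤H)) t<t′
    ; opp-low = λ e _ _ _ _ _ eq → c-opp e (cong proj₁ eq)
    ; opp-mixed = λ {u} {v} e _ _ _ _ _ eq → proj₂ (y-class (adj-flip G e)) (sym (cong proj₁ eq))
    ; opp-high = λ {u} {v} e 1≤t t≤H 1≤s s≤H p eq →
        lvl-opp e 1≤t t≤H 1≤s s≤H (level t≤H) (level s≤H) p (cong proj₁ eq) (cong proj₂ eq)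
    ; far-low = λ {u} {v} e e′ _ 1≤j j≤K i≤K p eq →
        let q , q′ = same-class v u eq in lvl-far-low u v _ 1≤j j≤K i≤K p q′
    ; far-high = λ {u} {v} e e′ _ 1≤j j≤K 1≤t t≤H p eq →
        let q , q′ = same-class v u eq in lvl-far-high u v _ 1≤j j≤K 1≤t t≤H (level t≤H) p q′
    }

  open Build middle public using (blocks)

module TwoThirds {G : FinSimpleGraph} {Δ K r H : ℕ} (2H≤ : H + H ≤ suc r) (H≤K : H ≤ K)
  (c y : G ⇉ Fin Δ)
  (c-inj : Injective-at G c)
  (c-opp : ∀ {u v} → G ⊢ u ~ v → c u v ≢ c v u)
  (y-class : ∀ {u v} → G ⊢ u ~ v → y u v ≢ c u v × y u v ≢ c v u)
  (y-opp : ∀ {u v} → G ⊢ u ~ v → y u v ≢ y v u) where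

  -- Each end fills its half of the middle from a class of its own, so the identity can order the
  -- levels at every hub. A remote middle vertex could meet its own colour only if `r + 1 < 2t`,
  -- which `t ≤ H` excludes.
  twoThirds : Blocks G Δ K r H
  twoThirds = DistinctEnds.blocks 2H≤ H≤K c y (λ _ _ l → l) c-inj c-opp y-class
    (λ _ _ p q → p , q)
    (λ _ _ _ _ _ _ eq → eq)
    (λ { _ _ _ {i} 1≤j _ _ p refl → linear 2 (λ r i → r :+ i :< i :⇒ goal absurd) r i p })
    (λ { _ _ _ {t} {l} _ _ 1≤t t≤H q p refl →
      linear 5 (λ k r H t l → t :+ l :≡ 1+ k :⇒ r :+ l :< k :+ t :⇒ t :≤ H :⇒ H :+ H :≤ 1+ r :⇒ goal absurd) K r H t l q p t≤H 2H≤ })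
    (λ e _ _ _ _ _ _ _ q _ → y-opp e q)

module OneThird {G : FinSimpleGraph} {Δ K r H : ℕ} (2H≤ : H + H ≤ suc r) (r≤K : r ≤ K)
  (c y : G ⇉ Fin Δ)
  (o : V G → Fin Δ → Bool)
  (c-inj : Injective-at G c)
  (c-opp : ∀ {u v} → G ⊢ u ~ v → c u v ≢ c v u)
  (y-class : ∀ {u v} → G ⊢ u ~ v → y u v ≢ c u v × y u v ≢ c v u)
  (o-opp : ∀ {u v} → G ⊢ u ~ v → y u v ≡ y v u → o u (y u v) ≢ o v (y v u)) where

  -- Only the top `r` levels, which supply the middle, are reversed. If a remote vertex of the first
  -- `K` is within reach of level `j`, then `j ≤ K - r`, and both orders fix that level.
  lvl : V G → Fin Δ → ℕ → ℕ
  lvl u d = reversal K r (o u d)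

  top : ∀ {t l} → 1 ≤ t → t ≤ H → t + l ≡ suc K → K < l + r
  top {t} {l} 1≤t t≤H q =
    linear 5 (λ k r H t l → con 1 :≤ t :⇒ t :≤ H :⇒ H :+ H :≤ 1+ r :⇒ t :+ l :≡ 1+ k :⇒ goal (k :< l :+ r)) K r H t l 1≤t t≤H 2H≤ q

  level≤ : ∀ {t l} → 1 ≤ t → t + l ≡ suc K → l ≤ K
  level≤ {t} {l} 1≤t q = linear 3 (λ k t l → con 1 :≤ t :⇒ t :+ l :≡ 1+ k :⇒ goal (l :≤ k)) K t l 1≤t q

  far-low : ∀ u v d {i j} → 1 ≤ j → j ≤ K → i ≤ K → r + j < i → lvl v d i ≢ lvl u d j
  far-low u v d {i} {j} _ j≤K i≤K p eq = linear 3 (λ r i j → r :+ j :< i :⇒ i :≡ j :⇒ goal absurd) r i j p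
    (reversal-inj (o v d) r≤K i≤K j≤K (trans eq (trans (fixed (o u d)) (sym (fixed (o v d))))))
    where
    fixed : ∀ b → reversal K r b j ≡ j
    fixed b = reversal-fixed b r≤K (linear 4 (λ k r i j → r :+ j :< i :⇒ i :≤ k :⇒ goal (j :+ r :≤ k)) K r i j p i≤K)

  far-high : ∀ u v d {t l j} → 1 ≤ j → j ≤ K → 1 ≤ t → t ≤ H → t + l ≡ suc K → r + j < K + t → lvl v d l ≢ lvl u d j
  far-high u v d {t} {l} {j} _ j≤K 1≤t t≤H q p eq with K <? j + r
  ... | no ¬high = linear 4 (λ k r l j → k :< l :+ r :⇒ j :+ r :≤ k :⇒ l :≡ j :⇒ goal absurd) K r l j (top 1≤t t≤H q) (≮⇒≥ ¬high)
    (reversal-inj (o v d) r≤K (level≤ 1≤t q) j≤K (trans eq (trans (fixed (o u d)) (sym (fixed (o v d))))))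
    where
    fixed : ∀ b → reversal K r b j ≡ j
    fixed b = reversal-fixed b r≤K (≮⇒≥ ¬high)
  ... | yes high with o v d Bool.≟ o u d
  ...   | yes same = linear 6 (λ k r H t l j → t :+ l :≡ 1+ k :⇒ r :+ j :< k :+ t :⇒ t :≤ H :⇒ H :+ H :≤ 1+ r :⇒ l :≡ j :⇒ goal absurd)
    K r H t l j q p t≤H 2H≤
    (reversal-inj (o v d) r≤K (level≤ 1≤t q) j≤K (trans eq (cong (λ b → reversal K r b j) (sym same))))
  ...   | no differ = linear 5 (λ k r t l j → t :+ l :≡ 1+ k :⇒ r :+ j :< k :+ t :⇒ l :+ r :+ j :≡ 1+ (k :+ k) :⇒ goal absurd)
    K r t l j q p (reversal-mirror (o v d) (o u d) differ r≤K (level≤ 1≤t q) j≤K (top 1≤t t≤H q) high eq)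

  -- With levels `K + 1 - t` and `K + 1 - s` the mirror equation gives `t + s = r + 1`, that is, one
  -- and the same vertex seen from both ends.
  opposite : ∀ {u v t s l l′} → G ⊢ u ~ v → 1 ≤ t → t ≤ H → 1 ≤ s → s ≤ H → t + l ≡ suc K → s + l′ ≡ suc K → t + s ≤ r →
    y u v ≡ y v u → lvl u (y u v) l ≢ lvl v (y v u) l′
  opposite {u} {v} {t} {s} {l} {l′} e 1≤t t≤H 1≤s s≤H q q′ p y≡ eq =
    linear 6 (λ k r t s l l′ → t :+ l :≡ 1+ k :⇒ s :+ l′ :≡ 1+ k :⇒ t :+ s :≤ r :⇒ l :+ r :+ l′ :≡ 1+ (k :+ k) :⇒ goal absurd)
      K r t s l l′ q q′ p
      (reversal-mirror (o u (y u v)) (o v (y v u)) (o-opp e y≡) r≤K (level≤ 1≤t q) (level≤ 1≤s q′) (top 1≤t t≤H q) (top 1≤s s≤H q′) eq)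

  oneThird : Blocks G Δ K r H
  oneThird = DistinctEnds.blocks 2H≤
    (≮⇒≥ λ K<H → linear 3 (λ k r H → H :+ H :≤ 1+ r :⇒ r :≤ k :⇒ k :< H :⇒ goal absurd) K r H 2H≤ r≤K K<H)
    c y lvl c-inj c-opp y-class
    (λ u d p q → reversal-range (o u d) r≤K p q)
    (λ u d _ p _ q → reversal-inj (o u d) r≤K p q)
    far-low far-high opposite

-- On an edge with equal ends the middle is filled from two further classes; on an edge with ends a ≠ b it is filled,
-- on the a side, first with E colours of class b and then with top colours of a third class.
module AnyEnds {G : FinSimpleGraph} {Δ K E H : ℕ} (2H≤ : H + H ≤ suc (K + (E + E))) (1≤E : 1 ≤ E) (2E≤K : E + E ≤ K)
  (c y : G ⇉ Fin Δ)
  (o : V G → Fin Δ → Bool)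
  (c-inj : Injective-at G c)
  (bits : ∀ {u v} → G ⊢ u ~ v →
    (c u v ≡ c v u × o u (c u v) ≢ o v (c u v)) ⊎ (c u v ≢ c v u × ∀ d → o u d ≢ o v d))
  (y-class : ∀ {u v} → G ⊢ u ~ v → y u v ≢ c u v × y u v ≢ c v u)
  (y-opp : ∀ {u v} → G ⊢ u ~ v → c u v ≡ c v u → y u v ≢ y v u) where

  r : ℕ
  r = K + (E + E)

  H≤K : H ≤ K
  H≤K = ≮⇒≥ λ K<H →
    linear 3 (λ k E H → H :+ H :≤ 1+ (k :+ (E :+ E)) :⇒ E :+ E :≤ k :⇒ k :< H :⇒ goal absurd) K E H 2H≤ 2E≤K K<H

  lvl : V G → Fin Δ → ℕ → ℕ
  lvl u d = reversal K K (o u d)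

  mid : V G → V G → ℕ → Fin Δ × ℕ
  mid u v t with c u v Fin.≟ c v u
  ... | yes _ = y u v , suc K ∸ t
  ... | no _ with t ≤? E
  ...   | yes _ = c v u , suc K ∸ t
  -- The shift by `E` makes the third class start at its top level `K` when `t = E + 1`.
  ...   | no _ = y u v , suc K + E ∸ t

  data Mid u v t : Fin Δ × ℕ → Set where
    equal : ∀ {l} → c u v ≡ c v u → t + l ≡ suc K → Mid u v t (y u v , l)
    near  : ∀ {l} → c u v ≢ c v u → t ≤ E → t + l ≡ suc K → Mid u v t (c v u , l)
    far   : ∀ {l} → c u v ≢ c v u → E < t → t + l ≡ suc K + E → Mid u v t (y u v , l)

  midView : ∀ u v {t} → t ≤ H → Mid u v t (mid u v t)
  midView u v {t} t≤H with c u v Fin.≟ c v u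
  ... | yes p = equal p (∸-level (≤-trans t≤H H≤K))
  ... | no p with t ≤? E
  ...   | yes q = near p q (∸-level (≤-trans t≤H H≤K))
  ...   | no q = far p (≰⇒> q) (m+[n∸m]≡n (≤-trans (≤-trans t≤H H≤K) (≤-trans (n≤1+n K) (m≤m+n (suc K) E))))

  top : ∀ {l} → 1 ≤ l → K < l + K
  top 1≤l = +-monoˡ-≤ K 1≤l

  open Scheme {G} {Δ} {K} {r} {H} 2H≤ c lvl mid c-inj
    (λ u d p q → reversal-range (o u d) ≤-refl p q)
    (λ u d _ p _ q → reversal-inj (o u d) ≤-refl p q)

  mirror : ∀ {u v d l l′} → o u d ≢ o v d → InRange (d , l) → InRange (d , l′) → lvl u d l ≡ lvl v d l′ → l + l′ ≡ suc K
  mirror {u} {v} {d} {l} {l′} ne (p , q) (p′ , q′) eq =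
    linear 3 (λ k l l′ → l :+ k :+ l′ :≡ 1+ (k :+ k) :⇒ goal (l :+ l′ :≡ 1+ k)) K l l′
      (reversal-mirror (o u d) (o v d) ne ≤-refl q q′ (top p) (top p′) eq)

  level : ∀ {u v d d′ l l′} → paint u (d , l) ≡ paint v (d′ , l′) → d ≡ d′ × (d ≡ d′ → lvl u d l ≡ lvl v d l′)
  level eq with cong proj₁ eq
  ... | refl = refl , λ _ → cong proj₂ eq

  unequal : ∀ {u v} → G ⊢ u ~ v → c u v ≢ c v u → ∀ d → o u d ≢ o v d
  unequal e ne with bits e
  ... | inj₁ (q , _) = ⊥-elim (ne q)
  ... | inj₂ (_ , q) = q

  Mid-range : ∀ {u v t s} → 1 ≤ t → t ≤ H → Mid u v t s → InRange s
  Mid-range {t = t} 1≤t t≤H (equal {l} _ q) =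
    linear 3 (λ k t l → t :+ l :≡ 1+ k :⇒ t :≤ k :⇒ goal (con 1 :≤ l)) K t l q (≤-trans t≤H H≤K) ,
    linear 3 (λ k t l → t :+ l :≡ 1+ k :⇒ con 1 :≤ t :⇒ goal (l :≤ k)) K t l q 1≤t
  Mid-range {t = t} 1≤t t≤H (near {l} _ _ q) =
    linear 3 (λ k t l → t :+ l :≡ 1+ k :⇒ t :≤ k :⇒ goal (con 1 :≤ l)) K t l q (≤-trans t≤H H≤K) ,
    linear 3 (λ k t l → t :+ l :≡ 1+ k :⇒ con 1 :≤ t :⇒ goal (l :≤ k)) K t l q 1≤t
  Mid-range {t = t} 1≤t t≤H (far {l} _ p q) =
    linear 4 (λ k E t l → t :+ l :≡ 1+ k :+ E :⇒ t :≤ k :⇒ goal (con 1 :≤ l)) K E t l q (≤-trans t≤H H≤K) ,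
    linear 4 (λ k E t l → t :+ l :≡ 1+ k :+ E :⇒ E :< t :⇒ goal (l :≤ k)) K E t l q p

  Mid-high : ∀ {u v t s} → Mid u v t s → K < t + proj₂ s
  Mid-high (equal _ q) = ≤-reflexive (sym q)
  Mid-high (near _ _ q) = ≤-reflexive (sym q)
  Mid-high (far _ _ q) = ≤-trans (m≤m+n (suc K) E) (≤-reflexive (sym q))

  Mid-class : ∀ {u v t s} → G ⊢ u ~ v → Mid u v t s → proj₁ s ≢ c u v
  Mid-class e (equal _ _) = proj₁ (y-class e)
  Mid-class e (near p _ _) = p ∘ sym
  Mid-class e (far _ _ _) = proj₁ (y-class e)

  Mid-inj : ∀ {u v t t′ s s′} → G ⊢ u ~ v → Mid u v t s → Mid u v t′ s′ → t < t′ → s ≢ s′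
  Mid-inj e (equal {l} _ q) (equal _ q′) t<t′ refl = <⇒≢ t<t′ (+-cancelʳ-≡ l _ _ (trans q (sym q′)))
  Mid-inj e (near {l} _ _ q) (near _ _ q′) t<t′ refl = <⇒≢ t<t′ (+-cancelʳ-≡ l _ _ (trans q (sym q′)))
  Mid-inj e (far {l} _ _ q) (far _ _ q′) t<t′ refl = <⇒≢ t<t′ (+-cancelʳ-≡ l _ _ (trans q (sym q′)))
  Mid-inj e (near _ _ _) (far _ _ _) _ eq = proj₂ (y-class e) (sym (cong proj₁ eq))
  Mid-inj e (far _ p _) (near _ q _) t<t′ _ = <⇒≱ (<-trans p t<t′) q
  Mid-inj e (equal p _) (near q _ _) _ _ = q p
  Mid-inj e (equal p _) (far q _ _) _ _ = q p
  Mid-inj e (near q _ _) (equal p _) _ _ = q p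
  Mid-inj e (far q _ _) (equal p _) _ _ = q p

  -- The critical case is a colour of the class of `u` borrowed at the `s`-th middle vertex from
  -- `v`. In the opposite order its owner is the vertex `i = s` after `u`, and being within reach
  -- means `2s > 2E`, against `s ≤ E`.
  Mid-mixed : ∀ {u v i s σ} → G ⊢ u ~ v → 1 ≤ i → i ≤ K → 1 ≤ s → s ≤ H → r < i + (K + s) → Mid v u s σ →
    paint u (c u v , i) ≢ paint v σ
  Mid-mixed e _ _ _ _ _ (equal _ _) eq = proj₂ (y-class (adj-flip G e)) (sym (cong proj₁ eq))
  Mid-mixed {u} {v} {i} {s} e 1≤i i≤K 1≤s s≤H p m@(near {l} ne s≤E q) eq =
    linear 5 (λ k E i s l → i :+ l :≡ 1+ k :⇒ s :+ l :≡ 1+ k :⇒ s :≤ E :⇒ k :+ (E :+ E) :< i :+ (k :+ s) :⇒ goal absurd) K E i s l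
      (mirror {u} {v} {c u v} (unequal e (ne ∘ sym) _) (1≤i , i≤K) (Mid-range 1≤s s≤H m) (cong proj₂ eq)) q s≤E p
  Mid-mixed e _ _ _ _ _ (far _ _ _) eq = proj₂ (y-class (adj-flip G e)) (sym (cong proj₁ eq))

  -- Different kinds of middle slots use different classes. In the third class, shared by both ends,
  -- a clash would need `t + s = r + 1`, the same vertex.
  Mid-opp : ∀ {u v t s σ τ} → G ⊢ u ~ v → 1 ≤ t → t ≤ H → 1 ≤ s → s ≤ H → t + s ≤ r → Mid u v t σ → Mid v u s τ →
    paint u σ ≢ paint v τ
  Mid-opp e _ _ _ _ _ (equal p _) (equal _ _) eq = y-opp e p (cong proj₁ eq)
  Mid-opp e _ _ _ _ _ (near p _ _) (near _ _ _) eq = p (sym (cong proj₁ eq))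
  Mid-opp e _ _ _ _ _ (near _ _ _) (far _ _ _) eq = proj₁ (y-class (adj-flip G e)) (sym (cong proj₁ eq))
  Mid-opp e _ _ _ _ _ (far _ _ _) (near _ _ _) eq = proj₁ (y-class e) (cong proj₁ eq)
  Mid-opp {u} {v} {t} {s} e 1≤t t≤H 1≤s s≤H p m@(far {l} ne _ q) m′@(far {l′} _ _ q′) eq =
    linear 6 (λ k E t s l l′ → l :+ l′ :≡ 1+ k :⇒ t :+ l :≡ 1+ k :+ E :⇒ s :+ l′ :≡ 1+ k :+ E :⇒
      t :+ s :≤ k :+ (E :+ E) :⇒ goal absurd) K E t s l l′
      (mirror {u} {v} {y u v} (unequal e ne _) (Mid-range 1≤t t≤H m) (Mid-range 1≤s s≤H m′)
        (proj₂ (level {u} {v} eq) (proj₁ (level {u} {v} eq)))) q q′ p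
  Mid-opp e _ _ _ _ _ (equal p _) (near q _ _) _ = q (sym p)
  Mid-opp e _ _ _ _ _ (equal p _) (far q _ _) _ = q (sym p)
  Mid-opp e _ _ _ _ _ (near q _ _) (equal p _) _ = q (sym p)
  Mid-opp e _ _ _ _ _ (far q _ _) (equal p _) _ = q (sym p)

  -- On an edge with equal ends `bits` does not compare the orders of the spare classes at `u` and
  -- `v`, so both possibilities are refuted: equal orders by `t ≤ H`, opposite ones by `r ≥ K`.
  Mid-far : ∀ {u v v′ t j σ} → G ⊢ u ~ v → G ⊢ u ~ v′ → v ≢ v′ →
    1 ≤ j → j ≤ K → 1 ≤ t → t ≤ H → r + j < K + t → Mid v u t σ → paint v σ ≢ paint u (c u v′ , j)
  Mid-far {u} {v} {v′} {t} {j} e e′ v≢v′ 1≤j j≤K 1≤t t≤H p m@(equal {l} _ q) eq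
    with o v (y v u) Bool.≟ o u (y v u) | proj₂ (level {v} {u} eq) (proj₁ (level {v} {u} eq))
  ... | yes same | eq′ =
    linear 6 (λ k E H t l j → t :+ l :≡ 1+ k :⇒ k :+ (E :+ E) :+ j :< k :+ t :⇒ t :≤ H :⇒ H :+ H :≤ 1+ (k :+ (E :+ E)) :⇒ l :≡ j :⇒ goal absurd)
      K E H t l j q p t≤H 2H≤
      (reversal-inj (o v (y v u)) ≤-refl (proj₂ (Mid-range 1≤t t≤H m)) j≤K
        (trans eq′ (cong (λ b → reversal K K b j) (sym same))))
  ... | no differ | eq′ =
    linear 5 (λ k E t l j → t :+ l :≡ 1+ k :⇒ k :+ (E :+ E) :+ j :< k :+ t :⇒ l :+ j :≡ 1+ k :⇒ goal absurd) K E t l j q p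
      (mirror {v} {u} {y v u} differ (Mid-range 1≤t t≤H m) (1≤j , j≤K) eq′)
  Mid-far e e′ ne _ _ _ _ _ (near _ _ _) eq = ne (c-inj e e′ (cong proj₁ eq))
  Mid-far {u} {v} {v′} {t} {j} e e′ v≢v′ 1≤j j≤K 1≤t t≤H p m@(far {l} ne _ q) eq =
    linear 5 (λ k E t l j → t :+ l :≡ 1+ k :+ E :⇒ k :+ (E :+ E) :+ j :< k :+ t :⇒ l :+ j :≡ 1+ k :⇒ goal absurd) K E t l j q p
      (mirror {v} {u} {y v u} (unequal (adj-flip G e) ne _) (Mid-range 1≤t t≤H m) (1≤j , j≤K)
        (proj₂ (level {v} {u} eq) (proj₁ (level {v} {u} eq))))

  -- If the ends have the same class, opposite orders give equal colours only at `i + j = K + 1`,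
  -- which is out of reach because `E ≥ 1` makes `r` larger than `K`.
  opp-low : ∀ {u v i j} → G ⊢ u ~ v → 1 ≤ i → i ≤ K → 1 ≤ j → j ≤ K → r < i + j → paint u (c u v , i) ≢ paint v (c v u , j)
  opp-low {u} {v} {i} {j} e 1≤i i≤K 1≤j j≤K p eq with bits e
  ... | inj₂ (ne , _) = ne (cong proj₁ eq)
  ... | inj₁ (_ , δ) =
    linear 4 (λ k E i j → i :+ j :≡ 1+ k :⇒ k :+ (E :+ E) :< i :+ j :⇒ con 1 :≤ E :⇒ goal absurd) K E i j
      (mirror {u} {v} {c u v} δ (1≤i , i≤K) (1≤j , j≤K) (proj₂ (level {u} {v} eq) (proj₁ (level {u} {v} eq)))) p 1≤E

  middle : Middle
  middle = record
    { mid-range = λ {u} {v} _ 1≤t t≤H → Mid-range 1≤t t≤H (midView u v t≤H)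
    ; mid-high = λ {u} {v} _ _ t≤H → Mid-high (midView u v t≤H)
    ; mid-class = λ {u} {v} e _ t≤H → Mid-class e (midView u v t≤H)
    ; mid-inj = λ {u} {v} e _ t<t′ t′≤H → Mid-inj e (midView u v (≤-trans (<⇒≤ t<t′) t′≤H)) (midView u v t′≤H) t<t′
    ; opp-low = opp-low
    ; opp-mixed = λ {u} {v} e 1≤i i≤K 1≤s s≤H p → Mid-mixed e 1≤i i≤K 1≤s s≤H p (midView v u s≤H)
    ; opp-high = λ {u} {v} e 1≤t t≤H 1≤s s≤H p → Mid-opp e 1≤t t≤H 1≤s s≤H p (midView u v t≤H) (midView v u s≤H)
    ; far-low = λ {i = i} {j} _ _ _ _ _ i≤K p _ →
        linear 4 (λ k E i j → k :+ (E :+ E) :+ j :< i :⇒ i :≤ k :⇒ goal absurd) K E i j p i≤K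
    ; far-high = λ {u} {v} e e′ ne 1≤j j≤K 1≤t t≤H p → Mid-far e e′ ne 1≤j j≤K 1≤t t≤H p (midView v u t≤H)
    }

  open Build middle public using (blocks)

-- Components of a union of two matchings

-- Pigeonhole: each `i` rules out at most one `d`, so if every `d` were ruled out, choosing a
-- witness would be an injection into the smaller set.
avoid : ∀ {Δ s} (R : Fin Δ → Fin s → Set) → (∀ d i → Dec (R d i)) → (∀ {d d′ i} → R d i → R d′ i → d ≡ d′) → s < Δ →
  Σ (Fin Δ) λ d → ∀ i → ¬ R d i
avoid {Δ} {s} R R? functional s<Δ with Fin.any? (λ d → Fin.all? (λ i → ¬? (R? d i)))
... | yes p = p
... | no none = ⊥-elim (<⇒≱ s<Δ (Fin.injective⇒≤ {f = proj₁ ∘ hit}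
    λ {d} {d′} eq → functional (proj₂ (hit d)) (subst (R d′) (sym eq) (proj₂ (hit d′)))))
  where
  hit : ∀ d → Σ (Fin s) (R d)
  hit d with Fin.any? (R? d)
  ... | yes p = p
  ... | no q = ⊥-elim (none (d , λ i r → q (i , r)))

fresh : ∀ {Δ s} (xs : Vec (Fin Δ) s) → s < Δ → Σ (Fin Δ) λ d → ∀ i → d ≢ lookup xs i
fresh xs = avoid (λ d i → d ≡ lookup xs i) (λ d i → d Fin.≟ lookup xs i) (λ p q → trans p (sym q))

bool-cases : ∀ (b c : Bool) → b ≡ c ⊎ b ≡ not c
bool-cases false false = inj₁ refl
bool-cases false true = inj₂ refl
bool-cases true false = inj₂ refl
bool-cases true true = inj₁ refl

true≢false : ∀ {b} → b ≡ true → b ≢ false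
true≢false refl ()

module Component {X : Set} (_≟_ : ∀ (x y : X) → Dec (x ≡ y)) (xs : List X) (complete : ∀ x → x ∈ xs)
  (R : Bool → X → X → Bool)
  (R-sym : ∀ {b x y} → R b x y ≡ true → R b y x ≡ true)
  (R-fun : ∀ {b x y z} → R b x y ≡ true → R b x z ≡ true → y ≡ z) where

  Miss : Bool → X → Set
  Miss b x = ∀ {y} → R b x y ≢ true

  missing : (X → Bool) → List X → ℕ
  missing S [] = 0
  missing S (y ∷ ys) = (if S y then 0 else 1) + missing S ys

  insert : X → (X → Bool) → X → Bool
  insert w S x = isYes (x ≟ w) ∨ S x

  insert-new : ∀ w S → insert w S w ≡ true
  insert-new w S with w ≟ w
  ... | yes _ = refl
  ... | no ne = ⊥-elim (ne refl)

  insert-old : ∀ w S {x} → S x ≡ true → insert w S x ≡ true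
  insert-old w S {x} p with x ≟ w
  ... | yes _ = refl
  ... | no _ = p

  insert-cases : ∀ w S {x} → insert w S x ≡ true → x ≡ w ⊎ (x ≢ w × S x ≡ true)
  insert-cases w S {x} p with x ≟ w
  ... | yes q = inj₁ q
  ... | no q = inj₂ (q , p)

  missing-insert : ∀ w S ys → missing (insert w S) ys ≤ missing S ys
  missing-insert w S [] = z≤n
  missing-insert w S (y ∷ ys) with y ≟ w | S y
  ... | yes _ | true = missing-insert w S ys
  ... | yes _ | false = m≤n⇒m≤1+n (missing-insert w S ys)
  ... | no _ | true = missing-insert w S ys
  ... | no _ | false = s≤s (missing-insert w S ys)

  missing-insert-< : ∀ w S ys → w ∈ ys → S w ≡ false → missing (insert w S) ys < missing S ys
  missing-insert-< w S (y ∷ ys) (here refl) p with y ≟ y | S y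
  missing-insert-< w S (y ∷ ys) (here refl) refl | yes _ | .false = s≤s (missing-insert w S ys)
  ... | no ne | _ = ⊥-elim (ne refl)
  missing-insert-< w S (y ∷ ys) (there i) p with y ≟ w | S y
  ... | yes _ | true = missing-insert-< w S ys i p
  ... | yes _ | false = m≤n⇒m≤1+n (missing-insert-< w S ys i p)
  ... | no _ | true = missing-insert-< w S ys i p
  ... | no _ | false = s≤s (missing-insert-< w S ys i p)

  module From (p : X) (b₀ : Bool) (p-miss : Miss b₀ p) where

    -- The alternating walk from p; the index is the matching of the last step.
    data Trail : Bool → X → Set where
      start : Trail b₀ p
      step  : ∀ {b y z} → Trail b y → R (not b) y z ≡ true → Trail (not b) z

    record Closed : Set where
      field
        S      : X → Bool
        p∈S    : S p ≡ true
        closed : ∀ {b x y} → R b x y ≡ true → S x ≡ true → S y ≡ true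
        last   : X
        kind   : Bool
        trail  : Trail kind last
        ends   : ∀ {b z} → S z ≡ true → Miss b z → z ≡ p ⊎ z ≡ last

    -- The visited vertices other than `t` have all their partners in `S`, and `t` has the partner
    -- by which it was entered, so only its partner in the other matching can be new. Each step
    -- lowers `missing`, which bounds the fuel. At `p`, the matching that it misses counts as the
    -- one of the last step.
    grow : ∀ fuel S t b → missing S xs ≤ fuel → Trail b t → S p ≡ true → S t ≡ true →
      (∀ {b z y} → S z ≡ true → z ≢ t → R b z y ≡ true → S y ≡ true) →
      (∀ {y} → R b t y ≡ true → S y ≡ true) →
      (∀ {b z} → S z ≡ true → Miss b z → z ≡ p ⊎ z ≡ t) → Closed
    grow fuel S t b enough trail p∈S t∈S inner back ends
      with Any.any? (λ w → (R (not b) t w Bool.≟ true) ×-dec (S w Bool.≟ false)) xs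
    ... | no stuck = record { S = S ; p∈S = p∈S ; closed = closed ; last = t ; kind = b ; trail = trail ; ends = ends }
      where
      closed : ∀ {b x y} → R b x y ≡ true → S x ≡ true → S y ≡ true
      closed {b′} {x} {y} r x∈S with x ≟ t
      ... | no x≢t = inner x∈S x≢t r
      ... | yes refl with bool-cases b′ b
      ...   | inj₁ refl = back r
      ...   | inj₂ refl with S y in eq
      ...     | true = refl
      ...     | false = ⊥-elim (stuck (lose (complete y) (r , eq)))
    grow fuel S t b enough trail p∈S t∈S inner back ends | yes found with find found
    grow zero S t b enough _ _ _ _ _ _ | yes _ | w , w∈xs , _ , w∉S =
      ⊥-elim (<⇒≱ (missing-insert-< w S xs w∈xs w∉S) (≤-trans enough z≤n))
    grow (suc fuel) S t b enough trail p∈S t∈S inner back ends | yes _ | w , w∈xs , r , w∉S =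
      grow fuel (insert w S) w (not b) (s≤s⁻¹ (≤-trans (missing-insert-< w S xs w∈xs w∉S) enough))
        (step trail r) (insert-old w S p∈S) (insert-new w S) inner′
        (λ r′ → subst (λ y → insert w S y ≡ true) (R-fun (R-sym r) r′) (insert-old w S t∈S)) ends′
      where
      inner′ : ∀ {b z y} → insert w S z ≡ true → z ≢ w → R b z y ≡ true → insert w S y ≡ true
      inner′ {b′} {z} z∈ z≢w r′ with insert-cases w S z∈
      ... | inj₁ z≡w = ⊥-elim (z≢w z≡w)
      ... | inj₂ (_ , z∈S) with z ≟ t
      ...   | no z≢t = insert-old w S (inner z∈S z≢t r′)
      ...   | yes refl with bool-cases b′ b
      ...     | inj₁ refl = insert-old w S (back r′)
      ...     | inj₂ refl = subst (λ y → insert w S y ≡ true) (R-fun r r′) (insert-new w S)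
      -- The former last vertex now has partners in both matchings, unless it is the starting point.
      t-end : ∀ {b c z} → Trail c z → R (not c) z w ≡ true → Miss b z → z ≡ p
      t-end start _ _ = refl
      t-end {b′} (step {b = c} tr r₁) r₂ miss with bool-cases b′ (not c)
      ... | inj₁ refl = ⊥-elim (miss (R-sym r₁))
      ... | inj₂ refl = ⊥-elim (miss r₂)
      ends′ : ∀ {b z} → insert w S z ≡ true → Miss b z → z ≡ p ⊎ z ≡ w
      ends′ z∈ miss with insert-cases w S z∈
      ... | inj₁ z≡w = inj₂ z≡w
      ... | inj₂ (_ , z∈S) with ends z∈S miss
      ...   | inj₁ z≡p = inj₁ z≡p
      ...   | inj₂ refl = inj₁ (t-end trail r miss)

    abstract
      component : Closed
      component = grow (missing (insert p (λ _ → false)) xs) (insert p (λ _ → false)) p b₀ ≤-refl start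
        (insert-new p _) (insert-new p _)
        (λ z∈ z≢p _ → ⊥-elim (z≢p (only z∈)))
        (λ r → ⊥-elim (p-miss r))
        (λ z∈ _ → inj₁ (only z∈))
        where
        only : ∀ {z} → insert p (λ _ → false) z ≡ true → z ≡ p
        only {z} z∈ with insert-cases p (λ _ → false) {z} z∈
        ... | inj₁ q = q

    -- The parity of the number of steps determines both the matching used last and, as `o`
    -- alternates, the side reached.
    trail-parity : ∀ (o : X → Bool) → (∀ {b x y} → R b x y ≡ true → o x ≢ o y) → ∀ {b t} → Trail b t →
      (b ≡ b₀ × o t ≡ o p) ⊎ (b ≡ not b₀ × o t ≡ not (o p))
    trail-parity o alt start = inj₁ (refl , refl)
    trail-parity o alt (step tr r) with trail-parity o alt tr
    ... | inj₁ (refl , q) = inj₂ (refl , trans (¬-not (alt r ∘ sym)) (cong not q))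
    ... | inj₂ (refl , q) = inj₁ (not-involutive b₀ , trans (¬-not (alt r ∘ sym)) (trans (cong not q) (not-involutive (o p))))

    -- Two ends of one component with the same missing matching are joined by an odd path.
    separated : (C : Closed) (o : X → Bool) → (∀ {b x y} → R b x y ≡ true → o x ≢ o y) →
      ∀ {q} → q ≢ p → Miss b₀ q → o q ≡ o p → Closed.S C q ≡ false
    separated C o alt {q} q≢p q-miss oq≡op with Closed.S C q in eq
    ... | false = refl
    ... | true with Closed.ends C eq q-miss
    ...   | inj₁ q≡p = ⊥-elim (q≢p q≡p)
    ...   | inj₂ refl = ⊥-elim (contra (Closed.trail C))
      where
      contra : ∀ {b} → Trail b q → ⊥
      contra start = q≢p refl
      contra tr@(step _ r) with trail-parity o alt tr
      ... | inj₁ (b≡ , _) = q-miss (subst (λ b → R b q _ ≡ true) b≡ (R-sym r))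
      ... | inj₂ (_ , o≡) = not-¬ refl (trans (sym oq≡op) o≡)

-- Induction on sets of edges

module EdgeSets (G : FinSimpleGraph) where

  EdgeSet : Set
  EdgeSet = G ⇉ Bool

  record Sub (E : EdgeSet) : Set where
    field
      E-sym : ∀ {u v} → E u v ≡ true → E v u ≡ true
      E⊆    : ∀ {u v} → E u v ≡ true → G ⊢ u ~ v

  module Add (u v : V G) where

    joins? : ∀ x y → Dec ((x ≡ u × y ≡ v) ⊎ (x ≡ v × y ≡ u))
    joins? x y = ((x Fin.≟ u) ×-dec (y Fin.≟ v)) ⊎-dec ((x Fin.≟ v) ×-dec (y Fin.≟ u))

    add : EdgeSet → EdgeSet
    add E x y = isYes (joins? x y) ∨ E x y

    add-cases : ∀ E {x y} → add E x y ≡ true → ((x ≡ u × y ≡ v) ⊎ (x ≡ v × y ≡ u)) ⊎ E x y ≡ true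
    add-cases E {x} {y} p with joins? x y
    ... | yes q = inj₁ q
    ... | no _ = inj₂ p

    add-old : ∀ E {x y} → E x y ≡ true → add E x y ≡ true
    add-old E {x} {y} p with joins? x y
    ... | yes _ = refl
    ... | no _ = p

    add-new : ∀ E → add E u v ≡ true
    add-new E with joins? u v
    ... | yes _ = refl
    ... | no ne = ⊥-elim (ne (inj₁ (refl , refl)))

    add-new′ : ∀ E → add E v u ≡ true
    add-new′ E with joins? v u
    ... | yes _ = refl
    ... | no ne = ⊥-elim (ne (inj₂ (refl , refl)))

    add-elim : ∀ {E} (Q : V G → V G → Set) → (Q u v → Q v u) → Q u v → (∀ {x y} → E x y ≡ true → Q x y) →
      ∀ {x y} → add E x y ≡ true → Q x y
    add-elim {E} Q Q-sym new old {x} {y} p with add-cases E {x} {y} p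
    ... | inj₁ (inj₁ (refl , refl)) = new
    ... | inj₁ (inj₂ (refl , refl)) = Q-sym new
    ... | inj₂ q = old q

    add-Sub : ∀ {E} → G ⊢ u ~ v → Sub E → Sub (add E)
    add-Sub {E} e sub = record
      { E-sym = add-elim (λ x y → add E y x ≡ true) (λ _ → add-new E) (add-new′ E) (add-old E ∘ Sub.E-sym sub)
      ; E⊆ = add-elim (G ⊢_~_) (adj-flip G) e (Sub.E⊆ sub)
      }

  open Add public using (add; add-cases; add-elim)

  -- All ordered pairs are listed, so each edge occurs twice; `add` inserts both orientations at
  -- once, and the other occurrence is skipped.
  edge-induction : (P : EdgeSet → Set) → P (λ _ _ → false) →
    (∀ {E} → Sub E → ∀ u v → G ⊢ u ~ v → E u v ≡ false → P E → P (add u v E)) →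
    Σ EdgeSet λ E → P E × Sub E × (∀ {u v} → G ⊢ u ~ v → E u v ≡ true)
  edge-induction P base ind with go (cartesianProduct (allFin (N G)) (allFin (N G)))
    where
    go : (ps : List (V G × V G)) →
      Σ EdgeSet λ E → P E × Sub E × (∀ {u v} → (u , v) ∈ ps → G ⊢ u ~ v → E u v ≡ true)
    go [] = (λ _ _ → false) , base , record { E-sym = λ () ; E⊆ = λ () } , λ ()
    go ((u , v) ∷ ps) with go ps
    ... | E , pE , sub , covers with adj G u v in e | E u v in f
    ...   | false | _ = E , pE , sub , λ { (here refl) e′ → ⊥-elim (true≢false e′ e) ; (there i) → covers i }
    ...   | true | true = E , pE , sub , λ { (here refl) _ → f ; (there i) → covers i }
    ...   | true | false = add u v E , ind sub u v e f pE , Add.add-Sub u v e sub ,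
            λ { (here refl) _ → Add.add-new u v E ; (there i) e′ → Add.add-old u v E (covers i e′) }
  ... | E , pE , sub , covers = E , pE , sub , covers (Mem.∈-cartesianProduct⁺ (Mem.∈-allFin _) (Mem.∈-allFin _))

-- Labelling half-edges

isYes-true : ∀ {A : Set} (d : Dec A) → isYes d ≡ true → A
isYes-true (yes a) _ = a

true-isYes : ∀ {A : Set} (d : Dec A) → A → isYes d ≡ true
true-isYes (yes _) _ = refl
true-isYes (no ¬a) a = ⊥-elim (¬a a)

module Swap {Δ : ℕ} (a b : Fin Δ) where

  swap : Fin Δ → Fin Δ
  swap x with x Fin.≟ a | x Fin.≟ b
  ... | yes _ | _ = b
  ... | no _ | yes _ = a
  ... | no _ | no _ = x

  swap-a : swap a ≡ b
  swap-a with a Fin.≟ a | a Fin.≟ b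
  ... | yes _ | _ = refl
  ... | no ne | _ = ⊥-elim (ne refl)

  swap-b : swap b ≡ a
  swap-b with b Fin.≟ a | b Fin.≟ b
  ... | yes q | _ = q
  ... | no _ | yes _ = refl
  ... | no _ | no ne = ⊥-elim (ne refl)

  swap-other : ∀ {x} → x ≢ a → x ≢ b → swap x ≡ x
  swap-other {x} x≢a x≢b with x Fin.≟ a | x Fin.≟ b
  ... | yes q | _ = ⊥-elim (x≢a q)
  ... | no _ | yes q = ⊥-elim (x≢b q)
  ... | no _ | no _ = refl

  swap-involutive : ∀ x → swap (swap x) ≡ x
  swap-involutive x with x Fin.≟ a | x Fin.≟ b
  ... | yes q | _ = trans swap-b (sym q)
  ... | no _ | yes q = trans swap-a (sym q)
  ... | no p | no q = swap-other p q

  swap-injective : ∀ {x y} → swap x ≡ swap y → x ≡ y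
  swap-injective {x} {y} p = trans (sym (swap-involutive x)) (trans (cong swap p) (swap-involutive y))

  OneOf : Fin Δ → Set
  OneOf x = x ≡ a ⊎ x ≡ b

  oneOf? : ∀ x → Dec (OneOf x)
  oneOf? x = (x Fin.≟ a) ⊎-dec (x Fin.≟ b)

  swap-outside : ∀ {x} → ¬ OneOf x → swap x ≡ x
  swap-outside p = swap-other (p ∘ inj₁) (p ∘ inj₂)

  swap-OneOf : ∀ {x} → OneOf x → OneOf (swap x)
  swap-OneOf (inj₁ refl) = inj₂ swap-a
  swap-OneOf (inj₂ refl) = inj₁ swap-b

  other-unique : ∀ {x y z} → OneOf x → OneOf y → OneOf z → x ≢ y → x ≢ z → y ≡ z
  other-unique (inj₁ refl) (inj₁ refl) _ x≢y _ = ⊥-elim (x≢y refl)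
  other-unique (inj₁ refl) (inj₂ refl) (inj₁ refl) _ x≢z = ⊥-elim (x≢z refl)
  other-unique (inj₁ refl) (inj₂ refl) (inj₂ refl) _ _ = refl
  other-unique (inj₂ refl) (inj₂ refl) _ x≢y _ = ⊥-elim (x≢y refl)
  other-unique (inj₂ refl) (inj₁ refl) (inj₂ refl) _ x≢z = ⊥-elim (x≢z refl)
  other-unique (inj₂ refl) (inj₁ refl) (inj₁ refl) _ _ = refl

  side : Fin Δ → Bool
  side x = isYes (x Fin.≟ a)

  side-≢ : ∀ {x y} → OneOf x → OneOf y → x ≢ y → side x ≢ side y
  side-≢ {x} {y} p q x≢y with x Fin.≟ a | y Fin.≟ a
  ... | yes r | yes s = ⊥-elim (x≢y (trans r (sym s)))
  ... | yes _ | no _ = λ ()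
  ... | no _ | yes _ = λ ()
  side-≢ (inj₁ p) _ _ | no r | no _ = ⊥-elim (r p)
  side-≢ (inj₂ p) (inj₁ q) _ | no _ | no s = ⊥-elim (s q)
  side-≢ (inj₂ p) (inj₂ q) x≢y | no _ | no _ = ⊥-elim (x≢y (trans p (sym q)))

-- The components of the two matchings are the a-b-chains of the graph obtained by subdividing each edge of G once,
-- which is bipartite.
module HalfEdges (G : FinSimpleGraph) {E} (sub : EdgeSets.Sub G E) {Δ} (c : G ⇉ Fin Δ)
                 (c-inj : Injective-at G c) (a b : Fin Δ) where
  open EdgeSets.Sub sub
  open Swap a b public

  HalfEdge : Set
  HalfEdge = V G × V G

  _≟ₕ_ : ∀ (x y : HalfEdge) → Dec (x ≡ y)
  (x , y) ≟ₕ (z , w) with x Fin.≟ z | y Fin.≟ w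
  ... | yes refl | yes refl = yes refl
  ... | no ne | _ = no (ne ∘ cong proj₁)
  ... | yes _ | no ne = no (ne ∘ cong proj₂)

  halfEdges : List HalfEdge
  halfEdges = cartesianProduct (allFin (N G)) (allFin (N G))

  halfEdges-complete : ∀ x → x ∈ halfEdges
  halfEdges-complete (x , y) = Mem.∈-cartesianProduct⁺ (Mem.∈-allFin x) (Mem.∈-allFin y)

  Mate : Bool → HalfEdge → HalfEdge → Set
  Mate false (x , y) (z , w) = z ≡ y × w ≡ x × E x y ≡ true × OneOf (c x y) × OneOf (c y x)
  Mate true  (x , y) (z , w) = z ≡ x × G ⊢ x ~ y × G ⊢ x ~ w × OneOf (c x y) × OneOf (c x w) × c x y ≢ c x w

  abstract
    mate? : ∀ k s t → Dec (Mate k s t)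
    mate? false (x , y) (z , w) =
      (z Fin.≟ y) ×-dec (w Fin.≟ x) ×-dec (E x y Bool.≟ true) ×-dec oneOf? (c x y) ×-dec oneOf? (c y x)
    mate? true (x , y) (z , w) =
      (z Fin.≟ x) ×-dec (adj G x y Bool.≟ true) ×-dec (adj G x w Bool.≟ true) ×-dec oneOf? (c x y) ×-dec oneOf? (c x w)
        ×-dec ¬? (c x y Fin.≟ c x w)

  R : Bool → HalfEdge → HalfEdge → Bool
  R k s t = isYes (mate? k s t)

  Mate-R : ∀ {k s t} → Mate k s t → R k s t ≡ true
  Mate-R {k} {s} {t} = true-isYes (mate? k s t)

  R-Mate : ∀ {k s t} → R k s t ≡ true → Mate k s t
  R-Mate {k} {s} {t} = isYes-true (mate? k s t)

  Mate-sym : ∀ k {s t} → Mate k s t → Mate k t s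
  Mate-sym false (refl , refl , e , p , q) = refl , refl , E-sym e , q , p
  Mate-sym true (refl , e , e′ , p , q , ne) = refl , e′ , e , q , p , ne ∘ sym

  Mate-fun : ∀ k {s t t′} → Mate k s t → Mate k s t′ → t ≡ t′
  Mate-fun false (refl , refl , _) (refl , refl , _) = refl
  Mate-fun true (refl , _ , e , p , q , ne) (refl , _ , e′ , _ , q′ , ne′) =
    cong (_ ,_) (c-inj e e′ (other-unique p q q′ ne ne′))

  R-sym : ∀ {k s t} → R k s t ≡ true → R k t s ≡ true
  R-sym {k} {s} {t} r = Mate-R (Mate-sym k (R-Mate {k} {s} {t} r))

  R-fun : ∀ {k s t t′} → R k s t ≡ true → R k s t′ ≡ true → t ≡ t′
  R-fun {k} {s} {t} {t′} r r′ = Mate-fun k (R-Mate {k} {s} {t} r) (R-Mate {k} {s} {t′} r′)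

  open Component _≟ₕ_ halfEdges halfEdges-complete R R-sym R-fun public

  o : HalfEdge → Bool
  o (x , y) = side (c x y)

  o-alternates : (∀ {x y} → E x y ≡ true → c x y ≢ c y x) → ∀ {k s t} → R k s t ≡ true → o s ≢ o t
  o-alternates opp {false} {s} {t} r with R-Mate {false} {s} {t} r
  ... | refl , refl , e , p , q = side-≢ p q (opp e)
  o-alternates opp {true} {s} {t} r with R-Mate {true} {s} {t} r
  ... | refl , _ , _ , p , q , ne = side-≢ p q ne

  miss-unjoined : ∀ {x y} → E x y ≡ false → Miss false (x , y)
  miss-unjoined {x} {y} f {t} r = true≢false (proj₁ (proj₂ (proj₂ (R-Mate {false} {x , y} {t} r)))) f

module König (G : FinSimpleGraph) {Δ} (2≤Δ : 2 ≤ Δ) (c₀ : G ⇉ Fin Δ) (c₀-inj : Injective-at G c₀) where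
  open EdgeSets G

  Opposed : EdgeSet → Set
  Opposed E = Σ (G ⇉ Fin Δ) λ c → Injective-at G c × (∀ {x y} → E x y ≡ true → c x y ≢ c y x)

  module Flip {E} (sub : Sub E) (c : G ⇉ Fin Δ) (c-inj : Injective-at G c)
      (opp : ∀ {x y} → E x y ≡ true → c x y ≢ c y x) (u v : V G) (uv : G ⊢ u ~ v) (uv∉E : E u v ≡ false)
      (clash : c u v ≡ c v u) (b : Fin Δ) (b≢ : b ≢ c u v) where
    open Sub sub
    open HalfEdges G sub c c-inj (c u v) b
    open From (u , v) false (miss-unjoined uv∉E)
    open Closed component

    -- Both halves of `uv` carry the label `a` and lack a partner in the matching `false`. A chain
    -- joining them would have odd length, while `side` alternates along chains and agrees at these
    -- two ends.
    vu∉S : S (v , u) ≡ false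
    vu∉S = separated component o (o-alternates opp) (λ q → adj-≢ G uv (sym (cong proj₁ q)))
      (miss-unjoined (¬-not (λ q → true≢false (E-sym q) uv∉E)))
      (cong side (sym clash))

    c′ : G ⇉ Fin Δ
    c′ x y = if S (x , y) then swap (c x y) else c x y

    swap≡ : ∀ {x y z w} → S (x , y) ≡ true → S (z , w) ≡ false → swap (c x y) ≡ c z w →
      c x y ≡ c z w ⊎ (OneOf (c x y) × OneOf (c z w))
    swap≡ {x} {y} {z} {w} _ _ eq with oneOf? (c x y)
    ... | no p = inj₁ (trans (sym (swap-outside p)) eq)
    ... | yes p = inj₂ (p , subst OneOf eq (swap-OneOf p))

    across : ∀ {x y y′} → G ⊢ x ~ y → G ⊢ x ~ y′ → S (x , y) ≡ true → S (x , y′) ≡ false →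
      swap (c x y) ≡ c x y′ → y ≡ y′
    across {x} {y} {y′} e e′ p q eq with swap≡ p q eq
    ... | inj₁ r = c-inj e e′ r
    ... | inj₂ (s , t) with c x y Fin.≟ c x y′
    ...   | yes r = c-inj e e′ r
    ...   | no ne = ⊥-elim (true≢false (closed {true} {x , y} {x , y′} (Mate-R {true} {x , y} {x , y′} (refl , e , e′ , s , t , ne)) p) q)

    c′-inj : Injective-at G c′
    c′-inj {x} {y} {y′} e e′ eq with S (x , y) in p | S (x , y′) in q
    ... | true | true = c-inj e e′ (swap-injective eq)
    ... | false | false = c-inj e e′ eq
    ... | true | false = across e e′ p q eq
    ... | false | true = sym (across e′ e q p (sym eq))

    facing : ∀ {x y} → E x y ≡ true → S (x , y) ≡ true → S (y , x) ≡ false → swap (c x y) ≢ c y x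
    facing {x} {y} e p q eq with swap≡ p q eq
    ... | inj₁ r = opp e r
    ... | inj₂ (s , t) = true≢false (closed {false} {x , y} {y , x} (Mate-R {false} {x , y} {y , x} (refl , refl , e , s , t)) p) q

    c′-opp : ∀ {x y} → E x y ≡ true → c′ x y ≢ c′ y x
    c′-opp {x} {y} e eq with S (x , y) in p | S (y , x) in q
    ... | true | true = opp e (swap-injective eq)
    ... | false | false = opp e eq
    ... | true | false = facing e p q eq
    ... | false | true = facing (E-sym e) q p (sym eq)

    c′-new : c′ u v ≢ c′ v u
    c′-new eq rewrite p∈S | vu∉S = b≢ (trans (sym swap-a) (trans eq (sym clash)))

    flipped : Opposed (add u v E)
    flipped = c′ , c′-inj , add-elim u v (λ x y → c′ x y ≢ c′ y x) (_∘ sym) c′-new c′-opp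

  extend : ∀ {E} → Sub E → ∀ u v → G ⊢ u ~ v → E u v ≡ false → Opposed E → Opposed (add u v E)
  extend {E} sub u v uv uv∉E (c , c-inj , opp) with c u v Fin.≟ c v u
  ... | no ne = c , c-inj , add-elim u v (λ x y → c x y ≢ c y x) (_∘ sym) ne opp
  ... | yes clash with fresh (c u v ∷ []) 2≤Δ
  ...   | b , b-fresh = Flip.flipped sub c c-inj opp u v uv uv∉E clash b (b-fresh zero)

  opposed : Σ (G ⇉ Fin Δ) λ c → Injective-at G c × (∀ {x y} → G ⊢ x ~ y → c x y ≢ c y x)
  opposed with edge-induction Opposed (c₀ , c₀-inj , λ ()) extend
  ... | _ , (c , c-inj , opp) , _ , covers = c , c-inj , opp ∘ covers

abstract
  three : ∀ (a b d x : Fin 3) → a ≢ b → d ≢ a → d ≢ b → x ≢ a → x ≢ b → x ≡ d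
  three = toWitness {a? = Fin.all? λ a → Fin.all? λ b → Fin.all? λ d → Fin.all? λ x →
    ¬? (a Fin.≟ b) →-dec ¬? (d Fin.≟ a) →-dec ¬? (d Fin.≟ b) →-dec ¬? (x Fin.≟ a) →-dec ¬? (x Fin.≟ b) →-dec (x Fin.≟ d)} tt

xor-≢ : ∀ p {b c} → b ≢ c → p xor b ≢ p xor c
xor-≢ true ne eq = ne (not-injective eq)
xor-≢ false ne = ne

-- In a graph of maximum degree three, the edges with end labels a ≠ b form paths and cycles.  A bit per vertex that
-- alternates along them exists unless there are odd cycles, and every cycle can be broken by exchanging two labels at one
-- of its vertices.
module Thirds (G : FinSimpleGraph) where
  open EdgeSets G

  Labels Bits : Set
  Labels = G ⇉ Fin 3
  Bits = V G → Fin 3 → Bool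

  Opposed : Labels → Set
  Opposed c = ∀ {x y} → G ⊢ x ~ y → c x y ≢ c y x

  Good : Labels → Bits → V G → V G → Set
  Good c o x y = ∀ d → d ≢ c x y → d ≢ c y x → o x d ≢ o y d

  Good-sym : ∀ {c o x y} → Good c o x y → Good c o y x
  Good-sym g d p q = g d q p ∘ sym

  Good-add : ∀ {E c o} u v → Good c o u v → (∀ {x y} → E x y ≡ true → Good c o x y) → ∀ {x y} → add u v E x y ≡ true → Good c o x y
  Good-add {E} {c} {o} u v = add-elim u v (Good c o) (Good-sym {c} {o})

  Alternating : EdgeSet → Set
  Alternating E = Σ Labels λ c → Σ Bits λ o → Injective-at G c × Opposed c × (∀ {x y} → E x y ≡ true → Good c o x y)

  -- The assumption `free` makes it possible to exchange `a` and `d` at `u`: the arm of `u` that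
  -- then receives `a` must not have `a` at its other end.
  module Untangle {E} (sub : Sub E) (c : Labels) (o : Bits) (c-inj : Injective-at G c) (opp : Opposed c)
      (good : ∀ {x y} → E x y ≡ true → Good c o x y)
      (u v : V G) (uv : G ⊢ u ~ v) (uv∉E : E u v ≡ false)
      (d : Fin 3) (d≢a : d ≢ c u v) (d≢b : d ≢ c v u) (clash : o u d ≡ o v d)
      (free : ∀ {z} → G ⊢ u ~ z → c u z ≡ d → c z u ≢ c u v) where
    open Sub sub

    a b : Fin 3
    a = c u v
    b = c v u

    a≢b : a ≢ b
    a≢b = opp uv

    open HalfEdges G sub c c-inj a b hiding (o)
    open From (u , v) false (miss-unjoined uv∉E)
    open Closed component

    u≢v : u ≢ v
    u≢v = adj-≢ G uv

    not-d : ∀ {x} → x ≢ d → OneOf x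
    not-d {x} x≢d with x Fin.≟ a | x Fin.≟ b
    ... | yes p | _ = inj₁ p
    ... | no _ | yes p = inj₂ p
    ... | no p | no q = ⊥-elim (x≢d (three a b d x a≢b d≢a d≢b p q))

    touched? : ∀ x → Dec (Σ (V G) λ y → G ⊢ x ~ y × OneOf (c x y) × S (x , y) ≡ true)
    touched? x = Fin.any? λ y → (adj G x y Bool.≟ true) ×-dec oneOf? (c x y) ×-dec (S (x , y) Bool.≟ true)

    SV : V G → Bool
    SV x = isYes (touched? x)

    -- The half-edges labelled `a` and `b` at a vertex are partners, so they lie on the chain
    -- together and the chain is determined by its vertices.
    SV-S : ∀ {x y} → G ⊢ x ~ y → OneOf (c x y) → SV x ≡ S (x , y)
    SV-S {x} {y} e p with touched? x
    ... | no none with S (x , y) in eq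
    ...   | true = ⊥-elim (none (y , e , p , eq))
    ...   | false = refl
    SV-S {x} {y} e p | yes (y′ , e′ , p′ , q) with c x y′ Fin.≟ c x y
    ... | yes r with c-inj e′ e r
    ...   | refl = sym q
    SV-S {x} {y} e p | yes (y′ , e′ , p′ , q) | no ne =
      sym (closed {true} {x , y′} {x , y} (Mate-R {true} {x , y′} {x , y} (refl , e′ , e , p′ , p , ne)) q)

    S-mate : ∀ {x y} → E x y ≡ true → OneOf (c x y) → OneOf (c y x) → S (x , y) ≡ true → S (y , x) ≡ true
    S-mate {x} {y} e p q = closed {false} {x , y} {y , x} (Mate-R {false} {x , y} {y , x} (refl , refl , e , p , q))

    SV-E : ∀ {x y} → E x y ≡ true → OneOf (c x y) → OneOf (c y x) → SV x ≡ SV y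
    SV-E {x} {y} e p q = trans (SV-S (E⊆ e) p) (trans both (sym (SV-S (E⊆ (E-sym e)) q)))
      where
      both : S (x , y) ≡ S (y , x)
      both with S (x , y) in r | S (y , x) in s
      ... | true | true = refl
      ... | false | false = refl
      ... | true | false = ⊥-elim (true≢false (S-mate e p q r) s)
      ... | false | true = ⊥-elim (true≢false (S-mate (E-sym e) q p s) r)

    SV-u : SV u ≡ true
    SV-u = trans (SV-S uv (inj₁ refl)) p∈S

    module Apart (vu∉S : S (v , u) ≡ false) where

      -- `u` is on the chain and `v` is not, so inverting the bits of class `d` along the chain
      -- separates them; an edge of `E` with labels `a` and `b` has both ends on the chain or
      -- neither.
      o′ : Bits
      o′ x e with e Fin.≟ d
      ... | yes _ = SV x xor o x e
      ... | no _ = o x e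

      good′ : ∀ {x y} → E x y ≡ true → Good c o′ x y
      good′ {x} {y} e f p q eq with f Fin.≟ d
      ... | no _ = good e f p q eq
      ... | yes refl = xor-≢ (SV x) (good e d p q)
        (trans eq (cong (_xor o y d) (sym (SV-E e (not-d (p ∘ sym)) (not-d (q ∘ sym))))))

      good-new : Good c o′ u v
      good-new f p q eq with f Fin.≟ d
      ... | no ne = ne (three a b d f a≢b d≢a d≢b p q)
      ... | yes refl rewrite SV-u | trans (SV-S (adj-flip G uv) (inj₂ refl)) vu∉S = not-¬ refl (trans clash (sym eq))

      result : Alternating (add u v E)
      result = c , o′ , c-inj , opp , Good-add {E} {c} {o′} u v good-new good′

    module Cycle (vu∈S : S (v , u) ≡ true) where

      open Swap a d using () renaming (swap to swap-ad; swap-a to swap-ad-a; swap-b to swap-ad-d;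
        swap-other to swap-ad-other; swap-injective to swap-ad-injective)

      only-ends : ∀ {x y} → S (x , y) ≡ true → Miss false (x , y) → (x ≡ u × y ≡ v) ⊎ (x ≡ v × y ≡ u)
      only-ends s m with ends {false} {v , u} vu∈S (miss-unjoined (¬-not (λ q → true≢false (E-sym q) uv∉E)))
      ... | inj₁ p = ⊥-elim (u≢v (sym (cong proj₁ p)))
      ... | inj₂ p with ends s m
      ...   | inj₁ q = inj₁ (cong proj₁ q , cong proj₂ q)
      ...   | inj₂ q = inj₂ (cong proj₁ (trans q (sym p)) , cong proj₂ (trans q (sym p)))

      agree? : Dec (Σ (V G) λ z → G ⊢ u ~ z × c u z ≡ d × o z d ≡ o u d)
      agree? = Fin.any? λ z → (adj G u z Bool.≟ true) ×-dec (c u z Fin.≟ d) ×-dec (o z d Bool.≟ o u d)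

      -- After the exchange the arm of `u` with old label `d` has end labels `a` and `b`, so it
      -- continues the broken cycle to a vertex off the chain. `φ` decides whether the bits of the
      -- chain must be inverted to fit the bit of that vertex.
      φ : Bool
      φ = isYes agree?

      c′ : Labels
      c′ x y with x Fin.≟ u
      ... | yes _ = swap-ad (c x y)
      ... | no _ = c x y

      c′-u : ∀ y → c′ u y ≡ swap-ad (c u y)
      c′-u y with u Fin.≟ u
      ... | yes _ = refl
      ... | no ne = ⊥-elim (ne refl)

      c′-other : ∀ {x} y → x ≢ u → c′ x y ≡ c x y
      c′-other {x} y x≢u with x Fin.≟ u
      ... | yes p = ⊥-elim (x≢u p)
      ... | no _ = refl

      o′ : Bits
      o′ x e with e Fin.≟ d | x Fin.≟ u | e Fin.≟ a
      ... | yes _ | _ | _ = (SV x ∧ φ) xor o x e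
      -- After the exchange `uv` is the only edge at `u` whose third label is `a`, so this bit can
      -- be set to suit `v`.
      ... | no _ | yes _ | yes _ = not (o v a)
      ... | no _ | _ | _ = o x e

      o′-d : ∀ x → o′ x d ≡ (SV x ∧ φ) xor o x d
      o′-d x with d Fin.≟ d | x Fin.≟ u | d Fin.≟ a
      ... | yes _ | _ | _ = refl
      ... | no ne | _ | _ = ⊥-elim (ne refl)

      o′-a : o′ u a ≡ not (o v a)
      o′-a with a Fin.≟ d | u Fin.≟ u | a Fin.≟ a
      ... | yes p | _ | _ = ⊥-elim (d≢a (sym p))
      ... | no _ | yes _ | yes _ = refl
      ... | no _ | no ne | _ = ⊥-elim (ne refl)
      ... | no _ | yes _ | no ne = ⊥-elim (ne refl)

      o′-other : ∀ {x e} → x ≢ u → e ≢ d → o′ x e ≡ o x e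
      o′-other {x} {e} x≢u e≢d with e Fin.≟ d | x Fin.≟ u | e Fin.≟ a
      ... | yes p | _ | _ = ⊥-elim (e≢d p)
      ... | no _ | yes p | _ = ⊥-elim (x≢u p)
      ... | no _ | no _ | _ = refl

      beyond : ∀ {z} → G ⊢ u ~ z → c u z ≡ d → c z u ≡ b
      beyond {z} e q with c z u Fin.≟ b
      ... | yes p = p
      ... | no p = ⊥-elim (opp e (trans q (sym (three a b d _ a≢b d≢a d≢b (free e q) p))))

      -- The chain has no ends besides the two halves of `uv`. The half-edge labelled `b` at `u`
      -- lies on it and so continues across its edge, which must then be in `E` and have label `a`
      -- at its other end.
      before : ∀ {w} → G ⊢ u ~ w → c u w ≡ b → E u w ≡ true × c w u ≡ a × S (w , u) ≡ true
      before {w} e q with mate? false (u , w) (w , u)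
      ... | yes (_ , _ , uw∈E , p , r) = uw∈E , a-label r , S-mate uw∈E p r uw∈S
        where
        uw∈S = closed {true} {u , v} {u , w} (Mate-R {true} {u , v} {u , w}
          (refl , uv , e , inj₁ refl , inj₂ q , λ s → a≢b (trans s q))) p∈S
        a-label : OneOf (c w u) → c w u ≡ a
        a-label (inj₁ p) = p
        a-label (inj₂ p) = ⊥-elim (opp e (trans q (sym p)))
      ... | no unmated with only-ends
            (closed {true} {u , v} {u , w} (Mate-R {true} {u , v} {u , w}
              (refl , uv , e , inj₁ refl , inj₂ q , λ s → a≢b (trans s q))) p∈S)
            (λ {t} r → unmated (mated t (R-Mate {false} {u , w} {t} r)))
        where
        mated : ∀ t → Mate false (u , w) t → Mate false (u , w) (w , u)
        mated (.w , .u) (refl , refl , r) = refl , refl , r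
      ...   | inj₁ (_ , refl) = ⊥-elim (a≢b q)
      ...   | inj₂ (p , _) = ⊥-elim (u≢v p)

      c′-inj : Injective-at G c′
      c′-inj {x} e e′ eq with x Fin.≟ u
      ... | yes _ = c-inj e e′ (swap-ad-injective eq)
      ... | no _ = c-inj e e′ eq

      data Arm (y : V G) : Set where
        along : y ≡ v → Arm y
        out   : c u y ≡ d → c′ u y ≡ a → c y u ≡ b → Arm y
        back  : c u y ≡ b → c′ u y ≡ b → E u y ≡ true → c y u ≡ a → S (y , u) ≡ true → Arm y

      arm : ∀ {y} → G ⊢ u ~ y → Arm y
      arm {y} e with c u y Fin.≟ a | c u y Fin.≟ d
      ... | yes p | _ = along (c-inj e uv p)
      ... | no _ | yes q = out q (trans (c′-u y) (trans (cong swap-ad q) swap-ad-d)) (beyond e q)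
      ... | no p | no q with not-d q
      ...   | inj₁ r = ⊥-elim (p r)
      ...   | inj₂ r with before e r
      ...     | s , t , w = back r (trans (c′-u y) (trans (swap-ad-other p q) r)) s t w

      c′-uv : c′ u v ≡ d
      c′-uv = trans (c′-u v) swap-ad-a

      opp-u : ∀ {y} → G ⊢ u ~ y → c′ u y ≢ c y u
      opp-u {y} e eq with arm e
      ... | along refl = d≢b (trans (sym c′-uv) eq)
      ... | out _ q r = a≢b (trans (sym q) (trans eq r))
      ... | back _ q _ r _ = a≢b (sym (trans (sym q) (trans eq r)))

      opp′ : Opposed c′
      opp′ {x} {y} e eq with x Fin.≟ u
      ... | yes refl = opp-u e (trans (c′-u y) (trans eq (c′-other u (adj-≢ G e ∘ sym))))
      ... | no x≢u with y Fin.≟ u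
      ...   | yes refl = opp-u (adj-flip G e) (trans (c′-u x) (sym eq))
      ...   | no _ = opp e eq

      good-u : ∀ {y} → G ⊢ u ~ y → E u y ≡ true ⊎ y ≡ v → Good c′ o′ u y
      good-u {y} e m f p q eq with arm e
      ... | along refl = not-¬ refl (trans (sym (o′-other (u≢v ∘ sym) f≢d))
              (trans (sym eq) (trans (cong (o′ u) f≡a) (trans o′-a (cong (not ∘ o v) (sym f≡a))))))
        where
        f≢d : f ≢ d
        f≢d r = p (trans r (sym c′-uv))
        f≢b : f ≢ b
        f≢b r = q (trans r (sym (c′-other u (u≢v ∘ sym))))
        f≡a : f ≡ a
        f≡a = three d b a f d≢b (d≢a ∘ sym) a≢b f≢d f≢b
      ... | back r r′ uy∈E s t = xor-≢ (SV u ∧ φ) (good uy∈E d (λ w → d≢b (trans w r)) (λ w → d≢a (trans w s)))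
              (trans (sym (trans (cong (o′ u) f≡d) (o′-d u)))
                (trans eq (trans (trans (cong (o′ y) f≡d) (o′-d y)) (cong (λ s → (s ∧ φ) xor o y d) (trans SV-y (sym SV-u))))))
        where
        y≢u : y ≢ u
        y≢u = adj-≢ G e ∘ sym
        f≡d : f ≡ d
        f≡d = three a b d f a≢b d≢a d≢b (λ w → q (trans w (trans (sym s) (sym (c′-other u y≢u))))) (λ w → p (trans w (sym r′)))
        SV-y : SV y ≡ true
        SV-y = trans (SV-S (adj-flip G e) (inj₁ s)) t
      ... | out r r′ s = differ (trans (sym (trans (cong (o′ u) f≡d) (trans (o′-d u) (cong (λ s → (s ∧ φ) xor o u d) SV-u))))
              (trans eq (trans (cong (o′ y) f≡d) (trans (o′-d y) (cong (λ s → (s ∧ φ) xor o y d) SV-y)))))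
        where
        y≢u : y ≢ u
        y≢u = adj-≢ G e ∘ sym
        f≡d : f ≡ d
        f≡d = three a b d f a≢b d≢a d≢b (λ w → p (trans w (sym r′))) (λ w → q (trans w (trans (sym s) (sym (c′-other u y≢u)))))
        -- The label `d` at `u` keeps the half-edge at `y` without a partner across the edge; on the
        -- chain it would be an end, hence a half of `uv`.
        off : S (y , u) ≢ true
        off t with only-ends t (λ {z} w → unmatched z (R-Mate {false} {y , u} {z} w))
          where
          unmatched : ∀ z → ¬ Mate false (y , u) z
          unmatched z (_ , _ , _ , _ , inj₁ w) = d≢a (trans (sym r) w)
          unmatched z (_ , _ , _ , _ , inj₂ w) = d≢b (trans (sym r) w)
        ... | inj₁ (w , _) = y≢u w
        ... | inj₂ (refl , _) = d≢a (sym r)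
        SV-y : SV y ≡ false
        SV-y = trans (SV-S (adj-flip G e) (inj₂ s)) (¬-not off)
        differ : φ xor o u d ≢ o y d
        differ with agree?
        ... | yes (z , e′ , r″ , w) with c-inj e e′ (trans r (sym r″))
        ...   | refl = λ t → not-¬ refl (trans (sym w) (sym t))
        differ | no none = λ t → none (y , e , r , sym t)

      good-other : ∀ {x y} → x ≢ u → y ≢ u → E x y ≡ true → Good c′ o′ x y
      good-other {x} {y} x≢u y≢u e f p q eq = go (f Fin.≟ d)
        where
        p′ : f ≢ c x y
        p′ w = p (trans w (sym (c′-other y x≢u)))
        q′ : f ≢ c y x
        q′ w = q (trans w (sym (c′-other x y≢u)))
        go : Dec (f ≡ d) → ⊥
        go (no f≢d) = good e f p′ q′ (trans (sym (o′-other x≢u f≢d)) (trans eq (o′-other y≢u f≢d)))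
        go (yes refl) = xor-≢ (SV x ∧ φ) (good e d p′ q′)
          (trans (sym (o′-d x)) (trans eq (trans (o′-d y)
            (cong (λ s → (s ∧ φ) xor o y d) (sym (SV-E e (not-d (p′ ∘ sym)) (not-d (q′ ∘ sym))))))))

      good′ : ∀ {x y} → E x y ≡ true → Good c′ o′ x y
      good′ {x} {y} e = go (x Fin.≟ u) (y Fin.≟ u)
        where
        go : Dec (x ≡ u) → Dec (y ≡ u) → Good c′ o′ x y
        go (yes refl) _ = good-u (E⊆ e) (inj₁ e)
        go (no _) (yes refl) = Good-sym {c′} {o′} (good-u (adj-flip G (E⊆ e)) (inj₁ (E-sym e)))
        go (no x≢u) (no y≢u) = good-other x≢u y≢u e

      result : Alternating (add u v E)
      result = c′ , o′ , c′-inj , opp′ , Good-add {E} {c′} {o′} u v (good-u uv (inj₂ refl)) good′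

    untangled : Alternating (add u v E)
    untangled with S (v , u) in eq
    ... | true = Cycle.result eq
    ... | false = Apart.result eq

  third : ∀ (a b : Fin 3) → Σ (Fin 3) λ d → d ≢ a × d ≢ b
  third a b with fresh (a ∷ b ∷ []) ≤-refl
  ... | d , d-fresh = d , d-fresh zero , d-fresh (# 1)

  -- The case where `free` fails for `uv`. Inverting the single bit of `d` at `u` suits `uv` and
  -- spoils at most the arm of `u` with label `b`. That arm is taken out of `E` and put back by
  -- `Untangle`.
  module Extend {E} (sub : Sub E) (c : Labels) (o : Bits) (c-inj : Injective-at G c) (opp : Opposed c)
      (good : ∀ {x y} → E x y ≡ true → Good c o x y)
      (u v : V G) (uv : G ⊢ u ~ v) (uv∉E : E u v ≡ false)
      (d : Fin 3) (d≢a : d ≢ c u v) (d≢b : d ≢ c v u) (clash : o u d ≡ o v d)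
      (z : V G) (uz : G ⊢ u ~ z) (z-d : c u z ≡ d) (z-a : c z u ≡ c u v) where
    open Sub sub

    a b : Fin 3
    a = c u v
    b = c v u

    a≢b : a ≢ b
    a≢b = opp uv

    flip : Bits
    flip x e = isYes ((x Fin.≟ u) ×-dec (e Fin.≟ d)) xor o x e

    flip-here : flip u d ≡ not (o u d)
    flip-here with u Fin.≟ u | d Fin.≟ d
    ... | yes _ | yes _ = refl
    ... | no ne | _ = ⊥-elim (ne refl)
    ... | yes _ | no ne = ⊥-elim (ne refl)

    flip-other : ∀ {x e} → ¬ (x ≡ u × e ≡ d) → flip x e ≡ o x e
    flip-other {x} {e} ne with x Fin.≟ u | e Fin.≟ d
    ... | yes p | yes q = ⊥-elim (ne (p , q))
    ... | no _ | _ = refl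
    ... | yes _ | no _ = refl

    flip-v : ∀ e → flip v e ≡ o v e
    flip-v e = flip-other λ (p , _) → adj-≢ G uv (sym p)

    good-uv : Good c flip u v
    good-uv f p q eq with three a b d f a≢b d≢a d≢b p q
    ... | refl = not-¬ refl (trans clash (trans (sym (flip-v d)) (trans (sym eq) flip-here)))

    -- An edge of E spoilt by flipping the bit of u leads from u along label b to label a.
    Spoilt : V G → Set
    Spoilt w = E u w ≡ true × c u w ≡ b × c w u ≡ a

    good-flip-u : ∀ {y} → E u y ≡ true → ¬ Spoilt y → Good c flip u y
    good-flip-u {y} e unspoilt f p q eq = go (f Fin.≟ d) (c u y Fin.≟ a) (c u y Fin.≟ b) (c y u Fin.≟ a)
      where
      go : Dec (f ≡ d) → Dec (c u y ≡ a) → Dec (c u y ≡ b) → Dec (c y u ≡ a) → ⊥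
      go (no f≢d) _ _ _ = good e f p q (trans (sym (flip-other (f≢d ∘ proj₂)))
        (trans eq (flip-other λ (r , _) → adj-≢ G (E⊆ e) (sym r))))
      go (yes _) (yes r) _ _ = true≢false (subst (λ y → E u y ≡ true) (c-inj (E⊆ e) uv r) e) uv∉E
      go (yes refl) (no ¬a) (no ¬b) _ = p (sym (three a b d (c u y) a≢b d≢a d≢b ¬a ¬b))
      go (yes _) (no _) (yes r) (yes s) = unspoilt (e , r , s)
      go (yes refl) (no _) (yes r) (no s) = q (sym (three a b d (c y u) a≢b d≢a d≢b s (λ t → opp (E⊆ e) (trans r (sym t)))))

    good-flip : ∀ {x y} → E x y ≡ true → ¬ (x ≡ u × Spoilt y) → ¬ (y ≡ u × Spoilt x) → Good c flip x y
    good-flip {x} {y} e p q = go (x Fin.≟ u) (y Fin.≟ u)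
      where
      go : Dec (x ≡ u) → Dec (y ≡ u) → Good c flip x y
      go (yes refl) _ = good-flip-u e (λ s → p (refl , s))
      go (no _) (yes refl) = Good-sym {c} {flip} (good-flip-u (E-sym e) (λ s → q (refl , s)))
      go (no x≢u) (no y≢u) f r s eq = good e f r s
        (trans (sym (flip-other (x≢u ∘ proj₁))) (trans eq (flip-other (y≢u ∘ proj₁))))

    spoilt? : Dec (Σ (V G) Spoilt)
    spoilt? = Fin.any? λ w → (E u w Bool.≟ true) ×-dec (c u w Fin.≟ b) ×-dec (c w u Fin.≟ a)

    module Detour (w : V G) (uw∈E : E u w ≡ true) (w-b : c u w ≡ b) (w-a : c w u ≡ a) where
      module W = Add u w

      remove : EdgeSet
      remove x y = not (isYes (W.joins? x y)) ∧ E x y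

      remove-cases : ∀ {x y} → remove x y ≡ true → ¬ ((x ≡ u × y ≡ w) ⊎ (x ≡ w × y ≡ u)) × E x y ≡ true
      remove-cases {x} {y} p with W.joins? x y
      ... | no ne = ne , p

      remove-intro : ∀ {x y} → ¬ ((x ≡ u × y ≡ w) ⊎ (x ≡ w × y ≡ u)) → E x y ≡ true → remove x y ≡ true
      remove-intro {x} {y} ne p with W.joins? x y
      ... | yes q = ⊥-elim (ne q)
      ... | no _ = p

      remove-Sub : Sub remove
      remove-Sub = record
        { E-sym = λ p → let ne , e = remove-cases p in
            remove-intro (λ { (inj₁ (q , r)) → ne (inj₂ (r , q)) ; (inj₂ (q , r)) → ne (inj₁ (r , q)) }) (E-sym e)
        ; E⊆ = λ p → E⊆ (proj₂ (remove-cases p))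
        }

      E′ : EdgeSet
      E′ = add u v remove

      E′-Sub : Sub E′
      E′-Sub = Add.add-Sub u v uv remove-Sub

      w≢v : w ≢ v
      w≢v refl = true≢false uw∈E uv∉E

      spoilt-w : ∀ {y} → Spoilt y → y ≡ w
      spoilt-w (e , r , _) = c-inj (E⊆ e) (E⊆ uw∈E) (trans r (sym w-b))

      uw∉E′ : E′ u w ≡ false
      uw∉E′ = ¬-not λ p → case add-cases u v remove p of λ where
        (inj₁ (inj₁ (_ , q))) → w≢v q
        (inj₁ (inj₂ (q , _))) → adj-≢ G uv q
        (inj₂ q) → proj₁ (remove-cases q) (inj₁ (refl , refl))

      good′ : ∀ {x y} → E′ x y ≡ true → Good c flip x y
      good′ = Good-add {remove} {c} {flip} u v good-uv λ {x} {y} q → let ne , e = remove-cases {x} {y} q in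
        good-flip e (λ (r , s) → ne (inj₁ (r , spoilt-w s))) (λ (r , s) → ne (inj₂ (spoilt-w s , r)))

      clash′ : flip u d ≡ flip w d
      clash′ = trans flip-here (trans
        (sym (¬-not (good uw∈E d (λ r → d≢b (trans r w-b)) (λ r → d≢a (trans r w-a)) ∘ sym)))
        (sym (flip-other λ (p , _) → adj-≢ G (E⊆ uw∈E) (sym p))))

      result : Alternating (add u v E)
      result with Untangle.untangled E′-Sub c flip c-inj opp good′ u w (E⊆ uw∈E) uw∉E′ d
        (λ r → d≢b (trans r w-b)) (λ r → d≢a (trans r w-a)) clash′
        -- `free` holds for `uw`: its label at `u` is `b`, whereas the arm of `u` labelled `d` ends
        -- in `a`.
        (λ {z′} e r s → a≢b (trans (sym z-a) (trans (cong (λ y → c y u) (c-inj uz e (trans z-d (sym r)))) (trans s w-b))))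
      ... | c″ , o″ , inj″ , opp″ , good″ = c″ , o″ , inj″ , opp″ , λ {x} {y} e → good″ (widen {x} {y} e (W.joins? x y))
        where
        widen : ∀ {x y} → add u v E x y ≡ true → Dec ((x ≡ u × y ≡ w) ⊎ (x ≡ w × y ≡ u)) → add u w E′ x y ≡ true
        widen _ (yes (inj₁ (refl , refl))) = W.add-new E′
        widen _ (yes (inj₂ (refl , refl))) = W.add-new′ E′
        widen {x} {y} e (no ne) with add-cases u v E e
        ... | inj₁ (inj₁ (refl , refl)) = W.add-old E′ {u} {v} (Add.add-new u v remove)
        ... | inj₁ (inj₂ (refl , refl)) = W.add-old E′ {v} {u} (Add.add-new′ u v remove)
        ... | inj₂ f = W.add-old E′ {x} {y} (Add.add-old u v remove {x} {y} (remove-intro ne f))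

    result : Alternating (add u v E)
    result with spoilt?
    ... | yes (w , uw∈E , w-b , w-a) = Detour.result w uw∈E w-b w-a
    ... | no none = c , flip , c-inj , opp ,
      Good-add {E} {c} {flip} u v good-uv (λ f → good-flip f (λ (_ , s) → none (_ , s)) (λ (_ , s) → none (_ , s)))

  extend : ∀ {E} → Sub E → ∀ u v → G ⊢ u ~ v → E u v ≡ false → Alternating E → Alternating (add u v E)
  extend {E} sub u v uv uv∉E (c , o , c-inj , opp , good) with third (c u v) (c v u)
  ... | d , d≢a , d≢b with o u d Bool.≟ o v d
  ...   | no ne = c , o , c-inj , opp , Good-add {E} {c} {o} u v good-uv good
    where
    good-uv : Good c o u v
    good-uv f p q with three (c u v) (c v u) d f (opp uv) d≢a d≢b p q
    ... | refl = ne
  ...   | yes clash with Fin.any? (λ z → (adj G u z Bool.≟ true) ×-dec (c u z Fin.≟ d) ×-dec (c z u Fin.≟ c u v))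
  ...     | yes (z , uz , z-d , z-a) = Extend.result sub c o c-inj opp good u v uv uv∉E d d≢a d≢b clash z uz z-d z-a
  ...     | no none = Untangle.untangled sub c o c-inj opp good u v uv uv∉E d d≢a d≢b clash
              (λ {z} e r s → none (z , e , r , s))

  alternating : (c₀ : Labels) → Injective-at G c₀ → Σ Labels λ c → Σ Bits λ o →
    Injective-at G c × Opposed c × (∀ {x y} → G ⊢ x ~ y → Good c o x y)
  alternating c₀ c₀-inj with König.opposed G (s≤s (s≤s z≤n)) c₀ c₀-inj
  ... | c , c-inj , opp with edge-induction Alternating (c , (λ _ _ → false) , c-inj , opp , λ ()) extend
  ...   | _ , (c′ , o , c′-inj , opp′ , good) , _ , covers = c′ , o , c′-inj , opp′ , good ∘ covers

-- Edge colouring with four colours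

lookup-injective : ∀ {A : Set} {xs : List A} → Unique xs → Injective _≡_ _≡_ (List.lookup xs)
lookup-injective (_ ∷ _) {zero} {zero} _ = refl
lookup-injective (px ∷ _) {zero} {suc j} eq = ⊥-elim (All.lookup px (Mem.∈-lookup j) eq)
lookup-injective (px ∷ _) {suc i} {zero} eq = ⊥-elim (All.lookup px (Mem.∈-lookup i) (sym eq))
lookup-injective (_ ∷ pxs) {suc i} {suc j} eq = cong suc (lookup-injective pxs eq)

pigeonhole-∈ : ∀ {Δ} (xs : List (Fin Δ)) → Unique xs → length xs ≡ Δ → ∀ m → m ∈ xs
pigeonhole-∈ {Δ} xs unique len m with Any.any? (m Fin.≟_) xs
... | yes p = p
... | no m∉xs = ⊥-elim (<⇒≱ (≤-reflexive (cong suc (sym len))) (Fin.injective⇒≤ {f = List.lookup (m ∷ xs)}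
    (lookup-injective (All.¬Any⇒All¬ xs m∉xs ∷ unique))))

last₄ : Fin 4
last₄ = # 3

module Proper₄ (G : FinSimpleGraph) where
  open EdgeSets G

  Colours : Set
  Colours = G ⇉ Fin 4

  record Proper (E : EdgeSet) (κ : Colours) : Set where
    field
      κ-sym : ∀ {x y} → E x y ≡ true → κ x y ≡ κ y x
      κ-inj : ∀ {x y y′} → E x y ≡ true → E x y′ ≡ true → κ x y ≡ κ x y′ → y ≡ y′

  Absent : EdgeSet → Colours → V G → Fin 4 → Set
  Absent E κ x i = ∀ y → E x y ≡ true → κ x y ≢ i

  absent? : ∀ E κ x i → Dec (Absent E κ x i)
  absent? E κ x i = Fin.all? λ y → (E x y Bool.≟ true) →-dec ¬? (κ x y Fin.≟ i)

  present : ∀ {E κ x i} → ¬ Absent E κ x i → Σ (V G) λ y → E x y ≡ true × κ x y ≡ i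
  present {E} {κ} {x} {i} ¬absent with Fin.any? (λ y → (E x y Bool.≟ true) ×-dec (κ x y Fin.≟ i))
  ... | yes p = p
  ... | no none = ⊥-elim (¬absent λ y e q → none (y , e , q))

  Proper-⊆ : ∀ {E E′ κ} → (∀ {x y} → E x y ≡ true → E′ x y ≡ true) → Proper E′ κ → Proper E κ
  Proper-⊆ ⊆ pr = record { κ-sym = κ-sym ∘ ⊆ ; κ-inj = λ e e′ → κ-inj (⊆ e) (⊆ e′) }
    where open Proper pr

  module SetColour (u v : V G) (u≢v : u ≢ v) (i : Fin 4) where
    open Add u v using (joins?)

    set : Colours → Colours
    set κ x y = if isYes (joins? x y) then i else κ x y

    set-new : ∀ κ {x y} → (x ≡ u × y ≡ v) ⊎ (x ≡ v × y ≡ u) → set κ x y ≡ i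
    set-new κ {x} {y} p with joins? x y
    ... | yes _ = refl
    ... | no ne = ⊥-elim (ne p)

    set-old : ∀ κ {x y} → ¬ ((x ≡ u × y ≡ v) ⊎ (x ≡ v × y ≡ u)) → set κ x y ≡ κ x y
    set-old κ {x} {y} p with joins? x y
    ... | yes q = ⊥-elim (p q)
    ... | no _ = refl

    module _ {E κ} (pr : Proper E κ) (free-u : ∀ {y} → y ≢ v → E u y ≡ true → κ u y ≢ i)
             (free-v : ∀ {y} → y ≢ u → E v y ≡ true → κ v y ≢ i) where
      open Proper pr

      old : ∀ {x y} → add u v E x y ≡ true → ¬ ((x ≡ u × y ≡ v) ⊎ (x ≡ v × y ≡ u)) → E x y ≡ true
      old {x} {y} e ne with add-cases u v E {x} {y} e
      ... | inj₁ p = ⊥-elim (ne p)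
      ... | inj₂ p = p

      new-old : ∀ {x y y′} → (x ≡ u × y ≡ v) ⊎ (x ≡ v × y ≡ u) → add u v E x y′ ≡ true →
        ¬ ((x ≡ u × y′ ≡ v) ⊎ (x ≡ v × y′ ≡ u)) → κ x y′ ≢ i
      new-old {x} {y} {y′} (inj₁ (refl , refl)) e ne = free-u (λ q → ne (inj₁ (refl , q))) (old {x} {y′} e ne)
      new-old {x} {y} {y′} (inj₂ (refl , refl)) e ne = free-v (λ q → ne (inj₂ (refl , q))) (old {x} {y′} e ne)

      set-proper : Proper (add u v E) (set κ)
      set-proper = record { κ-sym = λ {x} {y} → sym′ {x} {y} ; κ-inj = λ {x} {y} {y′} → inj′ {x} {y} {y′} }
        where
        sym′ : ∀ {x y} → add u v E x y ≡ true → set κ x y ≡ set κ y x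
        sym′ {x} {y} e with joins? x y
        ... | yes (inj₁ (p , q)) = sym (set-new κ (inj₂ (q , p)))
        ... | yes (inj₂ (p , q)) = sym (set-new κ (inj₁ (q , p)))
        ... | no ne = trans (κ-sym e) (sym (set-old κ
              λ { (inj₁ (p , q)) → ne (inj₂ (q , p)) ; (inj₂ (p , q)) → ne (inj₁ (q , p)) }))
        inj′ : ∀ {x y y′} → add u v E x y ≡ true → add u v E x y′ ≡ true → set κ x y ≡ set κ x y′ → y ≡ y′
        inj′ {x} {y} {y′} e e′ eq = go (joins? x y) (joins? x y′)
          where
          go : Dec ((x ≡ u × y ≡ v) ⊎ (x ≡ v × y ≡ u)) → Dec ((x ≡ u × y′ ≡ v) ⊎ (x ≡ v × y′ ≡ u)) → y ≡ y′
          go (yes (inj₁ (refl , refl))) (yes (inj₁ (_ , refl))) = refl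
          go (yes (inj₂ (refl , refl))) (yes (inj₂ (_ , refl))) = refl
          go (yes (inj₁ (refl , _))) (yes (inj₂ (p , _))) = ⊥-elim (u≢v p)
          go (yes (inj₂ (refl , _))) (yes (inj₁ (p , _))) = ⊥-elim (u≢v (sym p))
          go (yes p) (no q) = ⊥-elim (new-old p e′ q (trans (sym (set-old κ q)) (trans (sym eq) (set-new κ p))))
          go (no q) (yes p) = ⊥-elim (new-old p e q (trans (sym (set-old κ q)) (trans eq (set-new κ p))))
          go (no p) (no q) = κ-inj (old {x} {y} e p) (old {x} {y′} e′ q)
            (trans (sym (set-old κ p)) (trans eq (set-old κ q)))

  module Kempe {E} (sub : Sub E) {κ} (pr : Proper E κ) (α β : Fin 4) where
    open Sub sub
    open Proper pr
    open Swap α β public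

    col : Bool → Fin 4
    col false = α
    col true = β

    abstract
      link? : ∀ k x y → Dec (E x y ≡ true × κ x y ≡ col k)
      link? k x y = (E x y Bool.≟ true) ×-dec (κ x y Fin.≟ col k)

    R : Bool → G ⇉ Bool
    R k x y = isYes (link? k x y)

    Link-R : ∀ k {x y} → E x y ≡ true → κ x y ≡ col k → R k x y ≡ true
    Link-R k {x} {y} e q = true-isYes (link? k x y) (e , q)

    R-Link : ∀ k {x y} → R k x y ≡ true → E x y ≡ true × κ x y ≡ col k
    R-Link k {x} {y} = isYes-true (link? k x y)

    R-sym : ∀ {k x y} → R k x y ≡ true → R k y x ≡ true
    R-sym {k} r with R-Link k r
    ... | e , q = Link-R k (E-sym e) (trans (sym (κ-sym e)) q)

    R-fun : ∀ {k x y z} → R k x y ≡ true → R k x z ≡ true → y ≡ z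
    R-fun {k} r r′ with R-Link k r | R-Link k r′
    ... | e , q | e′ , q′ = κ-inj e e′ (trans q (sym q′))

    open Component Fin._≟_ (allFin (N G)) Mem.∈-allFin R (λ {k} → R-sym {k}) (λ {k} → R-fun {k}) public

    absent-Miss : ∀ k {x} → Absent E κ x (col k) → Miss k x
    absent-Miss k absent {y} r with R-Link k r
    ... | e , q = absent y e q

    module Exchange (S : V G → Bool) (closed : ∀ {k x y} → R k x y ≡ true → S x ≡ true → S y ≡ true) where

      κ′ : Colours
      κ′ x y = if S x then swap (κ x y) else κ x y

      κ′-in : ∀ {x} y → S x ≡ true → κ′ x y ≡ swap (κ x y)
      κ′-in y p rewrite p = refl

      κ′-out : ∀ {x} y → S x ≡ false → κ′ x y ≡ κ x y
      κ′-out y p rewrite p = refl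

      forward : ∀ {x y} → E x y ≡ true → S x ≡ true → S y ≡ false → ¬ OneOf (κ x y)
      forward e p q (inj₁ r) = true≢false (closed {false} (Link-R false e r) p) q
      forward e p q (inj₂ r) = true≢false (closed {true} (Link-R true e r) p) q

      κ′-proper : Proper E κ′
      κ′-proper .Proper.κ-sym {x} {y} e with S x in p | S y in q
      ... | true | true = cong swap (κ-sym e)
      ... | false | false = κ-sym e
      ... | true | false = trans (swap-outside (forward e p q)) (κ-sym e)
      ... | false | true = trans (κ-sym e) (sym (swap-outside (forward (E-sym e) q p)))
      κ′-proper .Proper.κ-inj {x} e e′ eq with S x
      ... | true = κ-inj e e′ (swap-injective eq)
      ... | false = κ-inj e e′ eq

      absent-in : ∀ {x i} → S x ≡ true → Absent E κ x i → Absent E κ′ x (swap i)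
      absent-in {x} p absent y e eq = absent y e (swap-injective (trans (sym (κ′-in y p)) eq))

      absent-out : ∀ {x i} → S x ≡ false → Absent E κ x i → Absent E κ′ x i
      absent-out p absent y e eq = absent y e (trans (sym (κ′-out y p)) eq)

      absent-other : ∀ {x i} → ¬ OneOf i → Absent E κ x i → Absent E κ′ x i
      absent-other {x} ¬one absent y e eq with S x in p
      ... | true = absent y e (swap-injective (trans eq (sym (swap-outside ¬one))))
      ... | false = absent y e eq

  module Vizing (c₀ : G ⇉ Fin 3) (c₀-inj : Injective-at G c₀) where

    -- `c₀` numbers the edges at `x` by three numbers, and each of them blocks at most one of the
    -- four colours.
    absentAt : ∀ {E} → Sub E → ∀ κ x → Σ (Fin 4) (Absent E κ x)
    absentAt {E} sub κ x = let i , i-avoids = avoid Used used? functional ≤-refl in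
      i , λ y e q → i-avoids (c₀ x y) (y , e , q , refl)
      where
      Used : Fin 4 → Fin 3 → Set
      Used i j = Σ (V G) λ y → E x y ≡ true × κ x y ≡ i × c₀ x y ≡ j
      used? : ∀ i j → Dec (Used i j)
      used? i j = Fin.any? λ y → (E x y Bool.≟ true) ×-dec (κ x y Fin.≟ i) ×-dec (c₀ x y Fin.≟ j)
      functional : ∀ {i i′ j} → Used i j → Used i′ j → i ≡ i′
      functional (y , e , q , r) (y′ , e′ , q′ , r′) with c₀-inj (Sub.E⊆ sub e) (Sub.E⊆ sub e′) (trans r (sym r′))
      ... | refl = trans (sym q) q′

    -- The edge `xz` is not coloured yet, so its number blocks nothing and can be charged with the
    -- colour `i₀` instead.
    absentAt₂ : ∀ {E} → Sub E → ∀ κ {x z} → G ⊢ x ~ z → E x z ≡ false → ∀ i₀ → Σ (Fin 4) λ i → i ≢ i₀ × Absent E κ x i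
    absentAt₂ {E} sub κ {x} {z} xz xz∉E i₀ = let i , i-avoids = avoid Used used? functional ≤-refl in
      i , (λ q → i-avoids (c₀ x z) (inj₂ (q , refl))) , λ y e q → i-avoids (c₀ x y) (inj₁ (y , e , q , refl))
      where
      Used : Fin 4 → Fin 3 → Set
      Used i j = (Σ (V G) λ y → E x y ≡ true × κ x y ≡ i × c₀ x y ≡ j) ⊎ (i ≡ i₀ × c₀ x z ≡ j)
      used? : ∀ i j → Dec (Used i j)
      used? i j = (Fin.any? λ y → (E x y Bool.≟ true) ×-dec (κ x y Fin.≟ i) ×-dec (c₀ x y Fin.≟ j))
        ⊎-dec ((i Fin.≟ i₀) ×-dec (c₀ x z Fin.≟ j))
      functional : ∀ {i i′ j} → Used i j → Used i′ j → i ≡ i′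
      functional (inj₁ (y , e , q , r)) (inj₁ (y′ , e′ , q′ , r′)) with c₀-inj (Sub.E⊆ sub e) (Sub.E⊆ sub e′) (trans r (sym r′))
      ... | refl = trans (sym q) q′
      functional (inj₂ (q , _)) (inj₂ (q′ , _)) = trans q (sym q′)
      functional (inj₁ (y , e , _ , r)) (inj₂ (_ , r′)) with c₀-inj (Sub.E⊆ sub e) xz (trans r (sym r′))
      ... | refl = ⊥-elim (true≢false e xz∉E)
      functional (inj₂ (_ , r′)) (inj₁ (y , e , _ , r)) with c₀-inj (Sub.E⊆ sub e) xz (trans r (sym r′))
      ... | refl = ⊥-elim (true≢false e xz∉E)

    Coloured : EdgeSet → Set
    Coloured E = Σ Colours (Proper E)

    module Extend {E} (sub : Sub E) (u v : V G) (uv : G ⊢ u ~ v) (uv∉E : E u v ≡ false) where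
      open Sub sub

      u≢v : u ≢ v
      u≢v = adj-≢ G uv

      common : ∀ {κ i} → Proper E κ → Absent E κ u i → Absent E κ v i → Coloured (add u v E)
      common {κ} {i} pr p q = SetColour.set u v u≢v i κ , SetColour.set-proper u v u≢v i pr (λ _ → p _) (λ _ → q _)

      -- Recolouring the edge ux frees its colour for uv.
      recolour : ∀ {κ x i} → Proper E κ → E u x ≡ true → Absent E κ v (κ u x) → Absent E κ u i → Absent E κ x i → Coloured (add u v E)
      recolour {κ} {x} {i} pr ux∈E absent-v absent-u absent-x =
        common {set κ} {κ u x} (Proper-⊆ (λ {y} {z} → Add.add-old u x E {y} {z}) (set-proper pr (λ _ → absent-u _) (λ _ → absent-x _))) free-u free-v
        where
        u≢x : u ≢ x
        u≢x = adj-≢ G (E⊆ ux∈E)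
        open SetColour u x u≢x i
        v≢x : v ≢ x
        v≢x refl = true≢false ux∈E uv∉E
        free-u : Absent E (set κ) u (κ u x)
        free-u y e eq = go (y Fin.≟ x)
          where
          go : Dec (y ≡ x) → ⊥
          go (yes refl) = absent-u x ux∈E (trans (sym eq) (set-new κ (inj₁ (refl , refl))))
          go (no y≢x) = y≢x (Proper.κ-inj pr e ux∈E (trans (sym (set-old κ
            λ { (inj₁ (_ , q)) → y≢x q ; (inj₂ (q , _)) → u≢x q })) eq))
        free-v : Absent E (set κ) v (κ u x)
        free-v y e eq = absent-v y e (trans (sym (set-old κ
                λ { (inj₁ (q , _)) → u≢v (sym q) ; (inj₂ (q , _)) → v≢x q })) eq)

      -- u lacks α, v and x lack β, and at most two of these three are in one α-β-component.
      exchange : ∀ {κ x α β} (pr : Proper E κ) → E u x ≡ true → κ u x ≢ α → κ u x ≢ β → Absent E κ v (κ u x) →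
        Absent E κ u α → Absent E κ v β → Absent E κ x β → Coloured (add u v E)
      exchange {κ} {x} {α} {β} pr ux∈E ≢α ≢β absent-v u-α v-β x-β = go (S u) refl
        where
        open Kempe sub pr α β
        open From x true (absent-Miss true x-β)
        open Closed component
        open Exchange S (λ {k} → closed {k})
        v∉ : S u ≡ true → S v ≢ true
        v∉ u∈ v∈ with ends {true} v∈ (absent-Miss true v-β)
        ... | inj₁ refl = true≢false ux∈E uv∉E
        ... | inj₂ p with ends {false} u∈ (absent-Miss false u-α)
        ...   | inj₁ q = adj-≢ G (E⊆ ux∈E) q
        ...   | inj₂ q = u≢v (trans q (sym p))
        go : ∀ b → S u ≡ b → Coloured (add u v E)
        go true u∈ = common {κ′} κ′-proper (subst (Absent E κ′ u) swap-a (absent-in u∈ u-α))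
          (absent-out (¬-not (v∉ u∈)) v-β)
        go false u∉ = recolour {κ′} κ′-proper ux∈E
          (subst (Absent E κ′ v) (sym (κ′-out x u∉)) (absent-other (λ { (inj₁ p) → ≢α p ; (inj₂ p) → ≢β p }) absent-v))
          (absent-out u∉ u-α) (subst (Absent E κ′ x) swap-b (absent-in p∈S x-β))

      -- Since `uv` is uncoloured, each end lacks two colours. Without a common one these are all
      -- four: `j`, `j′` at `u` and `k`, `k′` at `v`. Let `ux` be the edge of colour `k` at `u` and
      -- `m` a colour absent at `x`. Either `u` lacks `m` too and `ux` can be recoloured, or
      -- `m = k′`, because `k` is present at `x`; then `v` and `x` lack the same colour and a Kempe
      -- exchange applies.
      extend : Coloured E → Coloured (add u v E)
      extend (κ , pr) with Fin.any? (λ i → absent? E κ u i ×-dec absent? E κ v i)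
      ... | yes (i , p , q) = common pr p q
      ... | no none = result
        where
        vu∉E : E v u ≡ false
        vu∉E = ¬-not (λ q → true≢false (E-sym q) uv∉E)
        result : Coloured (add u v E)
        result with absentAt sub κ u | absentAt sub κ v
        ... | j , u-j | k , v-k with absentAt₂ sub κ uv uv∉E j | absentAt₂ sub κ (adj-flip G uv) vu∉E k
        ...   | j′ , j′≢j , u-j′ | k′ , k′≢k , v-k′ with present {E} {κ} {u} {k} (λ p → none (k , p , v-k))
        ...     | x , ux∈E , refl with absentAt sub κ x
        ...       | m , x-m with absent? E κ u m
        ...         | yes u-m = recolour pr ux∈E v-k u-m x-m
        ...         | no ¬u-m = exchange pr ux∈E (apart u-j v-k ∘ sym) (λ p → k′≢k (trans (sym m≡k′) (sym p)))
                      v-k u-j (subst (Absent E κ v) (sym m≡k′) v-k′) x-m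
          where
          apart : ∀ {i i′} → Absent E κ u i → Absent E κ v i′ → i ≢ i′
          apart p q refl = none (_ , p , q)
          m≡k′ : m ≡ k′
          m≡k′ with pigeonhole-∈ (j ∷ j′ ∷ κ u x ∷ k′ ∷ [])
            (((j′≢j ∘ sym) ∷ apart u-j v-k ∷ apart u-j v-k′ ∷ []) ∷ (apart u-j′ v-k ∷ apart u-j′ v-k′ ∷ []) ∷
              ((k′≢k ∘ sym) ∷ []) ∷ [] ∷ []) refl m
          ... | here refl = ⊥-elim (¬u-m u-j)
          ... | there (here refl) = ⊥-elim (¬u-m u-j′)
          ... | there (there (here refl)) = ⊥-elim (x-m u (E-sym ux∈E) (sym (Proper.κ-sym pr ux∈E)))
          ... | there (there (there (here p))) = p

    vizing : Σ Colours (Proper (adj G))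
    vizing with edge-induction Coloured ((λ _ _ → zero) , record { κ-sym = λ () ; κ-inj = λ () }) (λ sub → Extend.extend sub)
    ... | _ , (κ , pr) , _ , covers = κ , Proper-⊆ covers pr

  module Bipartite {κ} (pr : Proper (adj G) κ) (α β : Fin 4) where

    full : Sub (adj G)
    full = record { E-sym = adj-flip G ; E⊆ = id }

    Alternating : EdgeSet → Set
    Alternating E = Σ (V G → Bool) λ o → ∀ {x y} → E x y ≡ true → κ x y ≡ α ⊎ κ x y ≡ β → o x ≢ o y

    module Extend {E} (sub : Sub E) (u v : V G) (uv : G ⊢ u ~ v) (uv∉E : E u v ≡ false)
        (o : V G → Bool) (alt : ∀ {x y} → E x y ≡ true → κ x y ≡ α ⊎ κ x y ≡ β → o x ≢ o y) where
      open Sub sub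

      prE : Proper E κ
      prE = Proper-⊆ E⊆ pr

      open Kempe sub prE α β

      unchanged : (κ u v ≡ α ⊎ κ u v ≡ β → o u ≢ o v) → Alternating (add u v E)
      unchanged new = o , add-elim u v (λ x y → OneOf (κ x y) → o x ≢ o y)
        (λ f p → f (subst OneOf (Proper.κ-sym pr (adj-flip G uv)) p) ∘ sym) new alt

      o-alternates : ∀ {k x y} → R k x y ≡ true → o x ≢ o y
      o-alternates {false} r with R-Link false r
      ... | e , p = alt e (inj₁ p)
      o-alternates {true} r with R-Link true r
      ... | e , p = alt e (inj₂ p)

      -- Both ends of `uv` lack its colour in `E`, so a path joining them inside `E` would be odd
      -- and give them different bits. Hence inverting the component of `u` leaves `v` alone.
      repaint : ∀ k → κ u v ≡ col k → o u ≡ o v → Alternating (add u v E)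
      repaint k kuv ou≡ov = o′ , add-elim u v (λ x y → OneOf (κ x y) → o′ x ≢ o′ y) (λ f _ → new ∘ sym) (λ _ → new) old
        where
        u-miss : Miss k u
        u-miss r with R-Link k r
        ... | e , p with Proper.κ-inj pr uv (E⊆ e) (trans kuv (sym p))
        ...   | refl = true≢false e uv∉E
        v-miss : Miss k v
        v-miss r with R-Link k r
        ... | e , p with Proper.κ-inj pr (adj-flip G uv) (E⊆ e) (trans (trans (sym (Proper.κ-sym pr uv)) kuv) (sym p))
        ...   | refl = true≢false (E-sym e) uv∉E
        open From u k u-miss
        open Closed component
        v∉S : S v ≡ false
        v∉S = separated component o (λ {k} → o-alternates {k}) (adj-≢ G uv ∘ sym) v-miss (sym ou≡ov)
        o′ : V G → Bool
        o′ x = S x xor o x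
        new : o′ u ≢ o′ v
        new eq rewrite p∈S | v∉S = not-¬ refl (trans ou≡ov (sym eq))
        S-link : ∀ {x y} → E x y ≡ true → OneOf (κ x y) → S x ≡ true → S y ≡ true
        S-link e (inj₁ p) = closed {false} (Link-R false e p)
        S-link e (inj₂ p) = closed {true} (Link-R true e p)
        S-≡ : ∀ {x y} → E x y ≡ true → OneOf (κ x y) → S x ≡ S y
        S-≡ {x} {y} e p with S x in q | S y in r
        ... | true | true = refl
        ... | false | false = refl
        ... | true | false = ⊥-elim (true≢false (S-link e p q) r)
        ... | false | true = ⊥-elim (true≢false (S-link (E-sym e) (subst OneOf (Proper.κ-sym prE e) p) r) q)
        old : ∀ {x y} → E x y ≡ true → OneOf (κ x y) → o′ x ≢ o′ y
        old {x} {y} e p eq = xor-≢ (S x) (alt e p) (trans eq (cong (_xor o y) (sym (S-≡ e p))))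

      extend : Alternating (add u v E)
      extend with oneOf? (κ u v) | o u Bool.≟ o v
      ... | no p | _ = unchanged (⊥-elim ∘ p)
      ... | yes _ | no ne = unchanged (λ _ → ne)
      ... | yes (inj₁ p) | yes q = repaint false p q
      ... | yes (inj₂ p) | yes q = repaint true p q

    bipartite : Σ (V G → Bool) λ o → ∀ {x y} → G ⊢ x ~ y → κ x y ≡ α ⊎ κ x y ≡ β → o x ≢ o y
    bipartite with edge-induction Alternating ((λ _ → false) , λ ())
                     (λ sub u v uv uv∉E (o , alt) → Extend.extend sub u v uv uv∉E o alt)
    ... | _ , (o , alt) , _ , covers = o , alt ∘ covers

lower : Fin 4 → Fin 3
lower zero = # 0
lower (suc zero) = # 1
lower (suc (suc zero)) = # 2
-- A dummy value: labels of edges are never `last₄`.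
lower (suc (suc (suc zero))) = # 0

inject-lower : ∀ {i} → i ≢ last₄ → inject₁ (lower i) ≡ i
inject-lower {zero} _ = refl
inject-lower {suc zero} _ = refl
inject-lower {suc (suc zero)} _ = refl
inject-lower {suc (suc (suc zero))} ne = ⊥-elim (ne refl)

-- The last colour class is a matching; its edges are labelled at each end by a colour absent there.
module Quartered (G : FinSimpleGraph) (c₀ : G ⇉ Fin 3) (c₀-inj : Injective-at G c₀)
    (κ : Proper₄.Colours G) (κ-proper : Proper₄.Proper G (adj G) κ) where
  open Proper₄ G
  open Vizing c₀ c₀-inj
  open Proper κ-proper

  gap : V G → Fin 4
  gap u = proj₁ (absentAt (Bipartite.full κ-proper last₄ last₄) κ u)

  gap-absent : ∀ u → Absent (adj G) κ u (gap u)
  gap-absent u = proj₂ (absentAt (Bipartite.full κ-proper last₄ last₄) κ u)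

  label : V G → Fin 4 → Fin 4
  label u i with i Fin.≟ last₄
  ... | yes _ = gap u
  ... | no _ = i

  label-other : ∀ u {i} → i ≢ last₄ → label u i ≡ i
  label-other u {i} p with i Fin.≟ last₄
  ... | yes q = ⊥-elim (p q)
  ... | no _ = refl

  -- A vertex on an edge of the last colour does not lack that colour, so its gap is one of the
  -- other three.
  label-≢ : ∀ {u v} → G ⊢ u ~ v → label u (κ u v) ≢ last₄
  label-≢ {u} {v} e q with κ u v Fin.≟ last₄
  ... | yes p = gap-absent u v e (trans p (sym q))
  ... | no ne = ne q

  c : G ⇉ Fin 3
  c u v = lower (label u (κ u v))

  inject-c : ∀ {u v} → G ⊢ u ~ v → inject₁ (c u v) ≡ label u (κ u v)
  inject-c e = inject-lower (label-≢ e)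

  c-inj : Injective-at G c
  c-inj {u} {v} {v′} e e′ eq with trans (sym (inject-c e)) (trans (cong inject₁ eq) (inject-c e′))
  ... | q with κ u v Fin.≟ last₄ | κ u v′ Fin.≟ last₄
  ...   | yes p | yes p′ = κ-inj e e′ (trans p (sym p′))
  ...   | no _ | no _ = κ-inj e e′ q
  ...   | yes _ | no _ = ⊥-elim (gap-absent u v′ e′ (sym q))
  ...   | no _ | yes _ = ⊥-elim (gap-absent u v e q)

  -- For each class its colour is paired with the last one. The edges of the last colour belong to
  -- all three unions, so there every bit alternates; on another edge the bit of its own class does.
  o : V G → Fin 3 → Bool
  o u d = proj₁ (Bipartite.bipartite κ-proper (inject₁ d) last₄) u

  o-≢ : ∀ {u v} d → G ⊢ u ~ v → κ u v ≡ inject₁ d ⊎ κ u v ≡ last₄ → o u d ≢ o v d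
  o-≢ d = proj₂ (Bipartite.bipartite κ-proper (inject₁ d) last₄)

  bits : ∀ {u v} → G ⊢ u ~ v →
    (c u v ≡ c v u × o u (c u v) ≢ o v (c u v)) ⊎ (c u v ≢ c v u × ∀ d → o u d ≢ o v d)
  bits {u} {v} e = go (κ u v Fin.≟ last₄) (c u v Fin.≟ c v u)
    where
    go : Dec (κ u v ≡ last₄) → Dec (c u v ≡ c v u) →
      (c u v ≡ c v u × o u (c u v) ≢ o v (c u v)) ⊎ (c u v ≢ c v u × ∀ d → o u d ≢ o v d)
    go (yes p) (yes q) = inj₁ (q , o-≢ (c u v) e (inj₂ p))
    go (yes p) (no ne) = inj₂ (ne , λ d → o-≢ d e (inj₂ p))
    go (no p) _ = inj₁
      ( cong lower (trans (label-other u p) (trans (κ-sym e) (sym (label-other v (p ∘ trans (κ-sym e))))))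
      , o-≢ (c u v) e (inj₁ (sym (trans (inject-c e) (label-other u p)))) )

-- Four-colour total labellings

abstract
  -- The labels must be a permutation of the three colours other than `b`, each position forbidding
  -- at most one of them. Hall's condition fails only if all three positions forbid the same colour.
  deranged : ∀ (b a₀ a₁ a₂ : Fin 4) → (a₀ ≡ a₁ → a₁ ≡ a₂ → a₀ ≡ b) →
    Σ (Fin 4) λ l₀ → Σ (Fin 4) λ l₁ → Σ (Fin 4) λ l₂ →
      (l₀ ≢ b × l₁ ≢ b × l₂ ≢ b) × (l₀ ≢ a₀ × l₁ ≢ a₁ × l₂ ≢ a₂) × (l₀ ≢ l₁ × l₀ ≢ l₂ × l₁ ≢ l₂)
  deranged = toWitness {a? = Fin.all? λ b → Fin.all? λ a₀ → Fin.all? λ a₁ → Fin.all? λ a₂ →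
    ((a₀ Fin.≟ a₁) →-dec (a₁ Fin.≟ a₂) →-dec (a₀ Fin.≟ b)) →-dec
    (Fin.any? λ l₀ → Fin.any? λ l₁ → Fin.any? λ l₂ →
      (¬? (l₀ Fin.≟ b) ×-dec ¬? (l₁ Fin.≟ b) ×-dec ¬? (l₂ Fin.≟ b)) ×-dec
      (¬? (l₀ Fin.≟ a₀) ×-dec ¬? (l₁ Fin.≟ a₁) ×-dec ¬? (l₂ Fin.≟ a₂)) ×-dec
      (¬? (l₀ Fin.≟ l₁) ×-dec ¬? (l₀ Fin.≟ l₂) ×-dec ¬? (l₁ Fin.≟ l₂)))} tt

Fin3-function : ∀ {A : Set} → A → A → A → Fin 3 → A
Fin3-function x y z zero = x
Fin3-function x y z (suc zero) = y
Fin3-function x y z (suc (suc zero)) = z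

Fin3-all : ∀ {P : Fin 3 → Set} → P (# 0) → P (# 1) → P (# 2) → ∀ i → P i
Fin3-all x y z zero = x
Fin3-all x y z (suc zero) = y
Fin3-all x y z (suc (suc zero)) = z

-- A label seen by all three neighbours may be taken as the colour of the vertex: no neighbour uses it as its own colour.
compatible : ∀ (β a : Fin 3 → Fin 4) → (∀ i → a i ≢ β i) →
  Σ (Fin 4) λ b → Σ (Fin 3 → Fin 4) λ l → (∀ i → b ≢ β i) × (∀ i → l i ≢ b) × (∀ i → l i ≢ a i) × Injective _≡_ _≡_ l
compatible β a a≢β = finish hub
  where
  hub : Σ (Fin 4) λ b → (∀ i → b ≢ β i) × (a (# 0) ≡ a (# 1) → a (# 1) ≡ a (# 2) → a (# 0) ≡ b)
  hub with a (# 0) Fin.≟ a (# 1) | a (# 1) Fin.≟ a (# 2)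
  ... | yes p | yes q = a (# 0) ,
        Fin3-all (a≢β (# 0)) (λ r → a≢β (# 1) (trans (sym p) r)) (λ r → a≢β (# 2) (trans (sym q) (trans (sym p) r))) ,
        λ _ _ → refl
  ... | no p | _ = let b , b-fresh = fresh (β (# 0) ∷ β (# 1) ∷ β (# 2) ∷ []) ≤-refl in
        b , Fin3-all (b-fresh (# 0)) (b-fresh (# 1)) (b-fresh (# 2)) , λ q _ → ⊥-elim (p q)
  ... | yes _ | no p = let b , b-fresh = fresh (β (# 0) ∷ β (# 1) ∷ β (# 2) ∷ []) ≤-refl in
        b , Fin3-all (b-fresh (# 0)) (b-fresh (# 1)) (b-fresh (# 2)) , λ _ q → ⊥-elim (p q)
  finish : (Σ (Fin 4) λ b → (∀ i → b ≢ β i) × (a (# 0) ≡ a (# 1) → a (# 1) ≡ a (# 2) → a (# 0) ≡ b)) →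
    Σ (Fin 4) λ b → Σ (Fin 3 → Fin 4) λ l → (∀ i → b ≢ β i) × (∀ i → l i ≢ b) × (∀ i → l i ≢ a i) × Injective _≡_ _≡_ l
  finish (b , b≢β , b-a) with deranged b (a (# 0)) (a (# 1)) (a (# 2)) b-a
  ... | l₀ , l₁ , l₂ , (p₀ , p₁ , p₂) , (q₀ , q₁ , q₂) , (r₀₁ , r₀₂ , r₁₂) =
    b , l , b≢β , Fin3-all p₀ p₁ p₂ , Fin3-all q₀ q₁ q₂ , λ {i} {j} → inj i j
    where
    l : Fin 3 → Fin 4
    l = Fin3-function l₀ l₁ l₂
    inj : ∀ i j → l i ≡ l j → i ≡ j
    inj zero zero _ = refl
    inj zero (suc zero) eq = ⊥-elim (r₀₁ eq)
    inj zero (suc (suc zero)) eq = ⊥-elim (r₀₂ eq)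
    inj (suc zero) zero eq = ⊥-elim (r₀₁ (sym eq))
    inj (suc zero) (suc zero) _ = refl
    inj (suc zero) (suc (suc zero)) eq = ⊥-elim (r₁₂ eq)
    inj (suc (suc zero)) zero eq = ⊥-elim (r₀₂ (sym eq))
    inj (suc (suc zero)) (suc zero) eq = ⊥-elim (r₁₂ (sym eq))
    inj (suc (suc zero)) (suc (suc zero)) _ = refl

-- The values at the two ends must be chosen together: the pair is chosen at the smaller end and
-- read backwards from the other.
choose : ∀ (G : FinSimpleGraph) {A : Set} → A → (Rel : V G → V G → A → A → Set) →
  (∀ {u v a b} → Rel u v a b → Rel v u b a) → (∀ {u v} → G ⊢ u ~ v → Σ A λ a → Σ A λ b → Rel u v a b) →
  Σ (G ⇉ A) λ m → ∀ {u v} → G ⊢ u ~ v → Rel u v (m u v) (m v u)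
choose G {A} default Rel Rel-sym exist = m , m-Rel
  where
  pair : ∀ u v → Σ (A × A) λ p → G ⊢ u ~ v → Rel u v (proj₁ p) (proj₂ p)
  pair u v with adj G u v in eq
  ... | true = let a , b , r = exist eq in (a , b) , λ _ → r
  ... | false = (default , default) , λ ()
  m : G ⇉ A
  m u v with <-cmp (toℕ u) (toℕ v)
  ... | tri< _ _ _ = proj₁ (proj₁ (pair u v))
  ... | tri≈ _ _ _ = default
  ... | tri> _ _ _ = proj₂ (proj₁ (pair v u))
  m-Rel : ∀ {u v} → G ⊢ u ~ v → Rel u v (m u v) (m v u)
  m-Rel {u} {v} e with <-cmp (toℕ u) (toℕ v) | <-cmp (toℕ v) (toℕ u)
  ... | tri< _ _ _ | tri> _ _ _ = proj₂ (pair u v) e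
  ... | tri> _ _ _ | tri< _ _ _ = Rel-sym (proj₂ (pair v u) (adj-flip G e))
  ... | tri< a _ _ | tri< b _ _ = ⊥-elim (<-asym a b)
  ... | tri> _ _ a | tri> _ _ b = ⊥-elim (<-asym a b)
  ... | tri≈ _ q _ | _ = ⊥-elim (adj-≢ G e (Fin.toℕ-injective q))
  ... | _ | tri≈ _ q _ = ⊥-elim (adj-≢ G e (Fin.toℕ-injective (sym q)))

module Greedy (G : FinSimpleGraph) (c₀ : G ⇉ Fin 3) (c₀-inj : Injective-at G c₀) where

  -- The vertices below `j` have been treated. Conditions at a single vertex hold everywhere from
  -- the start, conditions along an edge only once both its ends have been treated.
  record Upto (j : ℕ) : Set where
    field
      β     : V G → Fin 4
      q     : G ⇉ Fin 4
      qβ    : ∀ {u v} → G ⊢ u ~ v → q u v ≢ β u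
      q-inj : Injective-at G q
      ββ    : ∀ {u v} → G ⊢ u ~ v → toℕ u < j → toℕ v < j → β u ≢ β v
      qq    : ∀ {u v} → G ⊢ u ~ v → toℕ u < j → toℕ v < j → q u v ≢ q v u

  initial : Upto 0
  initial = record
    { β = λ _ → zero
    ; q = λ u v → suc (c₀ u v)
    ; qβ = λ _ ()
    ; q-inj = λ e e′ eq → c₀-inj e e′ (Fin.suc-injective eq)
    ; ββ = λ _ ()
    ; qq = λ _ ()
    }

  module Next {j} (j<N : j < N G) (state : Upto j) where
    open Upto state

    v : V G
    v = fromℕ< j<N

    toℕ-v : toℕ v ≡ j
    toℕ-v = Fin.toℕ-fromℕ< j<N

    Earlier : Fin 3 → Set
    Earlier i = Σ (V G) λ y → G ⊢ v ~ y × toℕ y < j × c₀ v y ≡ i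

    earlier? : ∀ i → Dec (Earlier i)
    earlier? i = Fin.any? λ y → (adj G v y Bool.≟ true) ×-dec (toℕ y <? j) ×-dec (c₀ v y Fin.≟ i)

    seen : ∀ {i} → Dec (Earlier i) → Fin 4 × Fin 4
    seen (yes (y , _)) = β y , q y v
    -- Dummies for an arm without a treated neighbour; they are distinct, as `compatible` requires.
    seen (no _) = # 0 , # 1

    seen-≢ : ∀ {i} (d : Dec (Earlier i)) → proj₂ (seen d) ≢ proj₁ (seen d)
    seen-≢ (yes (y , e , _)) = qβ (adj-flip G e)
    seen-≢ (no _) ()

    seen-at : ∀ {y} → G ⊢ v ~ y → toℕ y < j → (d : Dec (Earlier (c₀ v y))) → seen d ≡ (β y , q y v)
    seen-at e y<j (yes (y′ , e′ , _ , p)) with c₀-inj e′ e p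
    ... | refl = refl
    seen-at e y<j (no none) = ⊥-elim (none (_ , e , y<j , refl))

    b : Fin 4
    l : Fin 3 → Fin 4
    b≢ : ∀ i → b ≢ proj₁ (seen (earlier? i))
    l≢b : ∀ i → l i ≢ b
    l≢ : ∀ i → l i ≢ proj₂ (seen (earlier? i))
    l-inj : Injective _≡_ _≡_ l
    found : Σ (Fin 4) λ b → Σ (Fin 3 → Fin 4) λ l → (∀ i → b ≢ proj₁ (seen (earlier? i))) × (∀ i → l i ≢ b) ×
      (∀ i → l i ≢ proj₂ (seen (earlier? i))) × Injective _≡_ _≡_ l
    found = compatible (λ i → proj₁ (seen (earlier? i))) (λ i → proj₂ (seen (earlier? i))) (λ i → seen-≢ (earlier? i))
    b = proj₁ found
    l = proj₁ (proj₂ found)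
    b≢ = proj₁ (proj₂ (proj₂ found))
    l≢b = proj₁ (proj₂ (proj₂ (proj₂ found)))
    l≢ = proj₁ (proj₂ (proj₂ (proj₂ (proj₂ found))))
    l-inj = proj₂ (proj₂ (proj₂ (proj₂ (proj₂ found))))

    β′ : V G → Fin 4
    β′ x with x Fin.≟ v
    ... | yes _ = b
    ... | no _ = β x

    q′ : G ⇉ Fin 4
    q′ x y with x Fin.≟ v
    ... | yes _ = l (c₀ x y)
    ... | no _ = q x y

    before : ∀ {x} → toℕ x < suc j → x ≢ v → toℕ x < j
    before x<sj x≢v = ≤∧≢⇒< (s≤s⁻¹ x<sj) (λ p → x≢v (Fin.toℕ-injective (trans p (sym toℕ-v))))

    next : Upto (suc j)
    next .Upto.β = β′
    next .Upto.q = q′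
    next .Upto.qβ {x} e with x Fin.≟ v
    ... | yes _ = l≢b _
    ... | no _ = qβ e
    next .Upto.q-inj {x} e e′ eq with x Fin.≟ v
    ... | yes _ = c₀-inj e e′ (l-inj eq)
    ... | no _ = q-inj e e′ eq
    next .Upto.ββ {x} {y} e x< y< eq with x Fin.≟ v | y Fin.≟ v
    ... | yes p | yes r = adj-≢ G e (trans p (sym r))
    ... | yes refl | no r = b≢ (c₀ v y) (trans eq (sym (cong proj₁ (seen-at e (before y< r) (earlier? _)))))
    ... | no r | yes refl = b≢ (c₀ v x) (trans (sym eq) (sym (cong proj₁ (seen-at (adj-flip G e) (before x< r) (earlier? _)))))
    ... | no p | no r = ββ e (before x< p) (before y< r) eq
    next .Upto.qq {x} {y} e x< y< eq with x Fin.≟ v | y Fin.≟ v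
    ... | yes p | yes r = adj-≢ G e (trans p (sym r))
    ... | yes refl | no r = l≢ (c₀ v y) (trans eq (sym (cong proj₂ (seen-at e (before y< r) (earlier? _)))))
    ... | no r | yes refl = l≢ (c₀ v x) (trans (sym eq) (sym (cong proj₂ (seen-at (adj-flip G e) (before x< r) (earlier? _)))))
    ... | no p | no r = qq e (before x< p) (before y< r) eq

  upto : ∀ j → j ≤ N G → Upto j
  upto zero _ = initial
  upto (suc j) j<N = Next.next j<N (upto j (<⇒≤ j<N))

  open Upto (upto (N G) ≤-refl)

  record Pair (u v : V G) (a b : Fin 4) : Set where
    constructor pair
    field
      left  : a ≢ β u × a ≢ q u v × a ≢ q v u
      right : b ≢ β v × b ≢ q v u × b ≢ q u v
      ≢     : a ≢ b

  -- Crossing over works in general: `β v` goes next to `u` and `β u` next to `v`. A choice blocked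
  -- by a `q`-label is replaced by a fresh colour. If both are blocked, the `q`-labels repeat the
  -- two hub colours and two colours remain.
  pair-exists : ∀ {u v} → G ⊢ u ~ v → Σ (Fin 4) λ a → Σ (Fin 4) λ b → Pair u v a b
  pair-exists {u} {v} e = go (β v Fin.≟ q u v) (β u Fin.≟ q v u)
    where
    e′ = adj-flip G e
    βu≢βv : β u ≢ β v
    βu≢βv = ββ e (Fin.toℕ<n u) (Fin.toℕ<n v)
    go : Dec (β v ≡ q u v) → Dec (β u ≡ q v u) → Σ (Fin 4) λ a → Σ (Fin 4) λ b → Pair u v a b
    go (no p) (no r) = β v , β u , pair (βu≢βv ∘ sym , p , qβ e′ ∘ sym) (βu≢βv , r , qβ e ∘ sym) (βu≢βv ∘ sym)
    go (no p) (yes _) = let b , b-fresh = fresh (β v ∷ q v u ∷ q u v ∷ []) ≤-refl in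
      β v , b , pair (βu≢βv ∘ sym , p , qβ e′ ∘ sym) (b-fresh (# 0) , b-fresh (# 1) , b-fresh (# 2)) (b-fresh (# 0) ∘ sym)
    go (yes _) (no r) = let a , a-fresh = fresh (β u ∷ q u v ∷ q v u ∷ []) ≤-refl in
      a , β u , pair (a-fresh (# 0) , a-fresh (# 1) , a-fresh (# 2)) (βu≢βv , r , qβ e ∘ sym) (a-fresh (# 0))
    go (yes p) (yes r) =
      let a , a-fresh = fresh (β u ∷ β v ∷ β v ∷ []) ≤-refl
          b , b-fresh = fresh (β u ∷ β v ∷ a ∷ []) ≤-refl
      in a , b , pair (a-fresh (# 0) , subst (a ≢_) p (a-fresh (# 1)) , subst (a ≢_) r (a-fresh (# 0)))
                      (b-fresh (# 1) , subst (b ≢_) r (b-fresh (# 0)) , subst (b ≢_) p (b-fresh (# 1))) (b-fresh (# 2) ∘ sym)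

  quad : Quad G
  quad with choose G zero Pair (λ (pair p r ne) → pair r p (ne ∘ sym)) pair-exists
  ... | m , m-Pair = record
    { β = β
    ; q = q
    ; m = m
    ; qβ = qβ
    ; qq = λ {u} {v} e → qq e (Fin.toℕ<n u) (Fin.toℕ<n v)
    ; q-inj = λ e e′ v≢v′ eq → v≢v′ (q-inj e e′ eq)
    ; mβ = λ e → proj₁ (Pair.left (m-Pair e))
    ; mq = λ e → proj₁ (proj₂ (Pair.left (m-Pair e)))
    ; mq′ = λ e → proj₂ (proj₂ (Pair.left (m-Pair e)))
    ; mm = λ e → Pair.≢ (m-Pair e)
    }

-- Degrees

module Degrees (G : FinSimpleGraph) where

  adjacent? : ∀ v w → Dec (G ⊢ v ~ w)
  adjacent? v w = adj G v w Bool.≟ true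

  neighbours : V G → List (V G)
  neighbours v = filter (adjacent? v) (allFin (N G))

  neighbours-unique : ∀ v → Unique (neighbours v)
  neighbours-unique v = Unique.filter⁺ (adjacent? v) (Unique.allFin⁺ (N G))

  neighbours-adj : ∀ {v w} → w ∈ neighbours v → G ⊢ v ~ w
  neighbours-adj {v} w∈ = proj₂ (Mem.∈-filter⁻ (adjacent? v) {xs = allFin (N G)} w∈)

  adj-neighbours : ∀ {v w} → G ⊢ v ~ w → w ∈ neighbours v
  adj-neighbours {v} {w} = Mem.∈-filter⁺ (adjacent? v) (Mem.∈-allFin w)

  count : ∀ v (xs : List (V G)) → sum (List.map (λ w → boolToℕ (adj G v w)) xs) ≡ length (filter (adjacent? v) xs)
  count v [] = refl
  count v (x ∷ xs) with adj G v x
  ... | true = cong suc (count v xs)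
  ... | false = count v xs

  degree-length : ∀ v → degree G v ≡ length (neighbours v)
  degree-length v = count v (allFin (N G))

  module _ {Δ} (bound : ∀ v → degree G v ≤ suc Δ) where

    rank : ∀ v {w} → Dec (w ∈ neighbours v) → Fin (suc Δ)
    rank v (yes p) = inject≤ (Any.index p) (subst (_≤ suc Δ) (degree-length v) (bound v))
    rank v (no _) = zero

    rank-inj : ∀ v {w w′} (p : Dec (w ∈ neighbours v)) (q : Dec (w′ ∈ neighbours v)) →
      w ∈ neighbours v → w′ ∈ neighbours v → rank v p ≡ rank v q → w ≡ w′
    rank-inj v (no p) _ w∈ _ _ = ⊥-elim (p w∈)
    rank-inj v (yes _) (no q) _ w′∈ _ = ⊥-elim (q w′∈)
    rank-inj v (yes p) (yes q) _ _ eq =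
      trans (Any.lookup-index p) (trans (cong (List.lookup (neighbours v)) (Fin.inject≤-injective _ _ _ _ eq)) (sym (Any.lookup-index q)))

    labels : Σ (G ⇉ Fin (suc Δ)) (Injective-at G)
    labels = (λ v w → rank v (Any.any? (w Fin.≟_) (neighbours v))) ,
      λ {u} {v} {v′} e e′ → rank-inj u (Any.any? (v Fin.≟_) (neighbours u)) (Any.any? (v′ Fin.≟_) (neighbours u))
        (adj-neighbours e) (adj-neighbours e′)

  Star : ℕ → Set
  Star Δ = Σ (V G) λ v → Σ (Fin Δ → V G) λ nbr → Injective _≡_ _≡_ nbr × (∀ j → G ⊢ v ~ (nbr j))

  star : ∀ v → Star (degree G v)
  star v = subst Star (sym (degree-length v))
    (v , List.lookup (neighbours v) , lookup-injective (neighbours-unique v) , λ j → neighbours-adj (Mem.∈-lookup j))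

  below-max : ∀ (f : V G → ℕ) {x} xs → x ∈ xs → f x ≤ foldr _⊔_ 0 (List.map f xs)
  below-max f (y ∷ ys) (here refl) = m≤m⊔n (f y) _
  below-max f (y ∷ ys) (there p) = ≤-trans (below-max f ys p) (m≤n⊔m (f y) _)

  attained : ∀ (f : V G → ℕ) xs → 1 ≤ foldr _⊔_ 0 (List.map f xs) → Σ (V G) λ x → f x ≡ foldr _⊔_ 0 (List.map f xs)
  attained f (y ∷ ys) p with ⊔-sel (f y) (foldr _⊔_ 0 (List.map f ys))
  ... | inj₁ q = y , sym q
  ... | inj₂ q = let x , r = attained f ys (subst (1 ≤_) q p) in x , trans r (sym q)

  degree≤max : ∀ v → degree G v ≤ maxDegree G
  degree≤max v = below-max (degree G) (allFin (N G)) (Mem.∈-allFin v)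

  maxStar : 1 ≤ maxDegree G → Star (maxDegree G)
  maxStar p = let v , q = attained (degree G) (allFin (N G)) p in subst Star q (star v)

-- Colouring with Δ k + 1 colours

halve : ∀ n → Σ ℕ λ h → n ≡ h + h ⊎ n ≡ suc (h + h)
halve zero = 0 , inj₁ refl
halve (suc n) with halve n
... | h , inj₁ p = h , inj₂ (cong suc p)
... | h , inj₂ p = suc h , inj₁ (trans (cong suc p) (cong suc (sym (+-suc h h))))

-- The share of the middle that each end describes; for odd `r` the central vertex belongs to both
-- shares.
half-up : ∀ r → Σ ℕ λ H → H + H ≤ suc r × r ≤ H + H
half-up r with halve r
... | h , inj₁ refl = h , n≤1+n _ , ≤-refl
... | h , inj₂ refl = suc h , ≤-reflexive (cong suc (+-suc h h)) , ≤-trans (s≤s (+-monoʳ-≤ h (n≤1+n h))) ≤-refl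

module Colouring (G : FinSimpleGraph) where

  monochrome : ∀ {Δ K r H} → H + H ≤ suc r → r ≤ H + H → Blocks G Δ K r H → Pathwise G (Fin (suc (Δ * K))) (K + K + suc r) (K + K)
  monochrome {Δ} {K} {r} {H} 2H≤ ≤2H 𝒟 = Join.joined (Monochrome.coded 𝒟)
    (linear 3 (λ k r H → H :+ H :≤ 1+ r :⇒ goal (k :+ H :+ (k :+ H) :≤ k :+ k :+ (1+ r))) K r H 2H≤)
    (linear 3 (λ k r H → r :≤ H :+ H :⇒ goal (k :+ k :+ (1+ r) :≤ 1+ (k :+ H :+ (k :+ H)))) K r H ≤2H)
    (linear 2 (λ k r → goal (k :+ k :< k :+ k :+ (1+ r))) K r)

  fourchrome : ∀ {K r H} → H + H ≤ suc r → r ≤ H + H → K ≤ r → r ≤ K + K → Quad G → Blocks G 3 K r H →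
    Pathwise G (Fin (suc (3 * suc K))) (suc K + suc K + suc (2 + r)) (suc K + suc K)
  fourchrome {K} {r} {H} 2H≤ ≤2H K≤r r≤2K 𝒬 𝒟 =
    subst (λ s → Pathwise G (Fin (suc s)) (suc K + suc K + suc (2 + r)) (suc K + suc K)) (sym (*-suc 3 K))
      (Join.joined (Fourchrome.coded 𝒟 𝒬 K≤r r≤2K 2H≤)
        (linear 3 (λ k r H → H :+ H :≤ 1+ r :⇒
          goal (con 2 :+ k :+ H :+ (con 2 :+ k :+ H) :≤ 1+ k :+ (1+ k) :+ (con 3 :+ r))) K r H 2H≤)
        (linear 3 (λ k r H → r :≤ H :+ H :⇒
          goal (1+ k :+ (1+ k) :+ (con 3 :+ r) :≤ 1+ (con 2 :+ k :+ H :+ (con 2 :+ k :+ H)))) K r H ≤2H)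
        (linear 2 (λ k r → goal (1+ k :+ (1+ k) :< 1+ k :+ (1+ k) :+ (con 3 :+ r))) K r))

  module ManyClasses {Δ} (4≤Δ : 4 ≤ Δ) (c₀ : G ⇉ Fin Δ) (c₀-inj : Injective-at G c₀) where

    coloured : ∀ k r → r ≤ k + k → Pathwise G (Fin (suc (Δ * k))) (k + k + suc r) (k + k)
    coloured k r r≤2k with half-up r | König.opposed G (≤-trans (s≤s (s≤s z≤n)) 4≤Δ) c₀ c₀-inj
    ... | H , 2H≤ , ≤2H | c , c-inj , c-opp = monochrome 2H≤ ≤2H
      (TwoThirds.twoThirds 2H≤ H≤k c (proj₁ thirds) c-inj c-opp
        (λ e → proj₁ (proj₂ thirds e)) (λ e → proj₂ (proj₂ (proj₂ thirds e))))
      where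
      H≤k : H ≤ k
      H≤k = ≮⇒≥ λ k<H → linear 3 (λ k r H → H :+ H :≤ 1+ r :⇒ r :≤ k :+ k :⇒ k :< H :⇒ goal absurd) k r H 2H≤ r≤2k k<H
      Rel : V G → V G → Fin Δ → Fin Δ → Set
      Rel u v a b = (a ≢ c u v × a ≢ c v u) × (b ≢ c v u × b ≢ c u v) × a ≢ b
      exist : ∀ {u v} → G ⊢ u ~ v → Σ (Fin Δ) λ a → Σ (Fin Δ) λ b → Rel u v a b
      exist {u} {v} _ =
        let a , a-fresh = fresh (c u v ∷ c v u ∷ []) (≤-trans (n≤1+n 3) 4≤Δ)
            b , b-fresh = fresh (c u v ∷ c v u ∷ a ∷ []) 4≤Δ
        in a , b , (a-fresh (# 0) , a-fresh (# 1)) , (b-fresh (# 1) , b-fresh (# 0)) , b-fresh (# 2) ∘ sym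
      thirds : Σ (G ⇉ Fin Δ) λ y → ∀ {u v} → G ⊢ u ~ v → Rel u v (y u v) (y v u)
      thirds = choose G (fromℕ< (≤-trans (s≤s z≤n) 4≤Δ)) Rel (λ (p , q , ne) → q , p , ne ∘ sym) exist

  module ThreeClasses (c₀ : G ⇉ Fin 3) (c₀-inj : Injective-at G c₀) where

    short : ∀ {K r H} → H + H ≤ suc r → r ≤ K → Blocks G 3 K r H
    short {K} {r} {H} 2H≤ r≤K with Thirds.alternating G c₀ c₀-inj
    ... | c , o , c-inj , c-opp , good = OneThird.oneThird 2H≤ r≤K c y o c-inj c-opp (λ _ → y-class)
        (λ {u} {v} e p → subst (λ d → o u (y u v) ≢ o v d) p (good e (y u v) (proj₁ y-class) (proj₂ y-class)))
      where
      y : G ⇉ Fin 3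
      y u v = proj₁ (fresh (c u v ∷ c v u ∷ []) ≤-refl)
      y-class : ∀ {u v} → y u v ≢ c u v × y u v ≢ c v u
      y-class {u} {v} = let p = proj₂ (fresh (c u v ∷ c v u ∷ []) ≤-refl) in p (# 0) , p (# 1)

    long : ∀ {K E H} → H + H ≤ suc (K + (E + E)) → 1 ≤ E → E + E ≤ K → Blocks G 3 K (K + (E + E)) H
    long {K} {E} {H} 2H≤ 1≤E 2E≤K with Proper₄.Vizing.vizing G c₀ c₀-inj
    ... | κ , κ-proper = AnyEnds.blocks 2H≤ 1≤E 2E≤K c (proj₁ thirds) o c-inj bits
        (λ e → proj₁ (proj₂ thirds e)) (λ e → proj₂ (proj₂ (proj₂ thirds e)))
      where
      open Quartered G c₀ c₀-inj κ κ-proper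
      Rel : V G → V G → Fin 3 → Fin 3 → Set
      Rel u v a b = (a ≢ c u v × a ≢ c v u) × (b ≢ c v u × b ≢ c u v) × (c u v ≡ c v u → a ≢ b)
      exist : ∀ {u v} → G ⊢ u ~ v → Σ (Fin 3) λ a → Σ (Fin 3) λ b → Rel u v a b
      exist {u} {v} _ with c u v Fin.≟ c v u | fresh (c u v ∷ c v u ∷ []) ≤-refl
      ... | no ne | a , a-fresh = a , a , (a-fresh (# 0) , a-fresh (# 1)) , (a-fresh (# 1) , a-fresh (# 0)) , ⊥-elim ∘ ne
      ... | yes eq | a , a-fresh = let b , b-fresh = fresh (c u v ∷ a ∷ []) ≤-refl in
        a , b , (a-fresh (# 0) , a-fresh (# 1)) , (subst (b ≢_) eq (b-fresh (# 0)) , b-fresh (# 0)) , λ _ → b-fresh (# 1) ∘ sym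
      thirds : Σ (G ⇉ Fin 3) λ y → ∀ {u v} → G ⊢ u ~ v → Rel u v (y u v) (y v u)
      thirds = choose G zero Rel (λ (p , q , ne) → q , p , λ eq → ne (sym eq) ∘ sym) exist

    Goal : ℕ → ℕ → Set
    Goal k r = Pathwise G (Fin (suc (3 * k))) (k + k + suc r) (k + k)

    even : ∀ k E → 1 ≤ E → E + E ≤ k → Goal k (k + (E + E))
    even k E 1≤E 2E≤k with half-up (k + (E + E))
    ... | H , 2H≤ , ≤2H = monochrome {H = H} 2H≤ ≤2H (long 2H≤ 1≤E 2E≤k)

    -- Here `K = k - 1`: the four special colours replace one level of each class and the hub
    -- colour. The middle left for the classes exceeds `K` by the even number `2E`; for `E = 0` it
    -- falls under the case `r ≤ K`.
    odd : ∀ K E → E + E ≤ K → Goal (suc K) (2 + (K + (E + E)))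
    odd K E 2E≤K with half-up (K + (E + E))
    ... | H , 2H≤ , ≤2H = fourchrome 2H≤ ≤2H (m≤m+n K _) (+-monoʳ-≤ K 2E≤K) (Greedy.quad G c₀ c₀-inj) (blocks E 2E≤K 2H≤)
      where
      blocks : ∀ E → E + E ≤ K → H + H ≤ suc (K + (E + E)) → Blocks G 3 K (K + (E + E)) H
      blocks zero _ 2H≤ = short 2H≤ (≤-reflexive (+-identityʳ K))
      blocks (suc E) 2E≤K 2H≤ = long 2H≤ (s≤s z≤n) 2E≤K

    beyond : ∀ k e → 1 ≤ e → e ≤ k → Goal k (k + e)
    beyond k e 1≤e e≤k with halve e
    beyond k e () e≤k | zero , inj₁ refl
    beyond k e 1≤e e≤k | suc E , inj₁ refl = even k (suc E) (s≤s z≤n) e≤k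
    beyond zero e 1≤e () | E , inj₂ refl
    beyond (suc K) e 1≤e e≤k | E , inj₂ refl = subst (Goal (suc K)) (cong suc (sym (+-suc K (E + E)))) (odd K E (s≤s⁻¹ e≤k))

    coloured : ∀ k r → r ≤ k + k → Goal k r
    coloured k r r≤2k with r ≤? k
    ... | yes r≤k = let H , 2H≤ , ≤2H = half-up r in monochrome {H = H} 2H≤ ≤2H (short 2H≤ r≤k)
    ... | no r≰k = subst (Goal k) q (beyond k (r ∸ k) (m<n⇒0<n∸m (≰⇒> r≰k)) (≤-trans (∸-monoˡ-≤ k r≤2k) (≤-reflexive (m+n∸m≡n k k))))
      where q = m+[n∸m]≡n (<⇒≤ (≰⇒> r≰k))

  base : ∀ {Δ} → 3 ≤ Δ → (c₀ : G ⇉ Fin Δ) → Injective-at G c₀ →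
    ∀ k r → r ≤ k + k → Pathwise G (Fin (suc (Δ * k))) (k + k + suc r) (k + k)
  base {suc zero} (s≤s ())
  base {suc (suc zero)} (s≤s (s≤s ()))
  base {suc (suc (suc zero))} _ = ThreeClasses.coloured
  base {suc (suc (suc (suc Δ)))} _ = ManyClasses.coloured (s≤s (s≤s (s≤s (s≤s z≤n))))

  lengthened : ∀ {A n w} p → w < n → Pathwise G A n w → w < p * suc w + n × Pathwise G A (p * suc w + n) w
  lengthened zero w<n 𝒫 = w<n , 𝒫
  lengthened {A} {n} {w} (suc p) w<n 𝒫 with lengthened p w<n 𝒫
  ... | w<n′ , 𝒫′ = ≤-trans w<n′ (+-monoˡ-≤ n (m≤n+m (p * suc w) (suc w))) ,
    subst (λ n → Pathwise G A n w) (sym (+-assoc (suc w) (p * suc w) n)) (Lengthen.lengthen 𝒫′ w<n′)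

  pathwise : ∀ {Δ} → 3 ≤ Δ → (c₀ : G ⇉ Fin Δ) → Injective-at G c₀ →
    ∀ k {n} → k + k < n → Pathwise G (Fin (suc (Δ * k))) n (k + k)
  pathwise {Δ} 3≤Δ c₀ c₀-inj k {n} w<n = subst (λ n → Pathwise G (Fin (suc (Δ * k))) n w) n≡
      (proj₂ (lengthened p (m<m+n w (s≤s z≤n)) (base 3≤Δ c₀ c₀-inj k (r % suc w) (s≤s⁻¹ (m%n<n r (suc w))))))
    where
    w r p : ℕ
    w = k + k
    r = n ∸ suc w
    p = r / suc w
    n≡ : p * suc w + (w + suc (r % suc w)) ≡ n
    n≡ = trans (linear 3 (λ a w b → goal (a :+ (w :+ (1+ b)) :≡ 1+ w :+ (b :+ a))) (p * suc w) w (r % suc w))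
      (trans (cong (suc w +_) (sym (m≡m%n+[m/n]*n r (suc w)))) (m+[n∸m]≡n w<n))

-- Equality of the chromatic and the clique number

even-case : (G : FinSimpleGraph) → 3 ≤ maxDegree G → (k n : ℕ) → k + k < n →
  Σ ℕ (λ ω → IsChromaticNumber (fracPower G (k + k) n) ω × IsCliqueNumber (fracPower G (k + k) n) ω)
even-case G 3≤Δ k (suc ν) w<n = go 3≤Δ degree≤max (maxStar (≤-trans (s≤s z≤n) 3≤Δ))
  where
  open Degrees G
  open Subdivision G ν using (module Ball)
  -- The maximum degree is generalised to a variable so that it can be matched as a successor:
  -- `labels` needs an inhabited set of labels for its default value.
  go : ∀ {Δ} → 3 ≤ Δ → (∀ v → degree G v ≤ Δ) → Star Δ →
    Σ ℕ (λ ω → IsChromaticNumber (fracPower G (k + k) (suc ν)) ω × IsCliqueNumber (fracPower G (k + k) (suc ν)) ω)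
  go {suc Δ} 3≤Δ bound (v , nbr , nbr-inj , nbr-adj) =
    suc (suc Δ * k) , Ball.perfect v nbr nbr-inj nbr-adj (≤-trans (m≤m+n k k) (<⇒≤ w<n))
      (Colouring.pathwise G 3≤Δ (proj₁ (labels bound)) (proj₂ (labels bound)) k w<n) (<⇒≤ w<n)

theorem1 : (G : FinSimpleGraph) → 3 ≤ maxDegree G →
    (m n : ℕ) → 1 < m → m < n → 2 ∣ m →
    Σ ℕ (λ k → IsChromaticNumber (fracPower G m n) k × IsCliqueNumber (fracPower G m n) k)
theorem1 G 3≤Δ m n _ m<n (divides k m≡k*2) with trans m≡k*2 (trans (*-comm k 2) (cong (k +_) (+-identityʳ k)))
... | refl = even-case G 3≤Δ k n m<n
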